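{- Let $\mathbb{F}$ be a field. Let $X$ be a simplicial complex and let $\Gamma$ be a finite collection of subcomplexes of $X$ such that $\bigcup\Gamma=X$. Let $\ell$ be an integer such that $-1\le\ell<|\Gamma|$. Suppose that $\widetilde{H}_{|\sigma|-2}\big(\bigcup\sigma,\mathbb{F}\big)=0$ for every simplex $\sigma\in N(\Gamma)$ of dimension at most $\ell$. Then $\dim\widetilde{H}_{\ell}(N(\Gamma),\mathbb{F})\le\dim\widetilde{H}_{\ell}(X,\mathbb{F})$.
   Context: Simplicial complexes are abstract and the empty set is not a simplex, so the minimal dimension of a simplex is $0$ (a complex may be empty). $\widetilde{H}$ denotes reduced simplicial homology; $\widetilde{H}_{ -1}(Y,\mathbb{F})=0$ if and only if $Y$ is nonempty. A collection allows repetitions, and cardinalities are counted with repetitions. For a finite collection $\Gamma$ of subcomplexes of a simplicial complex, the nerve $N(\Gamma)$ is the simplicial complex whose vertices are the subcomplexes in $\Gamma$ and whose simplices are the (nonempty) subcollections of $\Gamma$ with nonempty intersection. For $\sigma\in N(\Gamma)$, $|\sigma|$ is the number of members of $\sigma$ (so $\dim\sigma=|\sigma|-1$), and $\bigcup\sigma$ is the union of the subcomplexes in $\sigma$. -}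

module Defs where

open import Algebra.Bundles using (CommutativeMonoid; CommutativeRing; Semiring)
open import Algebra.Module.Bundles using (Module)
import Algebra.Module.Construct.Zero as ZeroModule
import Algebra.Module.Structures.Biased as Biased
import Algebra.Definitions.RawMonoid as RawMonoidSum
import Algebra.Definitions.RawSemiring as RawSemiringExp
import Algebra.Properties.CommutativeSemigroup as CommutativeSemigroupProperties
import Algebra.Properties.AbelianGroup as AbelianGroupProperties
import Relation.Binary.Reasoning.Setoid as SetoidReasoning
open import Data.Fin.Base using (Fin; zero; suc; toℕ)
open import Data.Integer.Base using (ℤ; +_; -[1+_]; _-_)
open import Data.List.Base using (List; []; _∷_; length)
open import Data.List.Membership.Propositional using (_∈_)
open import Data.List.Relation.Binary.Subset.Propositional using (_⊆_)
open import Data.List.Relation.Unary.Any using (here; there)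
open import Data.Nat.Base using (ℕ; zero; suc)
open import Data.Product.Base using (∃; _×_; _,_; proj₁)
open import Data.Unit.Polymorphic.Base using (⊤)
open import Data.Vec.Base using (Vec; []; _∷_; toList; removeAt)
open import Data.Vec.Relation.Unary.All using (All; []; _∷_)
open import Data.Vec.Relation.Unary.AllPairs using ([]; _∷_)
open import Data.Vec.Relation.Unary.Unique.Propositional using (Unique)
open import Function.Base using (_∘_; flip)
open import Level using (Level; _⊔_) renaming (suc to lsuc)
open import Relation.Binary.Core using (Rel)
open import Relation.Binary.Structures using (IsEquivalence)
open import Relation.Binary.PropositionalEquality.Core using (_≡_; _≢_; refl)
open import Relation.Nullary.Negation using (¬_; contradiction)
open import Relation.Unary using (Pred)

-- A finite vertex set is given by a list of its elements; since _⊆_ compares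
-- members only, `down-closed` also makes `Simplex` independent of the order
-- and the repetitions in the list.

record SimplicialComplex {v} (V : Set v) (p : Level) : Set (v ⊔ lsuc p) where
  field
    Simplex     : Pred (List V) p
    nonempty    : ¬ Simplex []
    down-closed : ∀ {s t} → Simplex s → t ⊆ s → t ≢ [] → Simplex t

open SimplicialComplex public using (Simplex)
open SimplicialComplex using (nonempty; down-closed)

infix 4 _⊆ᶜ_ _≐ᶜ_

_⊆ᶜ_ : ∀ {v p q} {V : Set v} → SimplicialComplex V p → SimplicialComplex V q → Set (v ⊔ p ⊔ q)
K ⊆ᶜ L = ∀ s → Simplex K s → Simplex L s

_≐ᶜ_ : ∀ {v p q} {V : Set v} → SimplicialComplex V p → SimplicialComplex V q → Set (v ⊔ p ⊔ q)
K ≐ᶜ L = K ⊆ᶜ L × L ⊆ᶜ K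

⋃ : ∀ {i v p} {I : Set i} {V : Set v} → (I → SimplicialComplex V p) → SimplicialComplex V (i ⊔ p)
⋃ Γ = record
  { Simplex     = λ s → ∃ λ i → Simplex (Γ i) s
  ; nonempty    = λ (i , s∈Γᵢ) → nonempty (Γ i) s∈Γᵢ
  ; down-closed = λ (i , s∈Γᵢ) t⊆s t≢[] → i , down-closed (Γ i) s∈Γᵢ t⊆s t≢[]
  }

⋃[_]_ : ∀ {i v p} {I : Set i} {V : Set v} →
        List I → (I → SimplicialComplex V p) → SimplicialComplex V (i ⊔ p)
⋃[ σ ] Γ = ⋃ {I = ∃ (_∈ σ)} (Γ ∘ proj₁)

-- The members of a collection with repetitions are its indices.  An
-- intersection of subcomplexes is nonempty when it contains a simplex.

Nerve : ∀ {i v p} {I : Set i} {V : Set v} → (I → SimplicialComplex V p) → SimplicialComplex I (i ⊔ v ⊔ p)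
Nerve {I = I} {V} Γ = record
  { Simplex     = λ σ → σ ≢ [] × (∃ λ (s : List V) → ∀ (i : I) → i ∈ σ → Simplex (Γ i) s)
  ; nonempty    = λ ([]≢[] , _) → []≢[] refl
  ; down-closed = λ (_ , s , s∈⋂) τ⊆σ τ≢[] → τ≢[] , s , λ i i∈τ → s∈⋂ i (τ⊆σ i∈τ)
  }

-- This is the dimension only when s has no repetitions.

dim : ∀ {v} {V : Set v} → List V → ℤ
dim s = + length s - + 1

module Presented {c ℓ g} (R : CommutativeRing c ℓ) (G : Set g) where

  private module R = CommutativeRing R

  infixr 7 _·_
  infixl 6 _⊕_

  data Term : Set (c ⊔ g) where
    gen : G → Term
    𝟎   : Term
    _⊕_ : Term → Term → Term
    ⊖_  : Term → Term
    _·_ : R.Carrier → Term → Term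

  module _ {q} (_~_ : Rel Term q) where

    infix 4 _≈_

    data _≈_ : Rel Term (c ⊔ ℓ ⊔ g ⊔ q) where
      relation   : ∀ {x y} → x ~ y → x ≈ y
      ≈-refl     : ∀ {x} → x ≈ x
      ≈-sym      : ∀ {x y} → x ≈ y → y ≈ x
      ≈-trans    : ∀ {x y z} → x ≈ y → y ≈ z → x ≈ z
      ⊕-cong     : ∀ {x x′ y y′} → x ≈ x′ → y ≈ y′ → x ⊕ y ≈ x′ ⊕ y′
      ⊕-assoc    : ∀ x y z → (x ⊕ y) ⊕ z ≈ x ⊕ (y ⊕ z)
      ⊕-comm     : ∀ x y → x ⊕ y ≈ y ⊕ x
      ⊕-identity : ∀ x → 𝟎 ⊕ x ≈ x
      ⊖-cong     : ∀ {x x′} → x ≈ x′ → ⊖ x ≈ ⊖ x′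
      ⊖-inverse  : ∀ x → ⊖ x ⊕ x ≈ 𝟎
      ·-cong     : ∀ {a a′ x x′} → a R.≈ a′ → x ≈ x′ → a · x ≈ a′ · x′
      ·-identity : ∀ x → R.1# · x ≈ x
      ·-assoc    : ∀ a b x → (a R.* b) · x ≈ a · (b · x)
      ·-distribˡ : ∀ a x y → a · (x ⊕ y) ≈ a · x ⊕ a · y
      ·-distribʳ : ∀ x a b → (a R.+ b) · x ≈ a · x ⊕ b · x
      ·-zeroˡ    : ∀ x → R.0# · x ≈ 𝟎
      ·-zeroʳ    : ∀ a → a · 𝟎 ≈ 𝟎

    ≈-isEquivalence : IsEquivalence _≈_
    ≈-isEquivalence = record { refl = ≈-refl ; sym = ≈-sym ; trans = ≈-trans }

    presentedModule : Module R (c ⊔ g) (c ⊔ ℓ ⊔ g ⊔ q)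
    presentedModule = record
      { Carrierᴹ = Term
      ; _≈ᴹ_     = _≈_
      ; _+ᴹ_     = _⊕_
      ; _*ₗ_     = _·_
      ; _*ᵣ_     = flip _·_
      ; 0ᴹ       = 𝟎
      ; -ᴹ_      = ⊖_
      ; isModule = Biased.IsModuleFromLeft.isModule {commutativeRing = R} (record
        { isLeftModule = record
          { isLeftSemimodule = record
            { +ᴹ-isCommutativeMonoid = record
              { isMonoid = record
                { isSemigroup = record
                  { isMagma = record { isEquivalence = ≈-isEquivalence ; ∙-cong = ⊕-cong }
                  ; assoc   = ⊕-assoc
                  }
                ; identity = ⊕-identity , λ x → ≈-trans (⊕-comm x 𝟎) (⊕-identity x)
                }
              ; comm = ⊕-comm
              }
            ; isPreleftSemimodule = record
              { *ₗ-cong      = ·-cong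
              ; *ₗ-zeroˡ     = ·-zeroˡ
              ; *ₗ-distribʳ  = ·-distribʳ
              ; *ₗ-identityˡ = ·-identity
              ; *ₗ-assoc     = ·-assoc
              ; *ₗ-zeroʳ     = ·-zeroʳ
              ; *ₗ-distribˡ  = ·-distribˡ
              }
            }
          ; -ᴹ‿cong    = ⊖-cong
          ; -ᴹ‿inverse = ⊖-inverse , λ x → ≈-trans (⊕-comm x (⊖ x)) (⊖-inverse x)
          }
        })
      }

module _ {r ℓ m ℓm} {R : CommutativeRing r ℓ} (M : Module R m ℓm) where

  private
    module R = CommutativeRing R
    module M = Module M

  Trivial : Set (m ⊔ ℓm)
  Trivial = ∀ x → x M.≈ᴹ M.0ᴹ

  linearCombination : ∀ {d} → (Fin d → R.Carrier) → (Fin d → M.Carrierᴹ) → M.Carrierᴹ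
  linearCombination a x = RawMonoidSum.sum M.+ᴹ-rawMonoid (λ i → a i M.*ₗ x i)

  LinearlyIndependent : ∀ {d} → (Fin d → M.Carrierᴹ) → Set (r ⊔ ℓ ⊔ ℓm)
  LinearlyIndependent x = ∀ a → linearCombination a x M.≈ᴹ M.0ᴹ → ∀ i → a i R.≈ R.0#

  DimAtLeast : ℕ → Set (r ⊔ ℓ ⊔ m ⊔ ℓm)
  DimAtLeast d = ∃ λ (x : Fin d → M.Carrierᴹ) → LinearlyIndependent x

-- The dimension, with values in ℕ ∪ {∞}, is the supremum of the sizes of the
-- finite linearly independent families; suprema are compared by comparing the
-- sets of natural numbers below them.

_dim≤_ : ∀ {r ℓ m ℓm n ℓn} {R : CommutativeRing r ℓ} →
         Module R m ℓm → Module R n ℓn → Set (r ⊔ ℓ ⊔ m ⊔ ℓm ⊔ n ⊔ ℓn)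
M dim≤ N = ∀ d → DimAtLeast M d → DimAtLeast N d

Face : ∀ {v p} {V : Set v} → SimplicialComplex V p → Pred (List V) p
Face K []        = ⊤
Face K s@(_ ∷ _) = Simplex K s

Face-down-closed : ∀ {v p} {V : Set v} (K : SimplicialComplex V p) {s t : List V} →
                   Face K s → t ⊆ s → Face K t
Face-down-closed K {_}     {[]}    _   _   = _
Face-down-closed K {[]}    {x ∷ t} _   t⊆s = contradiction (t⊆s (here refl)) λ ()
Face-down-closed K {_ ∷ _} {x ∷ t} s∈K t⊆s = down-closed K s∈K t⊆s λ ()

module _ {v} {V : Set v} where

  removeAt-⊆ : ∀ {m} (s : Vec V (suc m)) i → toList (removeAt s i) ⊆ toList s
  removeAt-⊆ (x ∷ s)         zero    y∈         = there y∈
  removeAt-⊆ (x ∷ s@(_ ∷ _)) (suc i) (here eq)  = here eq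
  removeAt-⊆ (x ∷ s@(_ ∷ _)) (suc i) (there y∈) = there (removeAt-⊆ s i y∈)

  removeAt-All : ∀ {m q} {P : Pred V q} {s : Vec V (suc m)} → All P s → ∀ i → All P (removeAt s i)
  removeAt-All (px ∷ ps)         zero    = ps
  removeAt-All (px ∷ ps@(_ ∷ _)) (suc i) = px ∷ removeAt-All ps i

  removeAt-Unique : ∀ {m} {s : Vec V (suc m)} → Unique s → ∀ i → Unique (removeAt s i)
  removeAt-Unique (x∉s ∷ s!)         zero    = s!
  removeAt-Unique (x∉s ∷ s!@(_ ∷ _)) (suc i) = removeAt-All x∉s i ∷ removeAt-Unique s! i

-- The parameter m is the number of vertices, so the dimension is m - 1; m = 0
-- gives the empty face, which is not a simplex but is used for augmentation.

record OrderedFace {v p} {V : Set v} (K : SimplicialComplex V p) (m : ℕ) : Set (v ⊔ p) where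
  constructor orderedFace
  field
    vertices : Vec V m
    distinct : Unique vertices
    isFace   : Face K (toList vertices)

open OrderedFace public

deleteVertex : ∀ {v p} {V : Set v} {K : SimplicialComplex V p} {m} →
               OrderedFace K (suc m) → Fin (suc m) → OrderedFace K m
deleteVertex {K = K} (orderedFace s s! s∈K) i =
  orderedFace (removeAt s i) (removeAt-Unique s! i) (Face-down-closed K s∈K (removeAt-⊆ s i))

data AdjacentTransposition {v} {V : Set v} : ∀ {m} → Rel (Vec V m) v where
  swap : ∀ {m} x y (s : Vec V m) → AdjacentTransposition (x ∷ y ∷ s) (y ∷ x ∷ s)
  skip : ∀ {m} x {s t : Vec V m} → AdjacentTransposition s t → AdjacentTransposition (x ∷ s) (x ∷ t)

module _ {c ℓ v p} (R : CommutativeRing c ℓ) {V : Set v} (K : SimplicialComplex V p) where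

  private module R = CommutativeRing R

  module _ (m : ℕ) where
    open Presented R (OrderedFace K m)

    -- Adjacent transpositions generate all permutations, so an odd permutation
    -- of the vertices of an oriented simplex changes its sign.

    data Orientation : Rel Term (c ⊔ v ⊔ p) where
      same    : ∀ {s t} → vertices s ≡ vertices t → Orientation (gen s) (gen t)
      swapped : ∀ {s t} → AdjacentTransposition (vertices s) (vertices t) →
                Orientation (gen s) (⊖ gen t)

    -- Chains are graded by number of vertices.  The chains on zero vertices,
    -- generated by the empty face, are the augmentation module in degree -1.

    chains : Module R (c ⊔ v ⊔ p) (c ⊔ ℓ ⊔ v ⊔ p)
    chains = presentedModule Orientation

  Chain : ℕ → Set (c ⊔ v ⊔ p)
  Chain m = Presented.Term R (OrderedFace K m)

  open Presented using (gen; 𝟎; _⊕_; ⊖_; _·_)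

  ∂ : ∀ {m} → Chain (suc m) → Chain m
  ∂ {m} (gen s) = linearCombination (chains m)
    (λ i → RawSemiringExp._^_ (Semiring.rawSemiring R.semiring) (R.- R.1#) (toℕ i)) (λ i → gen (deleteVertex s i))
  ∂ 𝟎           = 𝟎
  ∂ (x ⊕ y)     = ∂ x ⊕ ∂ y
  ∂ (⊖ x)       = ⊖ ∂ x
  ∂ (a · x)     = a · ∂ x

  IsCycle : ∀ {m} → Chain m → Set (c ⊔ ℓ ⊔ v ⊔ p)
  IsCycle {zero}  z = ⊤
  IsCycle {suc m} z = Module._≈ᴹ_ (chains m) (∂ z) 𝟎

  record Cycle (m : ℕ) : Set (c ⊔ ℓ ⊔ v ⊔ p) where
    constructor cycle
    field
      chain   : Chain m
      isCycle : IsCycle chain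

  open Cycle public

  infix 4 _∼_

  _∼_ : ∀ {m} → Rel (Chain m) (c ⊔ ℓ ⊔ v ⊔ p)
  _∼_ {m} z z′ = ∃ λ (w : Chain (suc m)) → z C.≈ᴹ z′ C.+ᴹ ∂ w
    where module C = Module (chains m)

  IsCycle-⊕ : ∀ {m} {x y : Chain m} → IsCycle x → IsCycle y → IsCycle (x ⊕ y)
  IsCycle-⊕ {zero}  _ _ = _
  IsCycle-⊕ {suc m} p q = C.≈ᴹ-trans (C.+ᴹ-cong p q) (C.+ᴹ-identityˡ 𝟎)
    where module C = Module (chains m)

  IsCycle-𝟎 : ∀ {m} → IsCycle {m} 𝟎
  IsCycle-𝟎 {zero}  = _
  IsCycle-𝟎 {suc m} = Module.≈ᴹ-refl (chains m)

  IsCycle-⊖ : ∀ {m} {x : Chain m} → IsCycle x → IsCycle (⊖ x)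
  IsCycle-⊖ {zero}  _ = _
  IsCycle-⊖ {suc m} p = C.≈ᴹ-trans (C.-ᴹ‿cong p) ε⁻¹≈ε
    where
    module C = Module (chains m)
    open AbelianGroupProperties C.+ᴹ-abelianGroup using (ε⁻¹≈ε)

  IsCycle-· : ∀ {m} a {x : Chain m} → IsCycle x → IsCycle (a · x)
  IsCycle-· {zero}  a _ = _
  IsCycle-· {suc m} a p = C.≈ᴹ-trans (C.*ₗ-congˡ p) (C.*ₗ-zeroʳ a)
    where module C = Module (chains m)

  module _ (m : ℕ) where
    private
      module C = Module (chains m)
      open AbelianGroupProperties C.+ᴹ-abelianGroup using (⁻¹-∙-comm)
      open CommutativeSemigroupProperties
        (CommutativeMonoid.commutativeSemigroup C.+ᴹ-commutativeMonoid) using (interchange)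
      open SetoidReasoning C.≈ᴹ-setoid

      lift : {z z′ : Chain m} → z C.≈ᴹ z′ → z ∼ z′
      lift z≈z′ = 𝟎 , C.≈ᴹ-trans z≈z′ (C.≈ᴹ-sym (C.+ᴹ-identityʳ _))

      ∼-sym : {z z′ : Chain m} → z ∼ z′ → z′ ∼ z
      ∼-sym {z} {z′} (w , z≈) = ⊖ w , (begin
        z′                    ≈⟨ C.+ᴹ-identityʳ _ ⟨
        z′ ⊕ 𝟎                ≈⟨ C.+ᴹ-congˡ (C.-ᴹ‿inverseʳ _) ⟨
        z′ ⊕ (∂ w ⊕ (⊖ ∂ w))  ≈⟨ C.+ᴹ-assoc _ _ _ ⟨
        (z′ ⊕ ∂ w) ⊕ (⊖ ∂ w)  ≈⟨ C.+ᴹ-congʳ z≈ ⟨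
        z ⊕ (⊖ ∂ w)           ∎)

      ∼-trans : {x y z : Chain m} → x ∼ y → y ∼ z → x ∼ z
      ∼-trans {x} {y} {z} (w , x≈) (u , y≈) = u ⊕ w , (begin
        x                  ≈⟨ x≈ ⟩
        y ⊕ ∂ w            ≈⟨ C.+ᴹ-congʳ y≈ ⟩
        (z ⊕ ∂ u) ⊕ ∂ w    ≈⟨ C.+ᴹ-assoc _ _ _ ⟩
        z ⊕ (∂ u ⊕ ∂ w)    ∎)

    homologyModule : Module R (c ⊔ ℓ ⊔ v ⊔ p) (c ⊔ ℓ ⊔ v ⊔ p)
    homologyModule = record
      { Carrierᴹ = Cycle m
      ; _≈ᴹ_     = λ x y → chain x ∼ chain y
      ; _+ᴹ_     = λ x y → cycle (chain x ⊕ chain y) (IsCycle-⊕ (isCycle x) (isCycle y))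
      ; _*ₗ_     = λ a x → cycle (a · chain x) (IsCycle-· a (isCycle x))
      ; _*ᵣ_     = λ x a → cycle (a · chain x) (IsCycle-· a (isCycle x))
      ; 0ᴹ       = cycle 𝟎 IsCycle-𝟎
      ; -ᴹ_      = λ x → cycle (⊖ chain x) (IsCycle-⊖ (isCycle x))
      ; isModule = Biased.IsModuleFromLeft.isModule {commutativeRing = R} (record
        { isLeftModule = record
          { isLeftSemimodule = record
            { +ᴹ-isCommutativeMonoid = record
              { isMonoid = record
                { isSemigroup = record
                  { isMagma = record
                    { isEquivalence = record
                      { refl  = lift C.≈ᴹ-refl
                      ; sym   = ∼-sym
                      ; trans = ∼-trans
                      }
                    ; ∙-cong = λ (w , x≈) (u , y≈) → w ⊕ u ,
                        C.≈ᴹ-trans (C.+ᴹ-cong x≈ y≈) (interchange _ _ _ _)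
                    }
                  ; assoc = λ _ _ _ → lift (C.+ᴹ-assoc _ _ _)
                  }
                ; identity = (λ _ → lift (C.+ᴹ-identityˡ _)) , (λ _ → lift (C.+ᴹ-identityʳ _))
                }
              ; comm = λ _ _ → lift (C.+ᴹ-comm _ _)
              }
            ; isPreleftSemimodule = record
              { *ₗ-cong      = λ {_} {b} a≈b (w , x≈) → b · w ,
                  C.≈ᴹ-trans (C.*ₗ-cong a≈b x≈) (C.*ₗ-distribˡ _ _ _)
              ; *ₗ-zeroˡ     = λ _ → lift (C.*ₗ-zeroˡ _)
              ; *ₗ-distribʳ  = λ _ _ _ → lift (C.*ₗ-distribʳ _ _ _)
              ; *ₗ-identityˡ = λ _ → lift (C.*ₗ-identityˡ _)
              ; *ₗ-assoc     = λ _ _ _ → lift (C.*ₗ-assoc _ _ _)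
              ; *ₗ-zeroʳ     = λ _ → lift (C.*ₗ-zeroʳ _)
              ; *ₗ-distribˡ  = λ _ _ _ → lift (C.*ₗ-distribˡ _ _ _)
              }
            }
          ; -ᴹ‿cong    = λ (w , x≈) → ⊖ w ,
              C.≈ᴹ-trans (C.-ᴹ‿cong x≈) (C.≈ᴹ-sym (⁻¹-∙-comm _ _))
          ; -ᴹ‿inverse = (λ _ → lift (C.-ᴹ‿inverseˡ _)) , (λ _ → lift (C.-ᴹ‿inverseʳ _))
          }
        })
      }

H̃ : ∀ {c ℓ v p} (R : CommutativeRing c ℓ) {V : Set v} →
    SimplicialComplex V p → ℤ → Module R (c ⊔ ℓ ⊔ v ⊔ p) (c ⊔ ℓ ⊔ v ⊔ p)
H̃ R K (+ d)        = homologyModule R K (suc d)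
H̃ R K -[1+ 0 ]     = homologyModule R K 0
H̃ R K -[1+ suc _ ] = ZeroModule.⟨module⟩

{-# OPTIONS --safe #-}
module Submission where

-- By induction on dimension, the hypothesis provides fillers φ(σ), a chain of ⋃σ with
-- ∂φ(σ) = φ(∂σ), for all simplices σ of the nerve of dimension at most ℓ; so φ maps cycles of the
-- nerve to cycles of X, and it suffices that φ reflects boundaries.  Let K be the complex of the
-- joins t * τ, where t is a face of X contained in all members of τ.  It contains X and the nerve.
-- For each σ the part of K over ⋃σ and σ is contracted by coning with members of σ, so by acyclic
-- carriers z and φ(z) are homologous in K.  Coning with members of Γ also gives a chain map ψ from
-- X to the nerve, and t * τ ↦ ψ(t) ∧ τ retracts K to the nerve.  Hence if φ(z) = ∂w, then z bounds.
--
-- The cones depend on choosing, for each simplex, a member of Γ that contains it; this requires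
-- deciding membership in Γ.  Equality with zero in a Heyting field is stable under double negation,
-- so linear independence may be proved with finitely many such decisions under a double negation.

open import Defs
open import Algebra.Apartness.Bundles using (HeytingField; HeytingCommutativeRing)
open import Algebra.Bundles using (CommutativeMonoid; CommutativeRing; Semiring)
import Algebra.Definitions.RawSemiring as RawSemiringExp
open import Algebra.Module.Bundles using (Module)
import Algebra.Module.Construct.TensorUnit as TensorUnit
import Algebra.Module.Structures.Biased as Biased
import Algebra.Properties.AbelianGroup as AbelianGroupProperties
import Algebra.Properties.CommutativeSemigroup as CommutativeSemigroupProperties
import Algebra.Properties.Ring as RingProperties
open import Data.Bool.Base using (Bool; true; false)
open import Data.Empty using (⊥-elim)
open import Data.Fin.Base using (Fin; zero; suc; toℕ)
import Data.Fin.Properties as Fin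
open import Data.Fin.Properties using (_≟_)
open import Data.Integer.Base using (ℤ; +_; -[1+_]; -1ℤ; _-_; _≤_; _<_; +≤+; -≤-)
open import Data.List.Base as List using (List; []; _∷_; length; _++_)
import Data.List.Membership.DecPropositional as DecMembership
open import Data.List.Membership.Propositional using (_∈_; _∉_; lose)
open import Data.List.Membership.Propositional.Properties
  using (∈-map⁺; ∈-map⁻; ∈-allFin; ∈-++⁻; ∈-++⁺ˡ; ∈-++⁺ʳ)
open import Data.List.Properties using (length-map; length-++)
open import Data.List.Relation.Binary.Subset.Propositional using (_⊆_)
open import Data.List.Relation.Binary.Subset.Propositional.Properties
  using (map⁺; ∷⁺ʳ; xs⊆x∷xs; ⊆-refl; ⊆-trans; ∈-∷⁺ʳ)
open import Data.List.Relation.Unary.All as ListAll using ([]; _∷_)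
import Data.List.Relation.Unary.All.Properties as ListAllProperties
open import Data.List.Relation.Unary.AllPairs using ([]; _∷_)
open import Data.List.Relation.Unary.Any as Any using (Any; here; there)
open import Data.List.Relation.Unary.Unique.Propositional using (Unique)
import Data.List.Relation.Unary.Unique.Propositional.Properties as UniqueProperties
open import Data.Maybe using (Is-just)
open import Data.Maybe.Base using (Maybe; just; nothing)
open import Data.Maybe.Relation.Unary.Any using (just)
open import Data.Nat.Base as ℕ using (ℕ; zero; suc; _+_)
import Data.Nat.Properties as ℕ
open import Data.Product.Base using (∃; ∃₂; _×_; _,_; proj₁; proj₂)
open import Data.Sum.Base using (_⊎_; inj₁; inj₂; [_,_]′)
open import Data.Vec.Base as Vec using (Vec; []; _∷_; toList; fromList; removeAt; lookup; tabulate)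
open import Data.Vec.Membership.Propositional.Properties using (∈-lookup; ∈-toList⁺)
open import Data.Vec.Properties
  using (∷-injective; toList∘fromList; toList-map; length-toList; map-lookup-allFin)
open import Data.Vec.Relation.Unary.All as VecAll using ([]; _∷_)
open import Data.Vec.Relation.Unary.AllPairs using ([]; _∷_)
open import Data.Vec.Relation.Unary.Unique.Propositional using () renaming (Unique to Distinct)
open import Function.Base using (_∘_; id; case_of_)
open import Level using (_⊔_)
open import Relation.Binary.Construct.Closure.ReflexiveTransitive
  using (Star; _◅_; _◅◅_; gmap) renaming (ε to stop)
open import Relation.Binary.Core using (Rel)
open import Relation.Binary.PropositionalEquality
  using (_≡_; _≢_; refl; cong; cong₂; sym; trans; subst; subst₂)
import Relation.Binary.Reasoning.Setoid as SetoidReasoning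
open import Relation.Nullary using (Dec; yes; no; ¬_; contradiction; does; ¬¬-excluded-middle)
open import Relation.Nullary.Decidable using (map′; _×-dec_; dec-true; ¬?)

open SimplicialComplex using (nonempty; down-closed)
open Presented using (gen; 𝟎; _⊕_; ⊖_; _·_)

-- The definition of dimension asks for an independent family in the homology of `X` outright,
-- before any choice made under double negation. Hence φ is built without deciding membership in Γ:
-- it uses only the fillers from the hypothesis and the finitely many faces of the given cycles, and
-- every decision about Γ is left to the proof of independence. The same obstacle shapes the chains
-- of X: their vertices can be neither compared nor sorted, so a chain of X is moved into a module
-- of tuples that carry their decisions, by a relation that is total only up to double negation.
-- Vertices of the nerve are numbers, so its chains can be sorted and compared in an exterior
-- algebra on n generators. With chains of X as coefficients the same algebra holds the chains of K:
-- the monomial τ with coefficient t is the join t * τ. The boundary identities hold in the whole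
-- algebra, where multiplication by any generator is a contraction; membership in K is tracked
-- separately, as membership in a span. With dη(z) = φ(z) - z in K and φ(z) = ∂w, the retraction ρ
-- yields z = d(ψ(w) - ρ(η(z))).

module _ {n : ℕ} where
  open DecMembership (_≟_ {n}) public using (_∈?_)

-- Linear algebra over a commutative ring: function modules, linear maps, spans.

module ModuleLemmas {r ℓ m ℓm} {R : CommutativeRing r ℓ} (M : Module R m ℓm) where

  private module R = CommutativeRing R using (-_; 1#; _+_; -‿inverseˡ; 0#; ring; _*_)
  open Module M using (≈ᴹ-setoid; +ᴹ-abelianGroup; +ᴹ-commutativeMonoid)
  open Module M public
    using (Carrierᴹ; _≈ᴹ_; _+ᴹ_; _*ₗ_; 0ᴹ; -ᴹ_; ≈ᴹ-refl; ≈ᴹ-sym; ≈ᴹ-trans; ≈ᴹ-reflexive;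
           +ᴹ-cong; +ᴹ-congˡ; +ᴹ-congʳ; +ᴹ-assoc; +ᴹ-comm; +ᴹ-identityˡ; +ᴹ-identityʳ;
           -ᴹ‿cong; -ᴹ‿inverseˡ; -ᴹ‿inverseʳ; *ₗ-cong; *ₗ-congˡ; *ₗ-congʳ; *ₗ-assoc; *ₗ-comm;
           *ₗ-identityˡ; *ₗ-distribˡ; *ₗ-distribʳ; *ₗ-zeroˡ; *ₗ-zeroʳ)
  open SetoidReasoning ≈ᴹ-setoid public using (begin_; step-≈-⟩; step-≈-⟨; _∎)
  open AbelianGroupProperties +ᴹ-abelianGroup public
    using () renaming (⁻¹-∙-comm to -ᴹ-+ᴹ-comm; inverseˡ-unique to -ᴹ-uniqueˡ; ε⁻¹≈ε to -ᴹ0≈0;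
                       ⁻¹-involutive to -ᴹ-involutive)
  open CommutativeSemigroupProperties
    (CommutativeMonoid.commutativeSemigroup +ᴹ-commutativeMonoid) public
    using () renaming (interchange to +ᴹ-interchange; x∙yz≈y∙xz to +ᴹ-x∙yz≈y∙xz)

  -ᴹ≈-1*ₗ : ∀ x → -ᴹ x ≈ᴹ (R.- R.1#) *ₗ x
  -ᴹ≈-1*ₗ x = ≈ᴹ-sym (-ᴹ-uniqueˡ _ _ (begin
    (R.- R.1#) *ₗ x +ᴹ x           ≈⟨ +ᴹ-congˡ (*ₗ-identityˡ x) ⟨
    (R.- R.1#) *ₗ x +ᴹ R.1# *ₗ x   ≈⟨ *ₗ-distribʳ x _ _ ⟨
    ((R.- R.1#) R.+ R.1#) *ₗ x     ≈⟨ *ₗ-congʳ (R.-‿inverseˡ R.1#) ⟩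
    R.0# *ₗ x                      ≈⟨ *ₗ-zeroˡ x ⟩
    0ᴹ                             ∎))

  *ₗ-neg : ∀ a x → a *ₗ (-ᴹ x) ≈ᴹ -ᴹ (a *ₗ x)
  *ₗ-neg a x = begin
    a *ₗ (-ᴹ x)                ≈⟨ *ₗ-congˡ (-ᴹ≈-1*ₗ x) ⟩
    a *ₗ ((R.- R.1#) *ₗ x)     ≈⟨ *ₗ-comm _ _ _ ⟩
    (R.- R.1#) *ₗ (a *ₗ x)     ≈⟨ -ᴹ≈-1*ₗ _ ⟨
    -ᴹ (a *ₗ x)                ∎

  neg-*ₗ : ∀ a x → (R.- a) *ₗ x ≈ᴹ -ᴹ (a *ₗ x)
  neg-*ₗ a x = begin
    (R.- a) *ₗ x               ≈⟨ *ₗ-congʳ (RingProperties.-1*x≈-x R.ring a) ⟨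
    (R.- R.1# R.* a) *ₗ x      ≈⟨ *ₗ-assoc _ _ _ ⟩
    (R.- R.1#) *ₗ (a *ₗ x)     ≈⟨ -ᴹ≈-1*ₗ _ ⟨
    -ᴹ (a *ₗ x)                ∎

  x-y+y : ∀ x y → (x +ᴹ -ᴹ y) +ᴹ y ≈ᴹ x
  x-y+y x y = begin
    (x +ᴹ -ᴹ y) +ᴹ y   ≈⟨ +ᴹ-assoc _ _ _ ⟩
    x +ᴹ (-ᴹ y +ᴹ y)   ≈⟨ +ᴹ-congˡ (-ᴹ‿inverseˡ y) ⟩
    x +ᴹ 0ᴹ            ≈⟨ +ᴹ-identityʳ x ⟩
    x                  ∎

  x+y-y : ∀ x y → (x +ᴹ y) +ᴹ -ᴹ y ≈ᴹ x
  x+y-y x y = begin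
    (x +ᴹ y) +ᴹ -ᴹ y   ≈⟨ +ᴹ-assoc _ _ _ ⟩
    x +ᴹ (y +ᴹ -ᴹ y)   ≈⟨ +ᴹ-congˡ (-ᴹ‿inverseʳ y) ⟩
    x +ᴹ 0ᴹ            ≈⟨ +ᴹ-identityʳ x ⟩
    x                  ∎

  x≈y+z⇒x-z≈y : ∀ {x y z} → x ≈ᴹ y +ᴹ z → x +ᴹ -ᴹ z ≈ᴹ y
  x≈y+z⇒x-z≈y p = ≈ᴹ-trans (+ᴹ-congʳ p) (x+y-y _ _)

module _ {r ℓ} {R : CommutativeRing r ℓ} where

  infixr 5 _⇒ᴹ_

  -- Indexed by masks this carries the exterior algebra; indexed by tuples it allows `bd` to be
  -- called linear in the function that it sums.
  _⇒ᴹ_ : ∀ {i m ℓm} → Set i → Module R m ℓm → Module R (i ⊔ m) (i ⊔ ℓm)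
  I ⇒ᴹ M = record
    { Carrierᴹ = I → M.Carrierᴹ
    ; _≈ᴹ_     = λ f g → ∀ i → f i M.≈ᴹ g i
    ; _+ᴹ_     = λ f g i → f i M.+ᴹ g i
    ; _*ₗ_     = λ a f i → a M.*ₗ f i
    ; _*ᵣ_     = λ f a i → a M.*ₗ f i
    ; 0ᴹ       = λ _ → M.0ᴹ
    ; -ᴹ_      = λ f i → M.-ᴹ f i
    ; isModule = Biased.IsModuleFromLeft.isModule {commutativeRing = R} (record
      { isLeftModule = record
        { isLeftSemimodule = record
          { +ᴹ-isCommutativeMonoid = record
            { isMonoid = record
              { isSemigroup = record
                { isMagma = record
                  { isEquivalence = record
                    { refl  = λ _ → M.≈ᴹ-refl
                    ; sym   = λ p i → M.≈ᴹ-sym (p i)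
                    ; trans = λ p q i → M.≈ᴹ-trans (p i) (q i)
                    }
                  ; ∙-cong = λ p q i → M.+ᴹ-cong (p i) (q i)
                  }
                ; assoc = λ f g h i → M.+ᴹ-assoc (f i) (g i) (h i)
                }
              ; identity = (λ f i → M.+ᴹ-identityˡ (f i)) , (λ f i → M.+ᴹ-identityʳ (f i))
              }
            ; comm = λ f g i → M.+ᴹ-comm (f i) (g i)
            }
          ; isPreleftSemimodule = record
            { *ₗ-cong      = λ a≈b p i → M.*ₗ-cong a≈b (p i)
            ; *ₗ-zeroˡ     = λ f i → M.*ₗ-zeroˡ (f i)
            ; *ₗ-distribʳ  = λ f a b i → M.*ₗ-distribʳ (f i) a b
            ; *ₗ-identityˡ = λ f i → M.*ₗ-identityˡ (f i)
            ; *ₗ-assoc     = λ a b f i → M.*ₗ-assoc a b (f i)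
            ; *ₗ-zeroʳ     = λ a i → M.*ₗ-zeroʳ a
            ; *ₗ-distribˡ  = λ a f g i → M.*ₗ-distribˡ a (f i) (g i)
            }
          }
        ; -ᴹ‿cong    = λ p i → M.-ᴹ‿cong (p i)
        ; -ᴹ‿inverse = (λ f i → M.-ᴹ‿inverseˡ (f i)) , (λ f i → M.-ᴹ‿inverseʳ (f i))
        }
      })
    }
    where module M = ModuleLemmas M

module _ {r ℓ a ℓa b ℓb} {R : CommutativeRing r ℓ} (A : Module R a ℓa) (B : Module R b ℓb) where

  private
    module R = CommutativeRing R using (0#)
    module A = ModuleLemmas A
    module B = ModuleLemmas B

  record IsLinear (f : A.Carrierᴹ → B.Carrierᴹ) : Set (r ⊔ a ⊔ ℓa ⊔ ℓb) where
    field
      ≈-cong   : ∀ {x y} → x A.≈ᴹ y → f x B.≈ᴹ f y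
      +-homo : ∀ x y → f (x A.+ᴹ y) B.≈ᴹ f x B.+ᴹ f y
      *-homo : ∀ k x → f (k A.*ₗ x) B.≈ᴹ k B.*ₗ f x

    0-homo : f A.0ᴹ B.≈ᴹ B.0ᴹ
    0-homo = begin
      f A.0ᴹ                ≈⟨ ≈-cong (A.*ₗ-zeroˡ A.0ᴹ) ⟨
      f (R.0# A.*ₗ A.0ᴹ)    ≈⟨ *-homo _ _ ⟩
      R.0# B.*ₗ f A.0ᴹ      ≈⟨ B.*ₗ-zeroˡ _ ⟩
      B.0ᴹ                  ∎
      where open B

    neg-homo : ∀ x → f (A.-ᴹ x) B.≈ᴹ B.-ᴹ f x
    neg-homo x = B.-ᴹ-uniqueˡ _ _
      (B.≈ᴹ-trans (B.≈ᴹ-sym (+-homo _ _)) (B.≈ᴹ-trans (≈-cong (A.-ᴹ‿inverseˡ x)) 0-homo))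

    lc-homo : ∀ {d} k (x : Fin d → A.Carrierᴹ) →
              f (linearCombination A k x) B.≈ᴹ linearCombination B k (f ∘ x)
    lc-homo {zero}  k x = 0-homo
    lc-homo {suc d} k x = B.≈ᴹ-trans (+-homo _ _)
      (B.+ᴹ-cong (*-homo _ _) (lc-homo (k ∘ suc) (x ∘ suc)))

  +-linear : ∀ {f g} → IsLinear f → IsLinear g → IsLinear (λ x → f x B.+ᴹ g x)
  +-linear F G = record
    { ≈-cong   = λ p → B.+ᴹ-cong (F.≈-cong p) (G.≈-cong p)
    ; +-homo = λ x y → B.≈ᴹ-trans (B.+ᴹ-cong (F.+-homo x y) (G.+-homo x y)) (B.+ᴹ-interchange _ _ _ _)
    ; *-homo = λ k x → B.≈ᴹ-trans (B.+ᴹ-cong (F.*-homo k x) (G.*-homo k x)) (B.≈ᴹ-sym (B.*ₗ-distribˡ _ _ _))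
    }
    where module F = IsLinear F
          module G = IsLinear G

  *-linear : ∀ {f} k → IsLinear f → IsLinear (λ x → k B.*ₗ f x)
  *-linear k F = record
    { ≈-cong   = λ p → B.*ₗ-congˡ (F.≈-cong p)
    ; +-homo = λ x y → B.≈ᴹ-trans (B.*ₗ-congˡ (F.+-homo x y)) (B.*ₗ-distribˡ _ _ _)
    ; *-homo = λ j x → B.≈ᴹ-trans (B.*ₗ-congˡ (F.*-homo j x)) (B.*ₗ-comm _ _ _)
    }
    where module F = IsLinear F

  neg-linear : ∀ {f} → IsLinear f → IsLinear (λ x → B.-ᴹ f x)
  neg-linear F = record
    { ≈-cong   = λ p → B.-ᴹ‿cong (F.≈-cong p)
    ; +-homo = λ x y → B.≈ᴹ-trans (B.-ᴹ‿cong (F.+-homo x y)) (B.≈ᴹ-sym (B.-ᴹ-+ᴹ-comm _ _))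
    ; *-homo = λ j x → B.≈ᴹ-trans (B.-ᴹ‿cong (F.*-homo j x)) (B.≈ᴹ-sym (B.*ₗ-neg _ _))
    }
    where module F = IsLinear F

  0-linear : IsLinear (λ _ → B.0ᴹ)
  0-linear = record
    { ≈-cong   = λ _ → B.≈ᴹ-refl
    ; +-homo = λ _ _ → B.≈ᴹ-sym (B.+ᴹ-identityˡ _)
    ; *-homo = λ _ _ → B.≈ᴹ-sym (B.*ₗ-zeroʳ _)
    }

module _ {r ℓ} {R : CommutativeRing r ℓ} where

  private module R = CommutativeRing R using (Carrier)

  id-linear : ∀ {a ℓa} (A : Module R a ℓa) → IsLinear A A id
  id-linear A = record
    { ≈-cong = id ; +-homo = λ _ _ → ≈ᴹ-refl ; *-homo = λ _ _ → ≈ᴹ-refl }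
    where open ModuleLemmas A

  ∘-linear : ∀ {a ℓa b ℓb c ℓc} (A : Module R a ℓa) (B : Module R b ℓb) (C : Module R c ℓc) {g f} →
             IsLinear B C g → IsLinear A B f → IsLinear A C (g ∘ f)
  ∘-linear A B C G F = record
    { ≈-cong   = λ p → G.≈-cong (F.≈-cong p)
    ; +-homo = λ x y → C.≈ᴹ-trans (G.≈-cong (F.+-homo x y)) (G.+-homo _ _)
    ; *-homo = λ k x → C.≈ᴹ-trans (G.≈-cong (F.*-homo k x)) (G.*-homo _ _)
    }
    where module C = ModuleLemmas C
          module F = IsLinear F
          module G = IsLinear G

  pointwise-linear : ∀ {a ℓa b ℓb i} {I : Set i} (A : Module R a ℓa) (B : Module R b ℓb)
                     {f : Module.Carrierᴹ A → I → Module.Carrierᴹ B} →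
                     (∀ i → IsLinear A B (λ x → f x i)) → IsLinear A (I ⇒ᴹ B) f
  pointwise-linear A B F = record
    { ≈-cong   = λ p i → IsLinear.≈-cong (F i) p
    ; +-homo = λ x y i → IsLinear.+-homo (F i) x y
    ; *-homo = λ k x i → IsLinear.*-homo (F i) k x
    }

  restrict-linear : ∀ {a ℓa i j} {I : Set i} {J : Set j} (A : Module R a ℓa) (h : J → I) →
                    IsLinear (I ⇒ᴹ A) (J ⇒ᴹ A) (_∘ h)
  restrict-linear A h = record
    { ≈-cong = λ p j → p (h j) ; +-homo = λ _ _ _ → ≈ᴹ-refl ; *-homo = λ _ _ _ → ≈ᴹ-refl }
    where open ModuleLemmas A

  at-linear : ∀ {a ℓa i} {I : Set i} (A : Module R a ℓa) (i : I) → IsLinear (I ⇒ᴹ A) A (λ f → f i)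
  at-linear A i = record
    { ≈-cong = λ p → p i ; +-homo = λ _ _ → ≈ᴹ-refl ; *-homo = λ _ _ → ≈ᴹ-refl }
    where open ModuleLemmas A

  lc-linear : ∀ {a ℓa d} (A : Module R a ℓa) (k : Fin d → R.Carrier) →
              IsLinear (Fin d ⇒ᴹ A) A (linearCombination A k)
  lc-linear {d = zero}  A k = 0-linear (Fin 0 ⇒ᴹ A) A
  lc-linear {d = suc d} A k = +-linear (Fin (suc d) ⇒ᴹ A) A
    (*-linear (Fin (suc d) ⇒ᴹ A) A (k zero) (at-linear A zero))
    (∘-linear (Fin (suc d) ⇒ᴹ A) (Fin d ⇒ᴹ A) A (lc-linear A (k ∘ suc)) (restrict-linear A suc))

  module _ {a ℓa p} (A : Module R a ℓa) (P : Module.Carrierᴹ A → Set p) where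
    private module A = ModuleLemmas A

    -- Membership is a derivation, so that recursion on it can produce an actual chain, as in
    -- `Span⇒fwd`.
    data Span : A.Carrierᴹ → Set (r ⊔ a ⊔ ℓa ⊔ p) where
      base : ∀ {x} → P x → Span x
      0-∈  : Span A.0ᴹ
      +-∈  : ∀ {x y} → Span x → Span y → Span (x A.+ᴹ y)
      *-∈  : ∀ k {x} → Span x → Span (k A.*ₗ x)
      resp : ∀ {x y} → x A.≈ᴹ y → Span x → Span y

    neg-∈ : ∀ {x} → Span x → Span (A.-ᴹ x)
    neg-∈ x∈ = resp (A.≈ᴹ-sym (A.-ᴹ≈-1*ₗ _)) (*-∈ _ x∈)

    lc-∈ : ∀ {d} k {x : Fin d → A.Carrierᴹ} → (∀ i → Span (x i)) → Span (linearCombination A k x)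
    lc-∈ {zero}  k x∈ = 0-∈
    lc-∈ {suc d} k x∈ = +-∈ (*-∈ _ (x∈ zero)) (lc-∈ (k ∘ suc) (x∈ ∘ suc))

  module _ {a ℓa b ℓb} (A : Module R a ℓa) (B : Module R b ℓb) where
    private
      module A = Module A using (Carrierᴹ; ≈ᴹ-sym)
      module B = Module B using (Carrierᴹ; ≈ᴹ-sym; _≈ᴹ_; ≈ᴹ-trans; +ᴹ-cong; *ₗ-congˡ)

    Span-map : ∀ {p q} {P : A.Carrierᴹ → Set p} {Q : B.Carrierᴹ → Set q} {f} → IsLinear A B f →
               (∀ {x} → P x → Span B Q (f x)) → ∀ {x} → Span A P x → Span B Q (f x)
    Span-map F h (base x∈)     = h x∈
    Span-map F h 0-∈           = resp (B.≈ᴹ-sym (IsLinear.0-homo F)) 0-∈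
    Span-map F h (+-∈ x∈ y∈)   = resp (B.≈ᴹ-sym (IsLinear.+-homo F _ _)) (+-∈ (Span-map F h x∈) (Span-map F h y∈))
    Span-map F h (*-∈ k x∈)    = resp (B.≈ᴹ-sym (IsLinear.*-homo F _ _)) (*-∈ k (Span-map F h x∈))
    Span-map F h (resp x≈y x∈) = resp (IsLinear.≈-cong F x≈y) (Span-map F h x∈)

    agree-on-Span : ∀ {p} {P : A.Carrierᴹ → Set p} {f g} → IsLinear A B f → IsLinear A B g →
                    (∀ {x} → P x → f x B.≈ᴹ g x) → ∀ {x} → Span A P x → f x B.≈ᴹ g x
    agree-on-Span {P = P} {f} {g} F G h = go
      where
      module F = IsLinear F
      module G = IsLinear G
      go : ∀ {x} → Span A P x → f x B.≈ᴹ g x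
      go (base x∈)     = h x∈
      go 0-∈           = B.≈ᴹ-trans F.0-homo (B.≈ᴹ-sym G.0-homo)
      go (+-∈ x∈ y∈)   = B.≈ᴹ-trans (F.+-homo _ _) (B.≈ᴹ-trans (B.+ᴹ-cong (go x∈) (go y∈)) (B.≈ᴹ-sym (G.+-homo _ _)))
      go (*-∈ k x∈)    = B.≈ᴹ-trans (F.*-homo _ _) (B.≈ᴹ-trans (B.*ₗ-congˡ (go x∈)) (B.≈ᴹ-sym (G.*-homo _ _)))
      go (resp x≈y x∈) = B.≈ᴹ-trans (F.≈-cong (A.≈ᴹ-sym x≈y)) (B.≈ᴹ-trans (go x∈) (G.≈-cong x≈y))

  Span-⊆ : ∀ {a ℓa p q} (A : Module R a ℓa) {P : Module.Carrierᴹ A → Set p} {Q : Module.Carrierᴹ A → Set q} →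
           (∀ {x} → P x → Q x) → ∀ {x} → Span A P x → Span A Q x
  Span-⊆ A P⊆Q = Span-map A A (id-linear A) (λ x∈ → base (P⊆Q x∈))

-- Linear maps out of a module given by generators and relations.

module Evaluation {c ℓ g t ℓt} {R : CommutativeRing c ℓ} {G : Set g} (T : Module R t ℓt)
                  (f : G → Module.Carrierᴹ T) where

  open Presented R G hiding (gen; 𝟎; _⊕_; ⊖_; _·_)
  private module T = ModuleLemmas T

  eval : Term → T.Carrierᴹ
  eval (gen x) = f x
  eval 𝟎       = T.0ᴹ
  eval (x ⊕ y) = eval x T.+ᴹ eval y
  eval (⊖ x)   = T.-ᴹ eval x
  eval (k · x) = k T.*ₗ eval x

  module _ {q} {_~_ : Rel Term q} (f-resp : ∀ {x y} → x ~ y → eval x T.≈ᴹ eval y) where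

    eval-cong : ∀ {x y} → _≈_ _~_ x y → eval x T.≈ᴹ eval y
    eval-cong (relation p)        = f-resp p
    eval-cong ≈-refl              = T.≈ᴹ-refl
    eval-cong (≈-sym p)           = T.≈ᴹ-sym (eval-cong p)
    eval-cong (≈-trans p q)       = T.≈ᴹ-trans (eval-cong p) (eval-cong q)
    eval-cong (⊕-cong p q)        = T.+ᴹ-cong (eval-cong p) (eval-cong q)
    eval-cong (⊕-assoc x y z)     = T.+ᴹ-assoc _ _ _
    eval-cong (⊕-comm x y)        = T.+ᴹ-comm _ _
    eval-cong (⊕-identity x)      = T.+ᴹ-identityˡ _
    eval-cong (⊖-cong p)          = T.-ᴹ‿cong (eval-cong p)
    eval-cong (⊖-inverse x)       = T.-ᴹ‿inverseˡ _
    eval-cong (·-cong p q)        = T.*ₗ-cong p (eval-cong q)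
    eval-cong (·-identity x)      = T.*ₗ-identityˡ _
    eval-cong (·-assoc a b x)     = T.*ₗ-assoc _ _ _
    eval-cong (·-distribˡ a x y)  = T.*ₗ-distribˡ _ _ _
    eval-cong (·-distribʳ x a b)  = T.*ₗ-distribʳ _ _ _
    eval-cong (·-zeroˡ x)         = T.*ₗ-zeroˡ _
    eval-cong (·-zeroʳ a)         = T.*ₗ-zeroʳ _

    eval-linear : IsLinear (presentedModule _~_) T eval
    eval-linear = record
      { ≈-cong = eval-cong ; +-homo = λ _ _ → T.≈ᴹ-refl ; *-homo = λ _ _ → T.≈ᴹ-refl }

module _ {c ℓ g} {R : CommutativeRing c ℓ} {G : Set g} where

  open Presented R G hiding (gen; 𝟎; _⊕_; ⊖_; _·_)

  agree-on-gens : ∀ {q t ℓt} {_~_ : Rel Term q} (T : Module R t ℓt)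
                  {f h : Term → Module.Carrierᴹ T} →
                  IsLinear (presentedModule _~_) T f → IsLinear (presentedModule _~_) T h →
                  (∀ x → Module._≈ᴹ_ T (f (gen x)) (h (gen x))) → ∀ x → Module._≈ᴹ_ T (f x) (h x)
  agree-on-gens {_~_ = _~_} T {f} {h} F H p = go
    where
    module T = Module T using (_≈ᴹ_; ≈ᴹ-trans; ≈ᴹ-sym; +ᴹ-cong; -ᴹ‿cong; *ₗ-congˡ)
    module F = IsLinear F
    module H = IsLinear H
    go : ∀ x → f x T.≈ᴹ h x
    go (gen x) = p x
    go 𝟎       = T.≈ᴹ-trans F.0-homo (T.≈ᴹ-sym H.0-homo)
    go (x ⊕ y) = T.≈ᴹ-trans (F.+-homo _ _) (T.≈ᴹ-trans (T.+ᴹ-cong (go x) (go y)) (T.≈ᴹ-sym (H.+-homo _ _)))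
    go (⊖ x)   = T.≈ᴹ-trans (F.neg-homo _) (T.≈ᴹ-trans (T.-ᴹ‿cong (go x)) (T.≈ᴹ-sym (H.neg-homo _)))
    go (k · x) = T.≈ᴹ-trans (F.*-homo _ _) (T.≈ᴹ-trans (T.*ₗ-congˡ (go x)) (T.≈ᴹ-sym (H.*-homo _ _)))

-- Alternating sums over the faces of a tuple.

module Boundary {r ℓ t ℓt} {R : CommutativeRing r ℓ} (T : Module R t ℓt) where

  private module R = CommutativeRing R using (Carrier; semiring; -_; 1#; _*_)
  open ModuleLemmas T

  sign : ∀ {d} → Fin d → R.Carrier
  sign i = RawSemiringExp._^_ (Semiring.rawSemiring R.semiring) (R.- R.1#) (toℕ i)

  lc-*ₗ : ∀ {d} c (k : Fin d → R.Carrier) x →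
          linearCombination T (λ i → c R.* k i) x ≈ᴹ c *ₗ linearCombination T k x
  lc-*ₗ {zero}  c k x = ≈ᴹ-sym (*ₗ-zeroʳ c)
  lc-*ₗ {suc d} c k x = ≈ᴹ-trans
    (+ᴹ-cong (*ₗ-assoc _ _ _) (lc-*ₗ c (k ∘ suc) (x ∘ suc)))
    (≈ᴹ-sym (*ₗ-distribˡ _ _ _))

  opaque

    -- The function on faces is an argument, so that one formula gives the boundary of cells, of
    -- words in the exterior algebra and of values defined by coning.
    bd : ∀ {a} {A : Set a} {m} → (Vec A m → Carrierᴹ) → Vec A (suc m) → Carrierᴹ
    bd f s = linearCombination T sign (λ i → f (removeAt s i))

    bd-unfold : ∀ {a} {A : Set a} {m} (f : Vec A m → Carrierᴹ) s →
                bd f s ≡ linearCombination T sign (λ i → f (removeAt s i))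
    bd-unfold f s = refl

    bd-linear : ∀ {a} {A : Set a} {m} (s : Vec A (suc m)) → IsLinear (Vec A m ⇒ᴹ T) T (λ f → bd f s)
    bd-linear {A = A} {m} s =
      ∘-linear (Vec A m ⇒ᴹ T) (Fin (suc m) ⇒ᴹ T) T (lc-linear T sign) (restrict-linear T (removeAt s))

    bd-pointwise : ∀ {a b} {A : Set a} {B : Set b} {m} {f : Vec A m → Carrierᴹ} {g : Vec B m → Carrierᴹ} {s t} →
                   (∀ i → f (removeAt s i) ≈ᴹ g (removeAt t i)) → bd f s ≈ᴹ bd g t
    bd-pointwise p = IsLinear.≈-cong (lc-linear T sign) p

    bd-pointwise-neg : ∀ {a b} {A : Set a} {B : Set b} {m} {f : Vec A m → Carrierᴹ} {g : Vec B m → Carrierᴹ} {s t} →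
                       (∀ i → f (removeAt s i) ≈ᴹ -ᴹ g (removeAt t i)) → bd f s ≈ᴹ -ᴹ bd g t
    bd-pointwise-neg {f = f} {g} {s} {t} p =
      ≈ᴹ-trans (bd-pointwise {f = f} {λ u → -ᴹ g u} {s} {t} p) (IsLinear.neg-homo (bd-linear t) g)

    bd-[_] : ∀ {a} {A : Set a} {f : Vec A 0 → Carrierᴹ} x → bd f (x ∷ []) ≈ᴹ f []
    bd-[ x ] = ≈ᴹ-trans (+ᴹ-identityʳ _) (*ₗ-identityˡ _)

    -- Deleting a later vertex keeps the head x and has one more factor -1. This recursion replaces
    -- index arithmetic in all sign computations below.
    bd-∷ : ∀ {a} {A : Set a} {m} (f : Vec A (suc m) → Carrierᴹ) x s → bd f (x ∷ s) ≈ᴹ f s +ᴹ -ᴹ bd (f ∘ (x ∷_)) s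
    bd-∷ f x s@(_ ∷ _) = +ᴹ-cong (*ₗ-identityˡ _)
      (≈ᴹ-trans (lc-*ₗ (R.- R.1#) sign (λ i → f (x ∷ removeAt s i))) (≈ᴹ-sym (-ᴹ≈-1*ₗ _)))

    bd-∈ : ∀ {a p} {A : Set a} {P : Carrierᴹ → Set p} {m} {f : Vec A m → Carrierᴹ} {s} →
           (∀ i → Span T P (f (removeAt s i))) → Span T P (bd f s)
    bd-∈ f∈ = lc-∈ T _ sign f∈

  module _ {a} {A : Set a} where

    bd-cong : ∀ {m} {f g : Vec A m → Carrierᴹ} → (∀ s → f s ≈ᴹ g s) → ∀ s → bd f s ≈ᴹ bd g s
    bd-cong f≈g s = IsLinear.≈-cong (bd-linear s) f≈g

    -- Expanding both boundaries at the head leaves `bd f s` twice with opposite signs, and the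
    -- double boundary of the function `f ∘ (x ∷_)` on the shorter tuple.
    bd-bd : ∀ {m} (f : Vec A m → Carrierᴹ) s → bd (bd f) s ≈ᴹ 0ᴹ
    bd-bd f (x ∷ y ∷ []) = begin
      bd (bd f) (x ∷ y ∷ [])                       ≈⟨ bd-∷ (bd f) x _ ⟩
      bd f (y ∷ []) +ᴹ -ᴹ bd (bd f ∘ (x ∷_)) (y ∷ [])  ≈⟨ +ᴹ-cong (bd-[ y ]) (-ᴹ‿cong (≈ᴹ-trans (bd-[ y ]) bd-[ x ])) ⟩
      f [] +ᴹ -ᴹ f []                              ≈⟨ -ᴹ‿inverseʳ _ ⟩
      0ᴹ                                           ∎
    bd-bd {suc m} f (x ∷ s@(_ ∷ _ ∷ _)) = begin
      bd (bd f) (x ∷ s)                                    ≈⟨ bd-∷ (bd f) x s ⟩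
      bd f s +ᴹ -ᴹ bd (bd f ∘ (x ∷_)) s                    ≈⟨ +ᴹ-congˡ (-ᴹ‿cong (bd-cong (bd-∷ f x) s)) ⟩
      bd f s +ᴹ -ᴹ bd (λ u → f u +ᴹ -ᴹ bd (f ∘ (x ∷_)) u) s  ≈⟨ +ᴹ-congˡ (-ᴹ‿cong (IsLinear.+-homo (bd-linear s) _ _)) ⟩
      bd f s +ᴹ -ᴹ (bd f s +ᴹ bd (λ u → -ᴹ bd (f ∘ (x ∷_)) u) s)
        ≈⟨ +ᴹ-congˡ (-ᴹ‿cong (+ᴹ-congˡ (IsLinear.neg-homo (bd-linear s) _))) ⟩
      bd f s +ᴹ -ᴹ (bd f s +ᴹ -ᴹ bd (bd (f ∘ (x ∷_))) s)
        ≈⟨ +ᴹ-congˡ (-ᴹ‿cong (+ᴹ-congˡ (≈ᴹ-trans (-ᴹ‿cong (bd-bd (f ∘ (x ∷_)) s)) -ᴹ0≈0))) ⟩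
      bd f s +ᴹ -ᴹ (bd f s +ᴹ 0ᴹ)                          ≈⟨ +ᴹ-congˡ (-ᴹ‿cong (+ᴹ-identityʳ _)) ⟩
      bd f s +ᴹ -ᴹ bd f s                                  ≈⟨ -ᴹ‿inverseʳ _ ⟩
      0ᴹ                                                   ∎

  map-removeAt : ∀ {a b} {A : Set a} {B : Set b} (h : A → B) {m} (s : Vec A (suc m)) i →
                 Vec.map h (removeAt s i) ≡ removeAt (Vec.map h s) i
  map-removeAt h (x ∷ s)         zero    = refl
  map-removeAt h (x ∷ s@(_ ∷ _)) (suc i) = cong (h x ∷_) (map-removeAt h s i)

  -- W and W′ name the vertices, so that one vertex may have several names.
  module _ {a a′ v} {A : Set a} {A′ : Set a′} {V : Set v} (W : A → V) (W′ : A′ → V) where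

    RespectsSame : ∀ {m} → (Vec A m → Carrierᴹ) → (Vec A′ m → Carrierᴹ) → Set (a ⊔ a′ ⊔ v ⊔ ℓt)
    RespectsSame f f′ = ∀ s s′ → Vec.map W s ≡ Vec.map W′ s′ → f s ≈ᴹ f′ s′

    RespectsSwap : ∀ {m} → (Vec A m → Carrierᴹ) → (Vec A′ m → Carrierᴹ) → Set (a ⊔ a′ ⊔ v ⊔ ℓt)
    RespectsSwap f f′ = ∀ s s′ → AdjacentTransposition (Vec.map W s) (Vec.map W′ s′) → f s ≈ᴹ -ᴹ f′ s′

    bd-same : ∀ {m} {f : Vec A m → Carrierᴹ} {f′} → RespectsSame f f′ → RespectsSame (bd f) (bd f′)
    bd-same hs s s′ p = bd-pointwise (λ i → hs _ _
      (trans (map-removeAt W s i) (trans (cong (λ u → removeAt u i) p) (sym (map-removeAt W′ s′ i)))))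

    -- If the first two vertices are exchanged, the two faces that omit one of them trade places,
    -- hence signs, and the remaining faces are swapped themselves. A later transposition is reached
    -- by absorbing the head into the function.
    bd-swap : ∀ {m} {f : Vec A m → Carrierᴹ} {f′} → RespectsSame f f′ → RespectsSwap f f′ → RespectsSwap (bd f) (bd f′)
    bd-swap hs hw s s′ p = go hs hw s s′ p refl refl
      where
      -- The named tuples become variables `u` and `u′` with equations, so that the transposition
      -- between them can be matched on.
      go : ∀ {m} {f : Vec A m → Carrierᴹ} {f′} → RespectsSame f f′ → RespectsSwap f f′ →
           ∀ s s′ {u u′} → AdjacentTransposition u u′ → Vec.map W s ≡ u → Vec.map W′ s′ ≡ u′ → bd f s ≈ᴹ -ᴹ bd f′ s′
      go {f = f} {f′} hs hw (x ∷ y ∷ []) (x′ ∷ y′ ∷ []) (swap _ _ _) refl q = begin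
        bd f (x ∷ y ∷ [])                       ≈⟨ bd-∷ f x _ ⟩
        f (y ∷ []) +ᴹ -ᴹ bd (f ∘ (x ∷_)) (y ∷ [])      ≈⟨ +ᴹ-cong (hs _ _ yy) (-ᴹ‿cong (≈ᴹ-trans bd-[ y ] (hs _ _ xx))) ⟩
        f′ (x′ ∷ []) +ᴹ -ᴹ f′ (y′ ∷ [])         ≈⟨ flip-sub _ _ ⟩
        -ᴹ (f′ (y′ ∷ []) +ᴹ -ᴹ f′ (x′ ∷ []))    ≈⟨ -ᴹ‿cong (≈ᴹ-trans (bd-∷ f′ x′ _) (+ᴹ-congˡ (-ᴹ‿cong bd-[ y′ ]))) ⟨
        -ᴹ bd f′ (x′ ∷ y′ ∷ [])                 ∎
        where
        flip-sub : ∀ a b → a +ᴹ -ᴹ b ≈ᴹ -ᴹ (b +ᴹ -ᴹ a)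
        flip-sub a b = ≈ᴹ-trans (+ᴹ-comm _ _) (≈ᴹ-trans (+ᴹ-congˡ (≈ᴹ-sym (-ᴹ-involutive a))) (-ᴹ-+ᴹ-comm _ _))
        yy : W y ∷ [] ≡ W′ x′ ∷ []
        yy = cong (_∷ []) (sym (proj₁ (∷-injective q)))
        xx : W x ∷ [] ≡ W′ y′ ∷ []
        xx = sym (proj₂ (∷-injective q))
      go {f = f} {f′} hs hw (x ∷ y ∷ s@(_ ∷ _)) (x′ ∷ y′ ∷ s′@(_ ∷ _)) (swap _ _ _) refl q
        with ∷-injective q
      ... | xq , q₁ with ∷-injective q₁
      ... | yq , sq = begin
        bd f (x ∷ y ∷ s)                                        ≈⟨ expand f x y s ⟩
        f (y ∷ s) +ᴹ (-ᴹ f (x ∷ s) +ᴹ bd (λ u → f (x ∷ y ∷ u)) s)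
          ≈⟨ +ᴹ-cong (hs _ _ (sym (cong₂ _∷_ xq sq))) (+ᴹ-cong (-ᴹ‿cong (hs _ _ (sym (cong₂ _∷_ yq sq)))) inner) ⟩
        f′ (x′ ∷ s′) +ᴹ (-ᴹ f′ (y′ ∷ s′) +ᴹ -ᴹ bd (λ u → f′ (x′ ∷ y′ ∷ u)) s′)
          ≈⟨ +ᴹ-x∙yz≈y∙xz _ _ _ ⟩
        -ᴹ f′ (y′ ∷ s′) +ᴹ (f′ (x′ ∷ s′) +ᴹ -ᴹ bd (λ u → f′ (x′ ∷ y′ ∷ u)) s′)
          ≈⟨ +ᴹ-congˡ (+ᴹ-congʳ (-ᴹ-involutive _)) ⟨
        -ᴹ f′ (y′ ∷ s′) +ᴹ (-ᴹ (-ᴹ f′ (x′ ∷ s′)) +ᴹ -ᴹ bd (λ u → f′ (x′ ∷ y′ ∷ u)) s′)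
          ≈⟨ ≈ᴹ-trans (+ᴹ-congˡ (-ᴹ-+ᴹ-comm _ _)) (-ᴹ-+ᴹ-comm _ _) ⟩
        -ᴹ (f′ (y′ ∷ s′) +ᴹ (-ᴹ f′ (x′ ∷ s′) +ᴹ bd (λ u → f′ (x′ ∷ y′ ∷ u)) s′))
          ≈⟨ -ᴹ‿cong (expand f′ x′ y′ s′) ⟨
        -ᴹ bd f′ (x′ ∷ y′ ∷ s′)                                 ∎
        where
        expand : ∀ {a} {A : Set a} {k} (f : Vec A (suc (suc k)) → Carrierᴹ) x y s →
                 bd f (x ∷ y ∷ s) ≈ᴹ f (y ∷ s) +ᴹ (-ᴹ f (x ∷ s) +ᴹ bd (λ u → f (x ∷ y ∷ u)) s)
        expand f x y s = begin
          bd f (x ∷ y ∷ s)                                                      ≈⟨ bd-∷ f x _ ⟩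
          f (y ∷ s) +ᴹ -ᴹ bd (f ∘ (x ∷_)) (y ∷ s)                               ≈⟨ +ᴹ-congˡ (-ᴹ‿cong (bd-∷ _ y s)) ⟩
          f (y ∷ s) +ᴹ -ᴹ (f (x ∷ s) +ᴹ -ᴹ bd (λ u → f (x ∷ y ∷ u)) s)          ≈⟨ +ᴹ-congˡ (-ᴹ-+ᴹ-comm _ _) ⟨
          f (y ∷ s) +ᴹ (-ᴹ f (x ∷ s) +ᴹ -ᴹ (-ᴹ bd (λ u → f (x ∷ y ∷ u)) s))     ≈⟨ +ᴹ-congˡ (+ᴹ-congˡ (-ᴹ-involutive _)) ⟩
          f (y ∷ s) +ᴹ (-ᴹ f (x ∷ s) +ᴹ bd (λ u → f (x ∷ y ∷ u)) s)             ∎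
        inner : bd (λ u → f (x ∷ y ∷ u)) s ≈ᴹ -ᴹ bd (λ u → f′ (x′ ∷ y′ ∷ u)) s′
        inner = bd-pointwise-neg (λ i → hw _ _ (subst₂ AdjacentTransposition refl
          (cong₂ _∷_ (sym xq) (cong₂ _∷_ (sym yq)
            (trans (map-removeAt W s i) (trans (cong (λ u → removeAt u i) (sym sq)) (sym (map-removeAt W′ s′ i))))))
          (swap _ _ _)))
      go {f = f} {f′} hs hw (x ∷ []) (x′ ∷ []) (skip _ ()) p q
      go {f = f} {f′} hs hw (x ∷ s@(_ ∷ _)) (x′ ∷ s′@(_ ∷ _)) (skip _ t) p q with ∷-injective p | ∷-injective q
      ... | xp , refl | xq , refl = begin
        bd f (x ∷ s)                                 ≈⟨ bd-∷ f x s ⟩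
        f s +ᴹ -ᴹ bd (f ∘ (x ∷_)) s                  ≈⟨ +ᴹ-cong (hw _ _ t) (-ᴹ‿cong (go
          (λ u u′ r → hs _ _ (cong₂ _∷_ x≡x′ r)) (λ u u′ r → hw _ _ (subst₂ AdjacentTransposition refl (cong (_∷ _) x≡x′) (skip _ r)))
          s s′ t refl refl)) ⟩
        -ᴹ f′ s′ +ᴹ -ᴹ (-ᴹ bd (f′ ∘ (x′ ∷_)) s′)     ≈⟨ -ᴹ-+ᴹ-comm _ _ ⟩
        -ᴹ (f′ s′ +ᴹ -ᴹ bd (f′ ∘ (x′ ∷_)) s′)        ≈⟨ -ᴹ‿cong (bd-∷ f′ x′ s′) ⟨
        -ᴹ bd f′ (x′ ∷ s′)                           ∎
        where
        x≡x′ : W x ≡ W′ x′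
        x≡x′ = trans xp (sym xq)

opaque

  unfolding Boundary.bd

  bd-homo : ∀ {r ℓ t ℓt u ℓu} {R : CommutativeRing r ℓ} (T : Module R t ℓt) (U : Module R u ℓu) {L} → IsLinear T U L →
            ∀ {a} {A : Set a} {m} (f : Vec A m → Module.Carrierᴹ T) s →
            Module._≈ᴹ_ U (L (Boundary.bd T f s)) (Boundary.bd U (L ∘ f) s)
  bd-homo T U F f s = IsLinear.lc-homo F (Boundary.sign T) (λ i → f (removeAt s i))

-- Coning by recursion on the number of vertices.

module Cone {r ℓ t ℓt} {R : CommutativeRing r ℓ} (T : Module R t ℓt)
            (ε : CommutativeRing.Carrier R) where

  open ModuleLemmas T
  open Boundary T

  module _ {a} {A : Set a} (E : ∀ {m} → Vec A (suc m) → Carrierᴹ → Carrierᴹ)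
           (b : Carrierᴹ) (g : ∀ {m} → Vec A m → Carrierᴹ) where

    -- The solution of ∂ (cone s) = g s + ε (cone of the boundary of s) obtained by coning with E.
    cone : ∀ m → Vec A m → Carrierᴹ
    cone zero    s = b
    cone (suc m) s = E s (g s +ᴹ ε *ₗ bd (cone m) s)

    module _ {∂ : Carrierᴹ → Carrierᴹ} (∂-linear : IsLinear T T ∂)
             (E-linear : ∀ {m} (s : Vec A (suc m)) → IsLinear T T (E s))
             (∂-E : ∀ {m} (s : Vec A (suc m)) x → ∂ (E s x) +ᴹ E s (∂ x) ≈ᴹ x)
             (∂-b : ∂ b ≈ᴹ g [])
             (∂-g : ∀ {m} (s : Vec A (suc m)) → ∂ (g s) ≈ᴹ -ᴹ (ε *ₗ bd g s)) where

      private module ∂ = IsLinear ∂-linear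

      -- `E s` inverts ∂ on cycles, so it suffices that the element being coned is a cycle. Its
      -- second summand has boundary `ε *ₗ bd g s` because the double alternating sum vanishes, and
      -- `∂-g` is the condition that the first summand cancels this.
      ∂-cone-suc : ∀ {m} (s : Vec A (suc m)) → ∂ (cone (suc m) s) ≈ᴹ g s +ᴹ ε *ₗ bd (cone m) s
      bd-∂-cone : ∀ {m} (s : Vec A (suc m)) → bd (∂ ∘ cone m) s ≈ᴹ bd g s

      ∂-cone-suc {m} s = begin
        ∂ (E s y)                        ≈⟨ +ᴹ-identityʳ _ ⟨
        ∂ (E s y) +ᴹ 0ᴹ                  ≈⟨ +ᴹ-congˡ (≈ᴹ-trans (Eₛ.≈-cong ∂y≈0) Eₛ.0-homo) ⟨
        ∂ (E s y) +ᴹ E s (∂ y)           ≈⟨ ∂-E s y ⟩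
        y                                ∎
        where
        module Eₛ = IsLinear (E-linear s)
        y : Carrierᴹ
        y = g s +ᴹ ε *ₗ bd (cone m) s
        ∂y≈0 : ∂ y ≈ᴹ 0ᴹ
        ∂y≈0 = begin
          ∂ y                                          ≈⟨ ∂.+-homo _ _ ⟩
          ∂ (g s) +ᴹ ∂ (ε *ₗ bd (cone m) s)            ≈⟨ +ᴹ-cong (∂-g s) (∂.*-homo _ _) ⟩
          -ᴹ (ε *ₗ bd g s) +ᴹ ε *ₗ ∂ (bd (cone m) s)   ≈⟨ +ᴹ-congˡ (*ₗ-congˡ (≈ᴹ-trans (bd-homo T T ∂-linear (cone m) s) (bd-∂-cone s))) ⟩
          -ᴹ (ε *ₗ bd g s) +ᴹ ε *ₗ bd g s              ≈⟨ -ᴹ‿inverseˡ _ ⟩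
          0ᴹ                                           ∎

      bd-∂-cone {zero}  s = bd-cong (λ { [] → ∂-b }) s
      bd-∂-cone {suc m} s = begin
        bd (∂ ∘ cone (suc m)) s                        ≈⟨ bd-cong ∂-cone-suc s ⟩
        bd (λ u → g u +ᴹ ε *ₗ bd (cone m) u) s         ≈⟨ bdₛ.+-homo _ _ ⟩
        bd g s +ᴹ bd (λ u → ε *ₗ bd (cone m) u) s      ≈⟨ +ᴹ-congˡ (bdₛ.*-homo ε _) ⟩
        bd g s +ᴹ ε *ₗ bd (bd (cone m)) s              ≈⟨ +ᴹ-congˡ (≈ᴹ-trans (*ₗ-congˡ (bd-bd (cone m) s)) (*ₗ-zeroʳ ε)) ⟩
        bd g s +ᴹ 0ᴹ                                   ≈⟨ +ᴹ-identityʳ _ ⟩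
        bd g s                                         ∎
        where module bdₛ = IsLinear (bd-linear s)

  module _ {a a′ v} {A : Set a} {A′ : Set a′} {V : Set v} (W : A → V) (W′ : A′ → V)
           (E : ∀ {m} → Vec A (suc m) → Carrierᴹ → Carrierᴹ) (E′ : ∀ {m} → Vec A′ (suc m) → Carrierᴹ → Carrierᴹ)
           (b b′ : Carrierᴹ) (g : ∀ {m} → Vec A m → Carrierᴹ) (g′ : ∀ {m} → Vec A′ m → Carrierᴹ)
           (E-same : ∀ {m} (s : Vec A (suc m)) (s′ : Vec A′ (suc m)) → Vec.map W s ≡ Vec.map W′ s′ → ∀ x → E s x ≈ᴹ E′ s′ x)
           (E-swap : ∀ {m} (s : Vec A (suc m)) (s′ : Vec A′ (suc m)) → AdjacentTransposition (Vec.map W s) (Vec.map W′ s′) →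
                     ∀ x → E s x ≈ᴹ E′ s′ x)
           (b≈b′ : b ≈ᴹ b′)
           (g-same : ∀ {m} → RespectsSame W W′ {m} g g′) (g-swap : ∀ {m} → RespectsSwap W W′ {m} g g′)
           (E′-linear : ∀ {m} (s : Vec A′ (suc m)) → IsLinear T T (E′ s)) where

    cone-same : ∀ {m} → RespectsSame W W′ (cone E b g m) (cone E′ b′ g′ m)
    cone-same {zero}  s s′ p = b≈b′
    cone-same {suc m} s s′ p = ≈ᴹ-trans (E-same s s′ p _) (IsLinear.≈-cong (E′-linear s′)
      (+ᴹ-cong (g-same s s′ p) (*ₗ-congˡ (bd-same W W′ cone-same s s′ p))))

    -- The operator `E` sees only the unordered vertices and contributes no sign; the sign comes
    -- from `g` and, inductively, from the faces.
    cone-swap : ∀ {m} → RespectsSwap W W′ (cone E b g m) (cone E′ b′ g′ m)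
    cone-swap {zero}  [] [] ()
    cone-swap {suc m} s s′ p = begin
      E s (g s +ᴹ ε *ₗ bd L s)                     ≈⟨ E-swap s s′ p _ ⟩
      E′ s′ (g s +ᴹ ε *ₗ bd L s)                   ≈⟨ IsLinear.≈-cong (E′-linear s′) (+ᴹ-cong (g-swap s s′ p)
                                                        (≈ᴹ-trans (*ₗ-congˡ (bd-swap W W′ cone-same cone-swap s s′ p)) (*ₗ-neg _ _))) ⟩
      E′ s′ (-ᴹ g′ s′ +ᴹ -ᴹ (ε *ₗ bd L′ s′))       ≈⟨ IsLinear.≈-cong (E′-linear s′) (-ᴹ-+ᴹ-comm _ _) ⟩
      E′ s′ (-ᴹ (g′ s′ +ᴹ ε *ₗ bd L′ s′))          ≈⟨ IsLinear.neg-homo (E′-linear s′) _ ⟩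
      -ᴹ E′ s′ (g′ s′ +ᴹ ε *ₗ bd L′ s′)            ∎
      where
      L : Vec A m → Carrierᴹ
      L = cone E b g m
      L′ : Vec A′ m → Carrierᴹ
      L′ = cone E′ b′ g′ m

-- The exterior algebra and its differential.

module Exterior {r ℓ t ℓt} {R : CommutativeRing r ℓ} (T : Module R t ℓt) where

  open ModuleLemmas T

  -- The exterior algebra on n generators with coefficients in T: the bits of a mask tell which
  -- generators occur in a monomial, e i multiplies by the i-th generator on the left, and the
  -- differential d below sends every generator to 1.
  Λ : ℕ → Module R t ℓt
  Λ n = Vec Bool n ⇒ᴹ T

  ∣Λ∣ : ℕ → Set t
  ∣Λ∣ n = Vec Bool n → Carrierᴹ

  cons₀ : ∀ {n} → ∣Λ∣ n → ∣Λ∣ (suc n)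
  cons₀ f (false ∷ S) = f S
  cons₀ f (true ∷ S)  = 0ᴹ

  cons₁ : ∀ {n} → ∣Λ∣ n → ∣Λ∣ (suc n)
  cons₁ f (false ∷ S) = 0ᴹ
  cons₁ f (true ∷ S)  = f S

  cons₀-linear : ∀ {n} → IsLinear (Λ n) (Λ (suc n)) cons₀
  cons₀-linear {n} = pointwise-linear (Λ n) T λ where
    (false ∷ S) → at-linear T S
    (true ∷ S)  → 0-linear (Λ n) T

  cons₁-linear : ∀ {n} → IsLinear (Λ n) (Λ (suc n)) cons₁
  cons₁-linear {n} = pointwise-linear (Λ n) T λ where
    (false ∷ S) → 0-linear (Λ n) T
    (true ∷ S)  → at-linear T S

  e : ∀ {n} → Fin n → ∣Λ∣ n → ∣Λ∣ n
  e zero    f (false ∷ S) = 0ᴹ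
  e zero    f (true ∷ S)  = f (false ∷ S)
  e (suc i) f (false ∷ S) = e i (f ∘ (false ∷_)) S
  -- The sign comes from moving the generator past generator zero, which is present in this mask.
  e (suc i) f (true ∷ S)  = -ᴹ e i (f ∘ (true ∷_)) S

  e-linear : ∀ {n} (i : Fin n) → IsLinear (Λ n) (Λ n) (e i)
  e-linear {n} i = pointwise-linear (Λ n) T (go i)
    where
    go : ∀ {n} (i : Fin n) S → IsLinear (Λ n) T (λ f → e i f S)
    go {suc n} zero    (false ∷ S) = 0-linear (Λ (suc n)) T
    go {suc n} zero    (true ∷ S)  = at-linear T (false ∷ S)
    go {suc n} (suc i) (false ∷ S) =
      ∘-linear (Λ (suc n)) (Λ n) T (go i S) (restrict-linear T (false ∷_))
    go {suc n} (suc i) (true ∷ S)  = neg-linear (Λ (suc n)) T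
      (∘-linear (Λ (suc n)) (Λ n) T (go i S) (restrict-linear T (true ∷_)))

  module e {n} (i : Fin n) = IsLinear (e-linear i)

  e-square : ∀ {n} (i : Fin n) f S → e i (e i f) S ≈ᴹ 0ᴹ
  e-square zero    f (false ∷ S) = ≈ᴹ-refl
  e-square zero    f (true ∷ S)  = ≈ᴹ-refl
  e-square (suc i) f (false ∷ S) = e-square i _ S
  e-square (suc i) f (true ∷ S)  = ≈ᴹ-trans (-ᴹ‿cong (≈ᴹ-trans (e.neg-homo i _ S) (-ᴹ‿cong (e-square i _ S))))
    (-ᴹ-involutive _)

  e-anticomm : ∀ {n} (i j : Fin n) f S → e i (e j f) S ≈ᴹ -ᴹ e j (e i f) S
  e-anticomm zero    zero    f (false ∷ S) = ≈ᴹ-sym -ᴹ0≈0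
  e-anticomm zero    zero    f (true ∷ S)  = ≈ᴹ-sym -ᴹ0≈0
  e-anticomm zero    (suc j) f (false ∷ S) = ≈ᴹ-sym (≈ᴹ-trans (-ᴹ‿cong (e.0-homo j S)) -ᴹ0≈0)
  e-anticomm zero    (suc j) f (true ∷ S)  = ≈ᴹ-sym (-ᴹ-involutive _)
  e-anticomm (suc i) zero    f (false ∷ S) = ≈ᴹ-trans (e.0-homo i S) (≈ᴹ-sym -ᴹ0≈0)
  e-anticomm (suc i) zero    f (true ∷ S)  = ≈ᴹ-refl
  e-anticomm (suc i) (suc j) f (false ∷ S) = e-anticomm i j _ S
  e-anticomm (suc i) (suc j) f (true ∷ S)  = -ᴹ‿cong (begin
    e i (λ U → -ᴹ e j (f ∘ (true ∷_)) U) S     ≈⟨ e.neg-homo i _ S ⟩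
    -ᴹ e i (e j (f ∘ (true ∷_))) S             ≈⟨ -ᴹ‿cong (e-anticomm i j _ S) ⟩
    -ᴹ (-ᴹ e j (e i (f ∘ (true ∷_))) S)        ≈⟨ -ᴹ‿cong (e.neg-homo j _ S) ⟨
    -ᴹ e j (λ U → -ᴹ e i (f ∘ (true ∷_)) U) S  ∎)

  e-cons₀ : ∀ {n} (i : Fin n) f S → e (suc i) (cons₀ f) S ≈ᴹ cons₀ (e i f) S
  e-cons₀ i f (false ∷ S) = ≈ᴹ-refl
  e-cons₀ i f (true ∷ S)  = ≈ᴹ-trans (-ᴹ‿cong (e.0-homo i S)) -ᴹ0≈0

  e₀-cons₀ : ∀ {n} (f : ∣Λ∣ n) S → e zero (cons₀ f) S ≈ᴹ cons₁ f S
  e₀-cons₀ f (false ∷ S) = ≈ᴹ-refl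
  e₀-cons₀ f (true ∷ S)  = ≈ᴹ-refl

  inj : ∀ {n} → Carrierᴹ → ∣Λ∣ n
  inj {zero}  x = λ _ → x
  inj {suc n} x = cons₀ (inj x)

  inj-linear : ∀ {n} → IsLinear T (Λ n) inj
  inj-linear {zero}  = pointwise-linear T T (λ _ → id-linear T)
  inj-linear {suc n} = ∘-linear T (Λ n) (Λ (suc n)) cons₀-linear inj-linear

  word : ∀ {n} → List (Fin n) → ∣Λ∣ n → ∣Λ∣ n
  word []      f = f
  word (i ∷ τ) f = e i (word τ f)

  word-linear : ∀ {n} (τ : List (Fin n)) → IsLinear (Λ n) (Λ n) (word τ)
  word-linear {n} []      = id-linear (Λ n)
  word-linear {n} (i ∷ τ) = ∘-linear (Λ n) (Λ n) (Λ n) (e-linear i) (word-linear τ)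

  word-++ : ∀ {n} (σ τ : List (Fin n)) f → word (σ List.++ τ) f ≡ word σ (word τ f)
  word-++ []      τ f = refl
  word-++ (i ∷ σ) τ f = cong (e i) (word-++ σ τ f)

  word-cons₀ : ∀ {n} (τ : List (Fin n)) f S → word (List.map suc τ) (cons₀ f) S ≈ᴹ cons₀ (word τ f) S
  word-cons₀ []      f S = ≈ᴹ-refl
  word-cons₀ (i ∷ τ) f S = ≈ᴹ-trans (e.≈-cong (suc i) (word-cons₀ τ f) S) (e-cons₀ i (word τ f) S)

  module Differential {δ : Carrierᴹ → Carrierᴹ} (δ-linear : IsLinear T T δ) where

    private module δ = IsLinear δ-linear

    -- The coefficient stands behind the generators, so δ acts with one sign for each generator in
    -- the mask. This is the boundary of the join of a full simplex with a complex whose boundary is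
    -- δ; scalars with δ = 0 give the augmented simplicial boundary.
    d : ∀ {n} → ∣Λ∣ n → ∣Λ∣ n
    d f []          = δ (f [])
    d f (false ∷ S) = d (f ∘ (false ∷_)) S +ᴹ f (true ∷ S)
    d f (true ∷ S)  = -ᴹ d (f ∘ (true ∷_)) S

    d-linear : ∀ {n} → IsLinear (Λ n) (Λ n) d
    d-linear {n} = pointwise-linear (Λ n) T go
      where
      go : ∀ {n} S → IsLinear (Λ n) T (λ f → d f S)
      go []          = ∘-linear (Λ 0) T T δ-linear (at-linear T [])
      go {suc n} (false ∷ S) = +-linear (Λ (suc n)) T
        (∘-linear (Λ (suc n)) (Λ n) T (go S) (restrict-linear T (false ∷_))) (at-linear T (true ∷ S))
      go {suc n} (true ∷ S)  = neg-linear (Λ (suc n)) T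
        (∘-linear (Λ (suc n)) (Λ n) T (go S) (restrict-linear T (true ∷_)))

    module d {n} = IsLinear (d-linear {n})

    -- The differential is a skew derivation with value 1 on each generator, so multiplication by
    -- any single generator is a contracting homotopy. This supplies every hypothesis `∂-E`.
    d-e : ∀ {n} (i : Fin n) f S → d (e i f) S +ᴹ e i (d f) S ≈ᴹ f S
    d-e zero f (false ∷ S) = begin
      (d (λ _ → 0ᴹ) S +ᴹ f (false ∷ S)) +ᴹ 0ᴹ   ≈⟨ +ᴹ-identityʳ _ ⟩
      d (λ _ → 0ᴹ) S +ᴹ f (false ∷ S)           ≈⟨ +ᴹ-congʳ (d.0-homo S) ⟩
      0ᴹ +ᴹ f (false ∷ S)                       ≈⟨ +ᴹ-identityˡ _ ⟩
      f (false ∷ S)                             ∎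
    d-e zero f (true ∷ S) = begin
      -ᴹ d (f ∘ (false ∷_)) S +ᴹ (d (f ∘ (false ∷_)) S +ᴹ f (true ∷ S))   ≈⟨ +ᴹ-assoc _ _ _ ⟨
      (-ᴹ d (f ∘ (false ∷_)) S +ᴹ d (f ∘ (false ∷_)) S) +ᴹ f (true ∷ S)   ≈⟨ +ᴹ-congʳ (-ᴹ‿inverseˡ _) ⟩
      0ᴹ +ᴹ f (true ∷ S)                                                  ≈⟨ +ᴹ-identityˡ _ ⟩
      f (true ∷ S)                                                        ∎
    d-e (suc i) f (false ∷ S) = begin
      (d (e i f₀) S +ᴹ -ᴹ e i f₁ S) +ᴹ e i (λ U → d f₀ U +ᴹ f₁ U) S       ≈⟨ +ᴹ-congˡ (e.+-homo i _ _ S) ⟩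
      (d (e i f₀) S +ᴹ -ᴹ e i f₁ S) +ᴹ (e i (d f₀) S +ᴹ e i f₁ S)         ≈⟨ +ᴹ-interchange _ _ _ _ ⟩
      (d (e i f₀) S +ᴹ e i (d f₀) S) +ᴹ (-ᴹ e i f₁ S +ᴹ e i f₁ S)         ≈⟨ +ᴹ-cong (d-e i f₀ S) (-ᴹ‿inverseˡ _) ⟩
      f₀ S +ᴹ 0ᴹ                                                          ≈⟨ +ᴹ-identityʳ _ ⟩
      f₀ S                                                                ∎
      where f₀ = f ∘ (false ∷_)
            f₁ = f ∘ (true ∷_)
    d-e (suc i) f (true ∷ S) = begin
      -ᴹ d (λ U → -ᴹ e i f₁ U) S +ᴹ -ᴹ e i (λ U → -ᴹ d f₁ U) S
        ≈⟨ +ᴹ-cong (≈ᴹ-trans (-ᴹ‿cong (d.neg-homo _ S)) (-ᴹ-involutive _)) (≈ᴹ-trans (-ᴹ‿cong (e.neg-homo i _ S)) (-ᴹ-involutive _)) ⟩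
      d (e i f₁) S +ᴹ e i (d f₁) S    ≈⟨ d-e i f₁ S ⟩
      f₁ S                            ∎
      where f₁ = f ∘ (true ∷_)

    d-cons₀ : ∀ {n} (f : ∣Λ∣ n) S → d (cons₀ f) S ≈ᴹ cons₀ (d f) S
    d-cons₀ f (false ∷ S) = +ᴹ-identityʳ _
    d-cons₀ f (true ∷ S)  = ≈ᴹ-trans (-ᴹ‿cong (d.0-homo S)) -ᴹ0≈0

    d-cons₁ : ∀ {n} (f : ∣Λ∣ n) S → d (cons₁ f) S ≈ᴹ cons₀ f S +ᴹ -ᴹ cons₁ (d f) S
    d-cons₁ f (false ∷ S) = ≈ᴹ-trans (+ᴹ-cong (d.0-homo S) (≈ᴹ-sym (+ᴹ-identityʳ _)))
      (≈ᴹ-trans (+ᴹ-identityˡ _) (+ᴹ-congˡ (≈ᴹ-sym -ᴹ0≈0)))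
    d-cons₁ f (true ∷ S)  = ≈ᴹ-sym (+ᴹ-identityˡ _)

    d-inj : ∀ {n} x (S : Vec Bool n) → d (inj x) S ≈ᴹ inj (δ x) S
    d-inj {zero}  x []      = ≈ᴹ-refl
    d-inj {suc n} x S = ≈ᴹ-trans (d-cons₀ (inj x) S) (IsLinear.≈-cong cons₀-linear (d-inj x) S)

    d-d : (∀ x → δ (δ x) ≈ᴹ 0ᴹ) → ∀ {n} (f : ∣Λ∣ n) S → d (d f) S ≈ᴹ 0ᴹ
    d-d δδ f []          = δδ _
    d-d δδ f (false ∷ S) = begin
      d (λ U → d f₀ U +ᴹ f₁ U) S +ᴹ -ᴹ d f₁ S   ≈⟨ +ᴹ-congʳ (d.+-homo _ _ S) ⟩
      (d (d f₀) S +ᴹ d f₁ S) +ᴹ -ᴹ d f₁ S       ≈⟨ x+y-y _ _ ⟩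
      d (d f₀) S                                ≈⟨ d-d δδ f₀ S ⟩
      0ᴹ                                        ∎
      where f₀ = f ∘ (false ∷_)
            f₁ = f ∘ (true ∷_)
    d-d δδ f (true ∷ S)  = ≈ᴹ-trans (-ᴹ‿cong (≈ᴹ-trans (d.neg-homo _ S) (≈ᴹ-trans (-ᴹ‿cong (d-d δδ _ S)) -ᴹ0≈0))) -ᴹ0≈0

-- Extending a map of coefficients to the exterior algebra.

module Extension {r ℓ t ℓt u ℓu} {R : CommutativeRing r ℓ} (T : Module R t ℓt) (U : Module R u ℓu)
                 (ε : CommutativeRing.Carrier R) where

  private
    module T = Module T using (Carrierᴹ; 0ᴹ; -ᴹ_)
  open ModuleLemmas U
  open Exterior T

  module _ (H : T.Carrierᴹ → Carrierᴹ) where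

    -- The extension of H that satisfies ext E ∘ e i = ε E i ∘ ext E.
    ext : ∀ {n} → (Fin n → Carrierᴹ → Carrierᴹ) → ∣Λ∣ n → Carrierᴹ
    ext {zero}  E f = H (f [])
    ext {suc n} E f = ext (E ∘ suc) (f ∘ (false ∷_)) +ᴹ ε *ₗ E zero (ext (E ∘ suc) (f ∘ (true ∷_)))

    module _ (H-linear : IsLinear T U H) where

      ext-linear : ∀ {n} (E : Fin n → Carrierᴹ → Carrierᴹ) → (∀ i → IsLinear U U (E i)) → IsLinear (Λ n) U (ext E)
      ext-linear {zero}  E E-linear = ∘-linear (Λ 0) T U H-linear (at-linear T [])
      ext-linear {suc n} E E-linear = +-linear (Λ (suc n)) U
        (∘-linear (Λ (suc n)) (Λ n) U ih (restrict-linear T (false ∷_)))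
        (*-linear (Λ (suc n)) U ε (∘-linear (Λ (suc n)) U U (E-linear zero)
          (∘-linear (Λ (suc n)) (Λ n) U ih (restrict-linear T (true ∷_)))))
        where
        ih : IsLinear (Λ n) U (ext (E ∘ suc))
        ih = ext-linear (E ∘ suc) (E-linear ∘ suc)

      ext-inj : ∀ {n} (E : Fin n → Carrierᴹ → Carrierᴹ) → (∀ i → IsLinear U U (E i)) → ∀ x → ext E (inj x) ≈ᴹ H x
      ext-inj {zero}  E E-linear x = ≈ᴹ-refl
      ext-inj {suc n} E E-linear x = begin
        ext (E ∘ suc) (inj x) +ᴹ ε *ₗ E zero (ext (E ∘ suc) (λ _ → T.0ᴹ))
          ≈⟨ +ᴹ-cong (ext-inj (E ∘ suc) (E-linear ∘ suc) x) (*ₗ-congˡ (≈ᴹ-trans (E₀.≈-cong (IsLinear.0-homo (ext-linear _ (E-linear ∘ suc)))) E₀.0-homo)) ⟩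
        H x +ᴹ ε *ₗ 0ᴹ   ≈⟨ ≈ᴹ-trans (+ᴹ-congˡ (*ₗ-zeroʳ _)) (+ᴹ-identityʳ _) ⟩
        H x              ∎
        where module E₀ = IsLinear (E-linear zero)

      -- The universal property of the exterior algebra, twisted by ε: for generator zero the
      -- unwanted term dies by `E-square`, and for a later one `E-anticomm` matches the sign built
      -- into `e`.
      ext-e : ∀ {n} (E : Fin n → Carrierᴹ → Carrierᴹ) → (∀ i → IsLinear U U (E i)) →
              (∀ i x → E i (E i x) ≈ᴹ 0ᴹ) → (∀ i j x → E i (E j x) ≈ᴹ -ᴹ E j (E i x)) →
              ∀ i f → ext E (e i f) ≈ᴹ ε *ₗ E i (ext E f)
      ext-e E E-linear E-square E-anticomm zero f = begin
        ext (E ∘ suc) (λ _ → T.0ᴹ) +ᴹ ε *ₗ E₀ x₀        ≈⟨ +ᴹ-congʳ (IsLinear.0-homo (ext-linear _ (E-linear ∘ suc))) ⟩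
        0ᴹ +ᴹ ε *ₗ E₀ x₀                                ≈⟨ ≈ᴹ-trans (+ᴹ-comm _ _) (+ᴹ-congˡ (≈ᴹ-sym zero-part)) ⟩
        ε *ₗ E₀ x₀ +ᴹ ε *ₗ E₀ (ε *ₗ E₀ x₁)              ≈⟨ *ₗ-distribˡ _ _ _ ⟨
        ε *ₗ (E₀ x₀ +ᴹ E₀ (ε *ₗ E₀ x₁))                 ≈⟨ *ₗ-congˡ (E₀.+-homo _ _) ⟨
        ε *ₗ E₀ (x₀ +ᴹ ε *ₗ E₀ x₁)                      ∎
        where
        E₀ = E zero
        module E₀ = IsLinear (E-linear zero)
        x₀ = ext (E ∘ suc) (f ∘ (false ∷_))
        x₁ = ext (E ∘ suc) (f ∘ (true ∷_))
        zero-part : ε *ₗ E₀ (ε *ₗ E₀ x₁) ≈ᴹ 0ᴹ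
        zero-part = ≈ᴹ-trans (*ₗ-congˡ (≈ᴹ-trans (E₀.*-homo _ _) (≈ᴹ-trans (*ₗ-congˡ (E-square zero x₁)) (*ₗ-zeroʳ _)))) (*ₗ-zeroʳ _)
      ext-e E E-linear E-square E-anticomm (suc i) f = begin
        ext (E ∘ suc) (e i f₀) +ᴹ ε *ₗ E₀ (ext (E ∘ suc) (λ S → T.-ᴹ e i f₁ S))
          ≈⟨ +ᴹ-cong (ih f₀) (*ₗ-congˡ (E₀.≈-cong (≈ᴹ-trans (IsLinear.neg-homo (ext-linear _ (E-linear ∘ suc)) _) (-ᴹ‿cong (ih f₁))))) ⟩
        ε *ₗ Eᵢ x₀ +ᴹ ε *ₗ E₀ (-ᴹ (ε *ₗ Eᵢ x₁))         ≈⟨ +ᴹ-congˡ (*ₗ-congˡ swap-part) ⟩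
        ε *ₗ Eᵢ x₀ +ᴹ ε *ₗ Eᵢ (ε *ₗ E₀ x₁)              ≈⟨ *ₗ-distribˡ _ _ _ ⟨
        ε *ₗ (Eᵢ x₀ +ᴹ Eᵢ (ε *ₗ E₀ x₁))                 ≈⟨ *ₗ-congˡ (Eᵢ.+-homo _ _) ⟨
        ε *ₗ Eᵢ (x₀ +ᴹ ε *ₗ E₀ x₁)                      ∎
        where
        E₀ = E zero
        Eᵢ = E (suc i)
        module E₀ = IsLinear (E-linear zero)
        module Eᵢ = IsLinear (E-linear (suc i))
        f₀ = f ∘ (false ∷_)
        f₁ = f ∘ (true ∷_)
        x₀ = ext (E ∘ suc) f₀
        x₁ = ext (E ∘ suc) f₁
        ih : ∀ f → ext (E ∘ suc) (e i f) ≈ᴹ ε *ₗ Eᵢ (ext (E ∘ suc) f)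
        ih = ext-e (E ∘ suc) (E-linear ∘ suc) (E-square ∘ suc) (λ i j → E-anticomm (suc i) (suc j)) i
        swap-part : E₀ (-ᴹ (ε *ₗ Eᵢ x₁)) ≈ᴹ Eᵢ (ε *ₗ E₀ x₁)
        swap-part = begin
          E₀ (-ᴹ (ε *ₗ Eᵢ x₁))       ≈⟨ E₀.neg-homo _ ⟩
          -ᴹ E₀ (ε *ₗ Eᵢ x₁)         ≈⟨ -ᴹ‿cong (E₀.*-homo _ _) ⟩
          -ᴹ (ε *ₗ E₀ (Eᵢ x₁))       ≈⟨ *ₗ-neg _ _ ⟨
          ε *ₗ (-ᴹ E₀ (Eᵢ x₁))       ≈⟨ *ₗ-congˡ (E-anticomm (suc i) zero x₁) ⟨
          ε *ₗ Eᵢ (E₀ x₁)            ≈⟨ Eᵢ.*-homo _ _ ⟨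
          Eᵢ (ε *ₗ E₀ x₁)            ∎

module ExtensionBoundary {r ℓ t ℓt u ℓu} {R : CommutativeRing r ℓ} (T : Module R t ℓt) (U : Module R u ℓu)
                         (ε η : CommutativeRing.Carrier R) where

  private
    module R = CommutativeRing R using (_≈_; -_; sym)
    module T = Module T using (Carrierᴹ; _+ᴹ_; -ᴹ_)
  open ModuleLemmas U
  open Exterior T
  private
    module Eε = Extension T U ε using (ext; ext-linear)
    module Eη = Extension T U η using (ext)

  module _ (η≈-ε : η R.≈ R.- ε)
           {H J : T.Carrierᴹ → Carrierᴹ} (H-linear : IsLinear T U H)
           {δ : T.Carrierᴹ → T.Carrierᴹ} (δ-linear : IsLinear T T δ)
           {∂ : Carrierᴹ → Carrierᴹ} (∂-linear : IsLinear U U ∂)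
           (∂-H : ∀ x → ∂ (H x) ≈ᴹ J x +ᴹ ε *ₗ H (δ x)) where

    open Differential δ-linear
    private module ∂ = IsLinear ∂-linear

    -- Moving ∂ past an operator `E i` leaves the identity and one minus sign, which turns the
    -- factor ε of the J part into η = -ε. With J = 0 and ε = 1 this makes ρ a chain map; with J =
    -- `inj` and ε = -1, hence η = 1, it makes h a contraction.
    ext-d : ∀ {n} (E : Fin n → Carrierᴹ → Carrierᴹ) → (∀ i → IsLinear U U (E i)) →
            (∀ i x → ∂ (E i x) +ᴹ E i (∂ x) ≈ᴹ x) →
            ∀ f → ∂ (Eε.ext H E f) ≈ᴹ Eη.ext J E f +ᴹ ε *ₗ Eε.ext H E (d f)
    ext-d {zero}  E E-linear ∂-E f = ∂-H _
    ext-d {suc n} E E-linear ∂-E f = begin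
      ∂ (h f₀ +ᴹ ε *ₗ E₀ (h f₁))                                    ≈⟨ ≈ᴹ-trans (∂.+-homo _ _) (+ᴹ-congˡ (∂.*-homo _ _)) ⟩
      ∂ (h f₀) +ᴹ ε *ₗ ∂ (E₀ (h f₁))                                ≈⟨ +ᴹ-cong (ih f₀) (*ₗ-congˡ step) ⟩
      (j f₀ +ᴹ ε *ₗ h (d f₀)) +ᴹ ε *ₗ (h f₁ +ᴹ (-ᴹ E₀ (j f₁) +ᴹ -ᴹ (ε *ₗ E₀ (h (d f₁)))))
        ≈⟨ +ᴹ-congˡ (≈ᴹ-trans (*ₗ-congˡ (+ᴹ-x∙yz≈y∙xz _ _ _)) (*ₗ-distribˡ _ _ _)) ⟩
      (j f₀ +ᴹ ε *ₗ h (d f₀)) +ᴹ (ε *ₗ (-ᴹ E₀ (j f₁)) +ᴹ ε *ₗ (h f₁ +ᴹ -ᴹ (ε *ₗ E₀ (h (d f₁)))))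
        ≈⟨ +ᴹ-interchange _ _ _ _ ⟩
      (j f₀ +ᴹ ε *ₗ (-ᴹ E₀ (j f₁))) +ᴹ (ε *ₗ h (d f₀) +ᴹ ε *ₗ (h f₁ +ᴹ -ᴹ (ε *ₗ E₀ (h (d f₁)))))
        ≈⟨ +ᴹ-cong (+ᴹ-congˡ sign-part) (≈ᴹ-sym (*ₗ-distribˡ _ _ _)) ⟩
      (j f₀ +ᴹ η *ₗ E₀ (j f₁)) +ᴹ ε *ₗ (h (d f₀) +ᴹ (h f₁ +ᴹ -ᴹ (ε *ₗ E₀ (h (d f₁)))))
        ≈⟨ +ᴹ-congˡ (*ₗ-congˡ (≈ᴹ-trans (≈ᴹ-sym (+ᴹ-assoc _ _ _)) (+ᴹ-cong (≈ᴹ-sym (hl.+-homo _ _)) neg-part))) ⟩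
      (j f₀ +ᴹ η *ₗ E₀ (j f₁)) +ᴹ ε *ₗ (h (λ S → d f₀ S T.+ᴹ f₁ S) +ᴹ ε *ₗ E₀ (h (λ S → T.-ᴹ d f₁ S)))
        ∎
      where
      E₀ = E zero
      module E₀ = IsLinear (E-linear zero)
      f₀ = f ∘ (false ∷_)
      f₁ = f ∘ (true ∷_)
      h = Eε.ext H (E ∘ suc)
      j = Eη.ext J (E ∘ suc)
      h-linear : IsLinear (Λ n) U h
      h-linear = Eε.ext-linear H H-linear (E ∘ suc) (E-linear ∘ suc)
      module hl = IsLinear h-linear
      ih : ∀ f → ∂ (h f) ≈ᴹ j f +ᴹ ε *ₗ h (d f)
      ih = ext-d (E ∘ suc) (E-linear ∘ suc) (∂-E ∘ suc)
      step : ∂ (E₀ (h f₁)) ≈ᴹ h f₁ +ᴹ (-ᴹ E₀ (j f₁) +ᴹ -ᴹ (ε *ₗ E₀ (h (d f₁))))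
      step = begin
        ∂ (E₀ (h f₁))                                            ≈⟨ x≈y+z⇒x-z≈y (≈ᴹ-sym (∂-E zero (h f₁))) ⟨
        h f₁ +ᴹ -ᴹ E₀ (∂ (h f₁))                                 ≈⟨ +ᴹ-congˡ (-ᴹ‿cong (≈ᴹ-trans (E₀.≈-cong (ih f₁)) (≈ᴹ-trans (E₀.+-homo _ _) (+ᴹ-congˡ (E₀.*-homo _ _))))) ⟩
        h f₁ +ᴹ -ᴹ (E₀ (j f₁) +ᴹ ε *ₗ E₀ (h (d f₁)))             ≈⟨ +ᴹ-congˡ (-ᴹ-+ᴹ-comm _ _) ⟨
        h f₁ +ᴹ (-ᴹ E₀ (j f₁) +ᴹ -ᴹ (ε *ₗ E₀ (h (d f₁))))        ∎
      sign-part : ε *ₗ (-ᴹ E₀ (j f₁)) ≈ᴹ η *ₗ E₀ (j f₁)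
      sign-part = ≈ᴹ-trans (*ₗ-neg _ _) (≈ᴹ-trans (≈ᴹ-sym (neg-*ₗ _ _)) (*ₗ-congʳ (R.sym η≈-ε)))
      neg-part : -ᴹ (ε *ₗ E₀ (h (d f₁))) ≈ᴹ ε *ₗ E₀ (h (λ S → T.-ᴹ d f₁ S))
      neg-part = ≈ᴹ-trans (≈ᴹ-sym (*ₗ-neg _ _)) (*ₗ-congˡ (≈ᴹ-sym (≈ᴹ-trans (E₀.≈-cong (hl.neg-homo _)) (E₀.neg-homo _))))

module _ {r ℓ t ℓt u ℓu u′ ℓu′} {R : CommutativeRing r ℓ} (T : Module R t ℓt) (U : Module R u ℓu) (U′ : Module R u′ ℓu′)
         (ε : CommutativeRing.Carrier R) where

  private
    module U  = ModuleLemmas U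
    module U′ = ModuleLemmas U′
    module T  = ModuleLemmas T
    module EU  = Extension T U ε using (ext)
    module EU′ = Extension T U′ ε using (ext)

  ext-natural : ∀ {L} → IsLinear U U′ L → ∀ {H H′} → (∀ x → L (H x) U′.≈ᴹ H′ x) →
                ∀ {n} {E E′} → (∀ i → IsLinear U′ U′ (E′ i)) → (∀ i x → L (E i x) U′.≈ᴹ E′ i (L x)) →
                ∀ (f : Exterior.∣Λ∣ T n) → L (EU.ext H E f) U′.≈ᴹ EU′.ext H′ E′ f
  ext-natural L-linear L-H {zero}  E′-linear L-E f = L-H _
  ext-natural {L} L-linear {H} {H′} L-H {suc n} {E} {E′} E′-linear L-E f = begin
    L (h f₀ U.+ᴹ ε U.*ₗ E zero (h f₁))           ≈⟨ L.+-homo _ _ ⟩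
    L (h f₀) +ᴹ L (ε U.*ₗ E zero (h f₁))         ≈⟨ +ᴹ-congˡ (≈ᴹ-trans (L.*-homo _ _) (*ₗ-congˡ (L-E zero _))) ⟩
    L (h f₀) +ᴹ ε *ₗ E′ zero (L (h f₁))          ≈⟨ +ᴹ-cong (ih f₀) (*ₗ-congˡ (IsLinear.≈-cong (E′-linear zero) (ih f₁))) ⟩
    EU′.ext H′ (E′ ∘ suc) f₀ +ᴹ ε *ₗ E′ zero (EU′.ext H′ (E′ ∘ suc) f₁)   ∎
    where
    open U′
    module L = IsLinear L-linear
    f₀ = f ∘ (false ∷_)
    f₁ = f ∘ (true ∷_)
    h = EU.ext H (E ∘ suc)
    ih : ∀ f → L (h f) ≈ᴹ EU′.ext H′ (E′ ∘ suc) f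
    ih = ext-natural L-linear L-H (E′-linear ∘ suc) (L-E ∘ suc)

module _ {r ℓ t ℓt} {R : CommutativeRing r ℓ} (T : Module R t ℓt) where

  private module R = CommutativeRing R using (_≈_; 1#)
  open ModuleLemmas T
  open Exterior T

  -- Splitting off generator zero shows that the operators `e i`, acting on bare coefficients,
  -- rebuild every element. In `d-h` this turns the J part into the identity.
  ext-inj-e : ∀ {ε} → ε R.≈ R.1# → ∀ {n} (f : ∣Λ∣ n) S → Extension.ext T (Λ n) ε inj e f S ≈ᴹ f S
  ext-inj-e ε≈1 {zero} f [] = ≈ᴹ-refl
  ext-inj-e {ε} ε≈1 {suc n} f S = begin
    ext inj (e ∘ suc) f₀ S +ᴹ ε *ₗ e zero (ext inj (e ∘ suc) f₁) S
      ≈⟨ +ᴹ-cong (shift f₀ S) (≈ᴹ-trans (*ₗ-congʳ ε≈1) (≈ᴹ-trans (*ₗ-identityˡ _) (≈ᴹ-trans (e.≈-cong zero (shift f₁) S) (e₀-cons₀ f₁ S)))) ⟩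
    cons₀ f₀ S +ᴹ cons₁ f₁ S   ≈⟨ split S ⟩
    f S                        ∎
    where
    ext = Extension.ext T (Λ (suc n)) ε
    f₀ = f ∘ (false ∷_)
    f₁ = f ∘ (true ∷_)
    shift : ∀ g S → ext inj (e ∘ suc) g S ≈ᴹ cons₀ g S
    shift g S = ≈ᴹ-sym (≈ᴹ-trans (IsLinear.≈-cong cons₀-linear (λ U → ≈ᴹ-sym (ext-inj-e ε≈1 g U)) S)
      (ext-natural T (Λ n) (Λ (suc n)) ε cons₀-linear (λ x U → ≈ᴹ-refl) (e-linear ∘ suc)
        (λ i x U → ≈ᴹ-sym (e-cons₀ i x U)) g S))
    split : ∀ S → cons₀ f₀ S +ᴹ cons₁ f₁ S ≈ᴹ f S
    split (false ∷ S) = +ᴹ-identityʳ _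
    split (true ∷ S)  = +ᴹ-identityˡ _

  word-repeat : ∀ {n i} {τ : List (Fin n)} → i ∈ τ → ∀ f S → e i (word τ f) S ≈ᴹ 0ᴹ
  word-repeat {i = i} {_ ∷ τ} (here refl) f S = e-square i (word τ f) S
  word-repeat {i = i} {j ∷ τ} (there i∈τ) f S = begin
    e i (e j (word τ f)) S      ≈⟨ e-anticomm i j (word τ f) S ⟩
    -ᴹ e j (e i (word τ f)) S   ≈⟨ -ᴹ‿cong (≈ᴹ-trans (e.≈-cong j (word-repeat i∈τ f) S) (e.0-homo j S)) ⟩
    -ᴹ 0ᴹ                       ≈⟨ -ᴹ0≈0 ⟩
    0ᴹ                          ∎

-- Masks as simplices, and the monomial basis with scalar coefficients.

members : ∀ {n} → Vec Bool n → List (Fin n)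
members []          = []
members (false ∷ S) = List.map suc (members S)
members (true ∷ S)  = zero ∷ List.map suc (members S)

infix 4 _◃_

-- The facet relation: exactly one element of the right-hand mask is removed.
data _◃_ : ∀ {n} → Vec Bool n → Vec Bool n → Set where
  drop : ∀ {n} {S : Vec Bool n} → (false ∷ S) ◃ (true ∷ S)
  keep : ∀ {n b} {S T : Vec Bool n} → T ◃ S → (b ∷ T) ◃ (b ∷ S)

◃-length : ∀ {n} {S T : Vec Bool n} → T ◃ S → suc (length (members T)) ≡ length (members S)
◃-length drop = refl
◃-length (keep {b = false} {S} {T} p) =
  trans (cong suc (length-map suc (members T))) (trans (◃-length p) (sym (length-map suc (members S))))
◃-length (keep {b = true} {S} {T} p) =
  cong suc (trans (cong suc (length-map suc (members T))) (trans (◃-length p) (sym (length-map suc (members S)))))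

◃-⊆ : ∀ {n} {S T : Vec Bool n} → T ◃ S → members T ⊆ members S
◃-⊆ drop               = xs⊆x∷xs _ _
◃-⊆ (keep {b = false} p) = map⁺ suc (◃-⊆ p)
◃-⊆ (keep {b = true} p)  = ∷⁺ʳ zero (map⁺ suc (◃-⊆ p))

module Scalars {r ℓ} (R : CommutativeRing r ℓ) where

  private module R = CommutativeRing R using (1#)

  unit : Module R r ℓ
  unit = TensorUnit.⟨module⟩

  open ModuleLemmas unit
  open Exterior unit public
  open Differential (0-linear unit unit) public

  basis : ∀ {n} → Vec Bool n → ∣Λ∣ n
  basis []          = λ _ → R.1#
  basis (false ∷ S) = cons₀ (basis S)
  basis (true ∷ S)  = cons₁ (basis S)

  basis≈word : ∀ {n} (S : Vec Bool n) U → basis S U ≈ᴹ word (members S) (inj R.1#) U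
  basis≈word []          U = ≈ᴹ-refl
  basis≈word (false ∷ S) U = ≈ᴹ-trans (IsLinear.≈-cong cons₀-linear (basis≈word S) U)
    (≈ᴹ-sym (word-cons₀ (members S) (inj R.1#) U))
  basis≈word (true ∷ S)  U = ≈ᴹ-trans (IsLinear.≈-cong cons₁-linear (basis≈word S) U)
    (≈ᴹ-trans (≈ᴹ-sym (e₀-cons₀ _ U)) (e.≈-cong zero (λ U → ≈ᴹ-sym (word-cons₀ (members S) (inj R.1#) U)) U))

  Basis : ∀ {n p} → (Vec Bool n → Set p) → ∣Λ∣ n → Set (r ⊔ p)
  Basis P x = ∃ λ S → P S × x ≡ basis S

  basis-∈ : ∀ {n p} {P : Vec Bool n → Set p} S → P S → Span (Λ n) (Basis P) (basis S)
  basis-∈ S PS = base (_ , PS , refl)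

  d-basis : ∀ {n} (S : Vec Bool n) → Span (Λ n) (Basis (_◃ S)) (d (basis S))
  d-basis []          = resp (λ { [] → ≈ᴹ-refl }) 0-∈
  d-basis {suc n} (false ∷ S) = resp (λ U → ≈ᴹ-sym (d-cons₀ (basis S) U))
    (Span-map (Λ n) (Λ (suc n)) cons₀-linear (λ { (_ , p , refl) → basis-∈ _ (keep p) }) (d-basis S))
  d-basis {suc n} (true ∷ S)  = resp (λ U → ≈ᴹ-sym (d-cons₁ (basis S) U))
    (+-∈ (basis-∈ _ drop) (neg-∈ (Λ (suc n)) _
      (Span-map (Λ n) (Λ (suc n)) cons₁-linear (λ { (_ , p , refl) → basis-∈ _ (keep p) }) (d-basis S))))

  Inserted : ∀ {n} → Fin n → Vec Bool n → Vec Bool n → Set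
  Inserted i S S′ = length (members S′) ≡ suc (length (members S)) × members S′ ⊆ i ∷ members S

  e-basis : ∀ {n} (i : Fin n) S → Span (Λ n) (Basis (Inserted i S)) (e i (basis S))
  e-basis zero (false ∷ S) = resp (λ U → ≈ᴹ-sym (e₀-cons₀ (basis S) U)) (basis-∈ (true ∷ S) (refl , ⊆-refl))
  e-basis zero (true ∷ S)  = resp (λ { (false ∷ U) → ≈ᴹ-refl ; (true ∷ U) → ≈ᴹ-refl }) 0-∈
  e-basis {suc n} (suc i) (false ∷ S) = resp (λ U → ≈ᴹ-sym (e-cons₀ i (basis S) U))
    (Span-map (Λ n) (Λ (suc n)) cons₀-linear (λ where
      (S′ , (p , q) , refl) → basis-∈ (_ ∷ S′)
        ( trans (length-map suc (members S′)) (trans p (cong suc (sym (length-map suc (members S)))))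
        , map⁺ suc q))
      (e-basis i S))
  e-basis {suc n} (suc i) (true ∷ S)  = resp (λ { (false ∷ U) → ≈ᴹ-trans -ᴹ0≈0 (≈ᴹ-sym (e.0-homo i U)) ; (true ∷ U) → ≈ᴹ-refl })
    (neg-∈ (Λ (suc n)) _ (Span-map (Λ n) (Λ (suc n)) cons₁-linear (λ where
      (S′ , (p , q) , refl) → basis-∈ (true ∷ S′)
        ( cong suc (trans (length-map suc (members S′)) (trans p (cong suc (sym (length-map suc (members S))))))
        , ∈-∷⁺ʳ (there (here refl)) (⊆-trans (map⁺ suc q) λ where
            (here p) → here p
            (there p) → there (there p))))
      (e-basis i S)))

  -- Multiplying a monomial by a further letter gives zero if the letter is present, and otherwise a
  -- signed monomial with one more member.
  word-∈ : ∀ {n} (τ : List (Fin n)) →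
           Span (Λ n) (Basis λ S → length (members S) ≡ length τ × members S ⊆ τ) (word τ (inj R.1#))
  word-∈ {n} []      = resp (empty-word n) (basis-∈ (empty n) (empty-length n , λ p → empty-⊆ n p))
    where
    empty : ∀ n → Vec Bool n
    empty zero    = []
    empty (suc n) = false ∷ empty n
    empty-word : ∀ n U → basis (empty n) U ≈ᴹ inj R.1# U
    empty-word zero    U = ≈ᴹ-refl
    empty-word (suc n) U = IsLinear.≈-cong cons₀-linear (empty-word n) U
    empty-members : ∀ n → members (empty n) ≡ []
    empty-members zero    = refl
    empty-members (suc n) = cong (List.map suc) (empty-members n)
    empty-length : ∀ n → length (members (empty n)) ≡ 0
    empty-length n = cong length (empty-members n)
    empty-⊆ : ∀ n {i} → i ∈ members (empty n) → i ∈ []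
    empty-⊆ n p rewrite empty-members n = p
  word-∈ {n} (i ∷ τ) = Span-map (Λ n) (Λ n) (e-linear i) (λ where
    (S , (p , q) , refl) → Span-⊆ (Λ n) (λ where
        (S′ , (p′ , q′) , x≡) → S′ , (trans p′ (cong suc p) , ⊆-trans q′ (∷⁺ʳ i q)) , x≡)
      (e-basis i S)) (word-∈ τ)

  words : ∀ {n m} → Vec (Fin n) m → ∣Λ∣ n
  words s = word (toList s) (inj R.1#)

  d-1 : ∀ {n} (U : Vec Bool n) → d (inj R.1#) U ≈ᴹ 0ᴹ
  d-1 U = ≈ᴹ-trans (d-inj R.1# U) (IsLinear.0-homo inj-linear U)

  -- The derivation rule `d-e` at the first letter is the same recursion as `bd-∷`.
  d-words : ∀ {n m} (s : Vec (Fin n) (suc m)) U → d (words s) U ≈ᴹ Boundary.bd (Λ n) words s U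
  d-words {n} (i ∷ s) U = ≈ᴹ-trans (≈ᴹ-sym (x≈y+z⇒x-z≈y (≈ᴹ-sym (d-e i (words s) U)))) (tail s)
    where
    open Boundary (Λ n)
    tail : ∀ {m} (s : Vec (Fin n) m) → words s U +ᴹ -ᴹ e i (d (words s)) U ≈ᴹ bd words (i ∷ s) U
    tail []         = ≈ᴹ-trans (+ᴹ-congˡ (≈ᴹ-trans (-ᴹ‿cong (≈ᴹ-trans (e.≈-cong i d-1 U) (e.0-homo i U))) -ᴹ0≈0))
      (≈ᴹ-trans (+ᴹ-identityʳ _) (≈ᴹ-sym (bd-[ i ] U)))
    tail s@(_ ∷ _) = ≈ᴹ-trans (+ᴹ-congˡ (-ᴹ‿cong (≈ᴹ-trans (e.≈-cong i (d-words s) U) (bd-homo (Λ n) (Λ n) (e-linear i) words s U))))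
      (≈ᴹ-sym (bd-∷ words i s U))

  words-swap : ∀ {n m} {s t : Vec (Fin n) m} → AdjacentTransposition s t → ∀ U → words s U ≈ᴹ -ᴹ words t U
  words-swap (swap x y s) U = e-anticomm x y (words s) U
  words-swap (skip x p) U = ≈ᴹ-trans (e.≈-cong x (words-swap p) U) (e.neg-homo x _ U)

  module _ {b ℓb} (B : Module R b ℓb) where

    private module B = ModuleLemmas B

    -- The linear extension of values prescribed on the monomials, written as a tree of sums over
    -- all masks.
    lin : ∀ {n} → (Vec Bool n → B.Carrierᴹ) → ∣Λ∣ n → B.Carrierᴹ
    lin {zero}  b a = a [] B.*ₗ b []
    lin {suc n} b a = lin (b ∘ (false ∷_)) (a ∘ (false ∷_)) B.+ᴹ lin (b ∘ (true ∷_)) (a ∘ (true ∷_))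

    lin-linear : ∀ {n} (b : Vec Bool n → B.Carrierᴹ) → IsLinear (Λ n) B (lin b)
    lin-linear {zero} b = record
      { ≈-cong   = λ p → B.*ₗ-congʳ (p [])
      ; +-homo = λ x y → B.*ₗ-distribʳ _ _ _
      ; *-homo = λ k x → B.*ₗ-assoc _ _ _
      }
    lin-linear {suc n} b = +-linear (Λ (suc n)) B
      (∘-linear (Λ (suc n)) (Λ n) B (lin-linear (b ∘ (false ∷_))) (restrict-linear unit (false ∷_)))
      (∘-linear (Λ (suc n)) (Λ n) B (lin-linear (b ∘ (true ∷_))) (restrict-linear unit (true ∷_)))

    lin-basis : ∀ {n} (b : Vec Bool n → B.Carrierᴹ) S → lin b (basis S) B.≈ᴹ b S
    lin-basis b []          = B.*ₗ-identityˡ _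
    lin-basis b (false ∷ S) = B.≈ᴹ-trans (B.+ᴹ-cong (lin-basis _ S) (IsLinear.0-homo (lin-linear (b ∘ (true ∷_))))) (B.+ᴹ-identityʳ _)
    lin-basis b (true ∷ S)  = B.≈ᴹ-trans (B.+ᴹ-cong (IsLinear.0-homo (lin-linear (b ∘ (false ∷_)))) (lin-basis _ S)) (B.+ᴹ-identityˡ _)

    lin-agree : ∀ {n p} {P : Vec Bool n → Set p} {b} {f : ∣Λ∣ n → B.Carrierᴹ} → IsLinear (Λ n) B f →
                (∀ S → P S → b S B.≈ᴹ f (basis S)) → ∀ {a} → Span (Λ n) (Basis P) a → lin b a B.≈ᴹ f a
    lin-agree {n} {b = b} F h = agree-on-Span (Λ n) B (lin-linear b) F
      (λ { (S , PS , refl) → B.≈ᴹ-trans (lin-basis b S) (h S PS) })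

    lin-∈ : ∀ {n p q} {P : Vec Bool n → Set p} {Q : B.Carrierᴹ → Set q} {b} →
            (∀ S → P S → Span B Q (b S)) → ∀ {a} → Span (Λ n) (Basis P) a → Span B Q (lin b a)
    lin-∈ {n} {b = b} h = Span-map (Λ n) B (lin-linear b)
      (λ { (S , PS , refl) → resp (B.≈ᴹ-sym (lin-basis b S)) (h S PS) })

-- Sorting tuples by adjacent transpositions.

module _ {v} {V : Set v} where

  transposition-sym : ∀ {m} {s t : Vec V m} → AdjacentTransposition s t → AdjacentTransposition t s
  transposition-sym (swap x y s) = swap y x s
  transposition-sym (skip x p)   = skip x (transposition-sym p)

  transposition-⊆ : ∀ {m} {s t : Vec V m} → AdjacentTransposition s t → toList t ⊆ toList s
  transposition-⊆ (swap x y s) (here p)           = there (here p)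
  transposition-⊆ (swap x y s) (there (here p))   = here p
  transposition-⊆ (swap x y s) (there (there p))  = there (there p)
  transposition-⊆ (skip x q)   (here p)           = here p
  transposition-⊆ (skip x q)   (there p)          = there (transposition-⊆ q p)

  transposition-All : ∀ {m p} {P : V → Set p} {s t : Vec V m} → AdjacentTransposition s t → VecAll.All P s → VecAll.All P t
  transposition-All (swap x y s) (px ∷ py ∷ ps) = py ∷ px ∷ ps
  transposition-All (skip x q)   (px ∷ ps)      = px ∷ transposition-All q ps

  transposition-Unique : ∀ {m} {s t : Vec V m} → AdjacentTransposition s t → Distinct s → Distinct t
  transposition-Unique (swap x y s) ((x≢y ∷ x∉s) ∷ y∉s ∷ s!) = ((x≢y ∘ sym) ∷ y∉s) ∷ x∉s ∷ s!
  transposition-Unique (skip x q)   (x∉s ∷ s!)               = transposition-All q x∉s ∷ transposition-Unique q s!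

  fromList-length : ∀ {m} (τ : List V) → length τ ≡ m → ∃ λ (s : Vec V m) → toList s ≡ τ
  fromList-length τ refl = fromList τ , toList∘fromList τ

  toList-injective : ∀ {m} (s t : Vec V m) → toList s ≡ toList t → s ≡ t
  toList-injective []      []      p = refl
  toList-injective (x ∷ s) (y ∷ t) p with toList s in q | toList t in r
  toList-injective (x ∷ s) (y ∷ t) refl | _ | _ = cong (x ∷_) (toList-injective s t (trans q (sym r)))

  ∉⇒All-≢ : ∀ {m x} (s : Vec V m) → x ∉ toList s → VecAll.All (x ≢_) s
  ∉⇒All-≢ []      x∉ = []
  ∉⇒All-≢ (y ∷ s) x∉ = (x∉ ∘ here) ∷ ∉⇒All-≢ s (x∉ ∘ there)

transposition-map : ∀ {a b m} {A : Set a} {B : Set b} (f : A → B) {s t : Vec A m} →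
                    AdjacentTransposition s t → AdjacentTransposition (Vec.map f s) (Vec.map f t)
transposition-map f (swap x y s) = swap (f x) (f y) (Vec.map f s)
transposition-map f (skip x p)   = skip (f x) (transposition-map f p)

data _Lists_ : ∀ {n m} → Vec Bool n → Vec (Fin n) m → Set where
  []   : [] Lists []
  skip : ∀ {n m} {S : Vec Bool n} {s : Vec (Fin n) m} → S Lists s → (false ∷ S) Lists Vec.map suc s
  take : ∀ {n m} {S : Vec Bool n} {s : Vec (Fin n) m} → S Lists s → (true ∷ S) Lists (zero ∷ Vec.map suc s)

Lists-members : ∀ {n m} {S : Vec Bool n} {s : Vec (Fin n) m} → S Lists s → toList s ≡ members S
Lists-members []       = refl
Lists-members (skip p) = trans (toList-map _ _) (cong (List.map suc) (Lists-members p))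
Lists-members (take p) = cong (zero ∷_) (trans (toList-map _ _) (cong (List.map suc) (Lists-members p)))

Sortable : ∀ {n m} → Vec (Fin n) m → Set
Sortable s = ∃₂ λ S t → S Lists t × Star AdjacentTransposition s t

All-≢-unmap : ∀ {n m} {x : Fin n} (s : Vec (Fin n) m) → VecAll.All (suc x ≢_) (Vec.map suc s) → VecAll.All (x ≢_) s
All-≢-unmap []      []       = []
All-≢-unmap (y ∷ s) (p ∷ ps) = (p ∘ cong suc) ∷ All-≢-unmap s ps

-- Insertion into a sorted tuple: zero stays in front, and a larger entry passes a leading zero by
-- one transposition before the recursion on shifted entries.
sort-∷ : ∀ {n m} (x : Fin n) {S} {s : Vec (Fin n) m} → S Lists s → VecAll.All (x ≢_) s → Sortable (x ∷ s)
sort-∷ zero    (skip p) x∉       = _ , _ , take p , stop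
sort-∷ zero    (take p) (x≢ ∷ _) = contradiction refl x≢
sort-∷ (suc x) (skip {s = s} p) x∉ with sort-∷ x p (All-≢-unmap s x∉)
... | S , t , q , r = _ , _ , skip q , gmap (Vec.map suc) (transposition-map suc) r
sort-∷ (suc x) (take {s = s} p) (_ ∷ x∉) with sort-∷ x p (All-≢-unmap s x∉)
... | S , t , q , r = _ , _ , take q ,
  swap _ _ _ ◅ gmap (λ u → zero ∷ Vec.map suc u) (skip zero ∘ transposition-map suc) r

sort : ∀ {n m} (s : Vec (Fin n) m) → Distinct s → Sortable s
sort {zero}  []      []  = _ , _ , [] , stop
sort {suc n} []      []  with sort {n} [] []
... | S , [] , p , _ = _ , _ , skip p , stop
sort         (x ∷ s) (x∉s ∷ s!) with sort s s!
... | S , t , p , q with sort-∷ x p (transpositions-All q x∉s)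
  where
  transpositions-All : ∀ {m} {s t : Vec (Fin _) m} → Star AdjacentTransposition s t → VecAll.All (x ≢_) s → VecAll.All (x ≢_) t
  transpositions-All stop        a = a
  transpositions-All (p ◅ ps) a = transpositions-All ps (transposition-All p a)
... | S′ , t′ , p′ , q′ = S′ , t′ , p′ , gmap (x ∷_) (skip x) q ◅◅ q′

unique? : ∀ {n m} (s : Vec (Fin n) m) → Dec (Distinct s)
unique? []      = yes []
unique? (x ∷ s) with unique? s | VecAll.all? (λ y → ¬? (x ≟ y)) s
... | yes s! | yes x∉s = yes (x∉s ∷ s!)
... | yes s! | no x∈s  = no λ { (x∉s ∷ _) → x∈s x∉s }
... | no ¬s! | _       = no λ { (_ ∷ s!) → ¬s! s! }

-- Chains of a complex on `Fin n` as elements of the exterior algebra.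

module NerveChains {r ℓ p} (R : CommutativeRing r ℓ) {n : ℕ} (K : SimplicialComplex (Fin n) p) where

  private module R = CommutativeRing R using (1#)
  open Scalars R using (unit; Λ; ∣Λ∣; inj; word; words; words-swap; d; d-1; d-words; basis≈word; lin; lin-linear; lin-basis; module e; module d)
  private
    module Λ = ModuleLemmas (Λ n)

  words-unique : ∀ {m} (s : Vec (Fin n) m) → Distinct s ⊎ (words s Λ.≈ᴹ Λ.0ᴹ)
  words-unique []      = inj₁ []
  words-unique (x ∷ s) with words-unique s
  ... | inj₂ s≈0 = inj₂ (Λ.≈ᴹ-trans (e.≈-cong x s≈0) (e.0-homo x))
  ... | inj₁ s! with x ∈? toList s
  ... | yes x∈s = inj₂ (word-repeat unit x∈s (inj R.1#))
  ... | no  x∉s = inj₁ (∉⇒All-≢ s x∉s ∷ s!)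

  module _ (m : ℕ) where
    open Evaluation {G = OrderedFace K m} (Λ n) (λ s → words (vertices s)) public renaming (eval to fwdAt)

    fwd-resp : ∀ {x y} → Orientation R K m x y → fwdAt x Λ.≈ᴹ fwdAt y
    fwd-resp (same {s} {t} p) = Λ.≈ᴹ-reflexive (cong words p)
    fwd-resp (swapped p)      = words-swap p

    fwd-linear : IsLinear (chains R K m) (Λ n) fwdAt
    fwd-linear = eval-linear fwd-resp

  fwd : ∀ {m} → Chain R K m → ∣Λ∣ n
  fwd {m} = fwdAt m

  fwd-∂ : ∀ {m} (x : Chain R K (suc m)) → fwd (∂ R K x) Λ.≈ᴹ d (fwd x)
  fwd-∂ {m} (gen s) = Λ.≈ᴹ-trans (IsLinear.lc-homo (fwd-linear m) (Boundary.sign (Λ n)) (λ i → gen (deleteVertex s i)))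
    (Λ.≈ᴹ-trans (Λ.≈ᴹ-reflexive (sym (Boundary.bd-unfold (Λ n) words (vertices s)))) (Λ.≈ᴹ-sym (d-words (vertices s))))
  fwd-∂ 𝟎       = Λ.≈ᴹ-sym d.0-homo
  fwd-∂ (x ⊕ y) = Λ.≈ᴹ-trans (Λ.+ᴹ-cong (fwd-∂ x) (fwd-∂ y)) (Λ.≈ᴹ-sym (d.+-homo _ _))
  fwd-∂ (⊖ x)   = Λ.≈ᴹ-trans (Λ.-ᴹ‿cong (fwd-∂ x)) (Λ.≈ᴹ-sym (d.neg-homo _))
  fwd-∂ (k · x) = Λ.≈ᴹ-trans (Λ.*ₗ-congˡ (fwd-∂ x)) (Λ.≈ᴹ-sym (d.*-homo _ _))

  -- `∂` starts at one vertex, so for the augmentation degree the cycle equation is checked in the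
  -- algebra, on multiples of the unit.
  d-fwd₀ : (x : Chain R K 0) → d (fwd x) Λ.≈ᴹ Λ.0ᴹ
  d-fwd₀ (gen (orderedFace [] _ _)) = d-1
  d-fwd₀ 𝟎       = d.0-homo
  d-fwd₀ (x ⊕ y) = Λ.≈ᴹ-trans (d.+-homo _ _) (Λ.≈ᴹ-trans (Λ.+ᴹ-cong (d-fwd₀ x) (d-fwd₀ y)) (Λ.+ᴹ-identityˡ _))
  d-fwd₀ (⊖ x)   = Λ.≈ᴹ-trans (d.neg-homo _) (Λ.≈ᴹ-trans (Λ.-ᴹ‿cong (d-fwd₀ x)) Λ.-ᴹ0≈0)
  d-fwd₀ (k · x) = Λ.≈ᴹ-trans (d.*-homo _ _) (Λ.≈ᴹ-trans (Λ.*ₗ-congˡ (d-fwd₀ x)) (Λ.*ₗ-zeroʳ k))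

  Word : ℕ → ∣Λ∣ n → Set (r ⊔ p)
  Word m x = ∃ λ (s : Vec (Fin n) m) → Face K (toList s) × x ≡ words s

  -- A word with a repeated letter vanishes and is the image of `𝟎`; any other word in the span
  -- comes from an ordered face.
  Span⇒fwd : ∀ {m x} → Span (Λ n) (Word m) x → ∃ λ (c : Chain R K m) → fwd c Λ.≈ᴹ x
  Span⇒fwd (base (s , s∈K , refl)) with words-unique s
  ... | inj₁ s!  = gen (orderedFace s s! s∈K) , Λ.≈ᴹ-refl
  ... | inj₂ s≈0 = 𝟎 , Λ.≈ᴹ-sym s≈0
  Span⇒fwd 0-∈ = 𝟎 , Λ.≈ᴹ-refl
  Span⇒fwd (+-∈ x∈ y∈) with Span⇒fwd x∈ | Span⇒fwd y∈
  ... | c , p | c′ , p′ = c ⊕ c′ , Λ.+ᴹ-cong p p′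
  Span⇒fwd (*-∈ k x∈) with Span⇒fwd x∈
  ... | c , p = k · c , Λ.*ₗ-congˡ p
  Span⇒fwd (resp x≈y x∈) with Span⇒fwd x∈
  ... | c , p = c , Λ.≈ᴹ-trans p x≈y

  module _ {m : ℕ} (face? : (s : Vec (Fin n) m) → Dec (Face K (toList s))) where
    private module C = ModuleLemmas (chains R K m)

    generatorAt : Vec (Fin n) m → Chain R K m
    generatorAt s with unique? s | face? s
    ... | yes s! | yes s∈K = gen (orderedFace s s! s∈K)
    ... | _      | _       = 𝟎

    generatorAt-gen : ∀ (s : OrderedFace K m) → generatorAt (vertices s) C.≈ᴹ gen s
    generatorAt-gen (orderedFace s s! s∈K) with unique? s | face? s
    -- `same` compares vertices only, so the witnesses found by the decisions may differ from the
    -- given ones.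
    ... | yes _ | yes _ = Presented.relation (same refl)
    ... | no s¡ | _     = contradiction s! s¡
    ... | yes _ | no s∉ = contradiction s∈K s∉

    generator : Vec Bool n → Chain R K m
    generator S with length (members S) ℕ.≟ m
    ... | no _  = 𝟎
    ... | yes q = generatorAt (proj₁ (fromList-length (members S) q))

    generator-gen : ∀ S (s : OrderedFace K m) → toList (vertices s) ≡ members S → generator S C.≈ᴹ gen s
    generator-gen S s p with length (members S) ℕ.≟ m
    ... | no q  = contradiction (trans (cong length (sym p)) (length-toList (vertices s))) q
    ... | yes q = C.≈ᴹ-trans
      (C.≈ᴹ-reflexive (cong generatorAt (toList-injective _ _ (trans (proj₂ (fromList-length (members S) q)) (sym p)))))
      (generatorAt-gen s)

    back : ∣Λ∣ n → Chain R K m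
    back = lin (chains R K m) generator

    back-linear : IsLinear (Λ n) (chains R K m) back
    back-linear = lin-linear (chains R K m) generator

    back-listed : ∀ {S t} → S Lists t → ∀ t! t∈K → back (words t) C.≈ᴹ gen (orderedFace t t! t∈K)
    back-listed {S} {t} p t! t∈K = C.≈ᴹ-trans
      (IsLinear.≈-cong back-linear (Λ.≈ᴹ-trans
        (Λ.≈ᴹ-reflexive (cong (λ τ → word τ (inj R.1#)) (Lists-members p)))
        (Λ.≈ᴹ-sym (basis≈word S))))
      (C.≈ᴹ-trans (lin-basis (chains R K m) generator S) (generator-gen S (orderedFace t t! t∈K) (Lists-members p)))

    -- Each transposition on the way to the sorted tuple changes the sign in the algebra and, by
    -- `swapped`, among ordered faces, so the two sides stay in step.
    back-sorted : ∀ {S s t} → S Lists t → Star AdjacentTransposition s t → ∀ s! s∈K → back (words s) C.≈ᴹ gen (orderedFace s s! s∈K)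
    back-sorted p stop        s! s∈K = back-listed p s! s∈K
    back-sorted p (_◅_ {i = s} {j = u} q qs) s! s∈K = begin
      back (words s)           ≈⟨ IsLinear.≈-cong back-linear (words-swap q) ⟩
      back (Λ.-ᴹ words u)      ≈⟨ IsLinear.neg-homo back-linear (words u) ⟩
      C.-ᴹ back (words u)      ≈⟨ C.-ᴹ‿cong (back-sorted p qs (transposition-Unique q s!) (Face-down-closed K s∈K (transposition-⊆ q))) ⟩
      C.-ᴹ gen _               ≈⟨ Presented.relation (swapped q) ⟨
      gen (orderedFace _ s! s∈K)   ∎
      where open C

    back-fwd : ∀ x → back (fwd x) C.≈ᴹ x
    back-fwd = agree-on-gens (chains R K m)
      (∘-linear (chains R K m) (Λ n) (chains R K m) back-linear (fwd-linear m)) (id-linear (chains R K m))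
      (λ { (orderedFace s s! s∈K) → let (_ , _ , p , q) = sort s s! in back-sorted p q s! s∈K })

    -- The left inverse `back` must supply a face witness for each monomial; this is where decided
    -- faces enter.
    fwd-injective : ∀ {x y} → fwd x Λ.≈ᴹ fwd y → x C.≈ᴹ y
    fwd-injective {x} {y} p = C.≈ᴹ-trans (C.≈ᴹ-sym (back-fwd x)) (C.≈ᴹ-trans (IsLinear.≈-cong back-linear p) (back-fwd y))

-- Finite choice and finitely many decisions under double negation.

infixl 1 _>>=_

_>>=_ : ∀ {a b} {A : Set a} {B : Set b} → ¬ ¬ A → (A → ¬ ¬ B) → ¬ ¬ B
(¬¬a >>= f) ¬b = ¬¬a (λ a → f a ¬b)

pure : ∀ {a} {A : Set a} → A → ¬ ¬ A
pure a ¬a = ¬a a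

¬¬-Fin : ∀ {n p} {P : Fin n → Set p} → (∀ i → ¬ ¬ P i) → ¬ ¬ (∀ i → P i)
¬¬-Fin {zero}  h = pure λ ()
¬¬-Fin {suc n} h = h zero >>= λ p → ¬¬-Fin (h ∘ suc) >>= λ ps → pure λ { zero → p ; (suc i) → ps i }

¬¬-Bool : ∀ {p} {P : Bool → Set p} → (∀ b → ¬ ¬ P b) → ¬ ¬ (∀ b → P b)
¬¬-Bool h = h true >>= λ p → h false >>= λ q → pure λ { true → p ; false → q }

-- Double negation commutes with quantification over a finite type. The argument is this principle
-- for the entries, and it is applied once for each position.
¬¬-Vec : ∀ {a} {A : Set a} → (∀ {p} {P : A → Set p} → (∀ x → ¬ ¬ P x) → ¬ ¬ (∀ x → P x)) →
         ∀ {m p} {P : Vec A m → Set p} → (∀ s → ¬ ¬ P s) → ¬ ¬ (∀ s → P s)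
¬¬-Vec choice {zero}  h = h [] >>= λ p → pure λ { [] → p }
¬¬-Vec choice {suc m} h = choice (λ x → ¬¬-Vec choice (λ s → h (x ∷ s))) >>= λ p → pure λ { (x ∷ s) → p x s }

Simplex-⊆⊇ : ∀ {v p} {V : Set v} (K : SimplicialComplex V p) {s t : List V} → Simplex K s → t ⊆ s → s ⊆ t → Simplex K t
Simplex-⊆⊇ K {[]}    s∈K t⊆s s⊆t = contradiction s∈K (nonempty K)
Simplex-⊆⊇ K {_ ∷ _} s∈K t⊆s s⊆t = down-closed K s∈K t⊆s λ { refl → case s⊆t (here refl) of λ () }

lookup-⊆ : ∀ {v m k} {V : Set v} (t : Vec V m) (s : Vec (Fin m) k) → toList (Vec.map (lookup t) s) ⊆ toList t
lookup-⊆ t (i ∷ s) (here refl) = ∈-toList⁺ (∈-lookup i t)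
lookup-⊆ t (i ∷ s) (there p)   = lookup-⊆ t s p

∈-members-tabulate⁺ : ∀ {n} (b : Fin n → Bool) i → b i ≡ true → i ∈ members (tabulate b)
∈-members-tabulate⁺ b zero p rewrite p = here refl
∈-members-tabulate⁺ b (suc i) p with b zero
... | true  = there (∈-map⁺ suc (∈-members-tabulate⁺ (b ∘ suc) i p))
... | false = ∈-map⁺ suc (∈-members-tabulate⁺ (b ∘ suc) i p)

∈-members-tabulate⁻ : ∀ {n} (b : Fin n → Bool) {i} → i ∈ members (tabulate b) → b i ≡ true
∈-members-tabulate⁻ {suc n} b i∈ with b zero in eq
∈-members-tabulate⁻ {suc n} b (here refl) | true = eq
∈-members-tabulate⁻ {suc n} b (there i∈)  | true with ∈-map⁻ suc i∈
... | _ , j∈ , refl = ∈-members-tabulate⁻ (b ∘ suc) j∈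
∈-members-tabulate⁻ {suc n} b i∈ | false with ∈-map⁻ suc i∈
... | _ , j∈ , refl = ∈-members-tabulate⁻ (b ∘ suc) j∈

mask : ∀ {n} → List (Fin n) → Vec Bool n
mask τ = tabulate (λ i → does (i ∈? τ))

mask-⊆ : ∀ {n} (τ : List (Fin n)) → members (mask τ) ⊆ τ
mask-⊆ τ {i} i∈ with i ∈? τ | ∈-members-tabulate⁻ _ i∈
... | yes p | _  = p

⊆-mask : ∀ {n} (τ : List (Fin n)) → τ ⊆ members (mask τ)
⊆-mask τ {i} i∈ = ∈-members-tabulate⁺ _ i (dec-true (i ∈? τ) i∈)

-- Being a simplex depends only on the set of positions used, so one decision for each of the
-- finitely many masks settles tuples of every length.
¬¬-decide : ∀ {v p} {V : Set v} (K : SimplicialComplex V p) {N} (W : Fin N → V) →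
            ¬ ¬ (∀ {m} (s : Vec (Fin N) m) → Dec (Simplex K (toList (Vec.map W s))))
¬¬-decide K {N} W = ¬¬-Vec ¬¬-Bool {P = λ S → Dec (Simplex K (List.map W (members S)))} (λ S → ¬¬-excluded-middle)
  >>= λ dec → pure λ {m} (s : Vec (Fin N) m) →
    map′ (λ t∈ → Simplex-⊆⊇ K t∈ (to s) (from s)) (λ s∈ → Simplex-⊆⊇ K s∈ (from s) (to s)) (dec (mask (toList s)))
  where
  to : ∀ {m} (s : Vec (Fin N) m) → toList (Vec.map W s) ⊆ List.map W (members (mask (toList s)))
  to s rewrite toList-map W s = map⁺ W (⊆-mask (toList s))
  from : ∀ {m} (s : Vec (Fin N) m) → List.map W (members (mask (toList s))) ⊆ toList (Vec.map W s)
  from s rewrite toList-map W s = map⁺ W (mask-⊆ (toList s))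

-- Choosing a first element, and moving words past operators.

module _ {a p} {A : Set a} {P : A → Set p} (P? : ∀ x → Dec (P x)) where

  choose : A → List A → A
  choose j []      = j
  choose j (i ∷ σ) with P? i
  ... | yes _ = i
  ... | no _  = choose j σ

  choose-∈ : ∀ {j} σ {τ} → j ∈ τ → σ ⊆ τ → choose j σ ∈ τ
  choose-∈ []      j∈ σ⊆ = j∈
  choose-∈ (i ∷ σ) j∈ σ⊆ with P? i
  ... | yes _ = σ⊆ (here refl)
  ... | no _  = choose-∈ σ j∈ (σ⊆ ∘ there)

  choose-holds : ∀ {j i} σ → i ∈ σ → P i → P (choose j σ)
  choose-holds (i ∷ σ) i∈ Pi with P? i
  ... | yes p = p
  choose-holds (i ∷ σ) (here refl) Pi | no q = contradiction Pi q
  choose-holds (i ∷ σ) (there i∈)  Pi | no q = choose-holds σ i∈ Pi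

-- The search reads only the truth values. The defaults must agree unless some element of the list
-- is sure to be found.
choose-cong : ∀ {a p q} {A : Set a} {P : A → Set p} {Q : A → Set q} (P? : ∀ x → Dec (P x)) (Q? : ∀ x → Dec (Q x)) →
              (∀ i → P i → Q i) → (∀ i → Q i → P i) → ∀ j j′ σ → (j ≡ j′ ⊎ (∃ λ i → i ∈ σ × P i)) →
              choose P? j σ ≡ choose Q? j′ σ
choose-cong P? Q? f g j j′ [] (inj₁ refl) = refl
choose-cong P? Q? f g j j′ (i ∷ σ) h with P? i | Q? i
... | yes p | yes q = refl
... | yes p | no q  = contradiction (f i p) q
... | no p  | yes q = contradiction (g i q) p
... | no p  | no q  = choose-cong P? Q? f g j j′ σ (rest h)
  where
  rest : _ → _
  rest (inj₁ r)                    = inj₁ r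
  rest (inj₂ (_ , here refl , Pi)) = contradiction Pi p
  rest (inj₂ (_ , there i∈ , Pi))  = inj₂ (_ , i∈ , Pi)

module _ {r ℓ t ℓt u ℓu} {R : CommutativeRing r ℓ} (T : Module R t ℓt) (U : Module R u ℓu) {n : ℕ}
         {ε : CommutativeRing.Carrier R} {L : Exterior.∣Λ∣ T n → Exterior.∣Λ∣ U n} where

  private
    module R = CommutativeRing R using (1#; _*_)
    module T = Exterior T
    module U = Exterior U
  open ModuleLemmas (U.Λ n)

  -- Each letter costs one factor ε. Only the existence of the total scalar is recorded, since spans
  -- are closed under scaling.
  skew-word : (∀ i f → L (T.e i f) ≈ᴹ ε *ₗ U.e i (L f)) →
              ∀ τ f → ∃ λ k → L (T.word τ f) ≈ᴹ k *ₗ U.word τ (L f)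
  skew-word skew []      f = R.1# , ≈ᴹ-sym (*ₗ-identityˡ _)
  skew-word skew (i ∷ τ) f with skew-word skew τ f
  ... | k , p = ε R.* k , (begin
    L (T.e i (T.word τ f))               ≈⟨ skew i _ ⟩
    ε *ₗ U.e i (L (T.word τ f))          ≈⟨ *ₗ-congˡ (≈ᴹ-trans (U.e.≈-cong i p) (IsLinear.*-homo (U.e-linear i) k _)) ⟩
    ε *ₗ (k *ₗ U.e i (U.word τ (L f)))   ≈⟨ *ₗ-assoc _ _ _ ⟨
    (ε R.* k) *ₗ U.e i (U.word τ (L f))  ∎)

_⊆?_ : ∀ {n} (σ τ : List (Fin n)) → Dec (σ ⊆ τ)
σ ⊆? τ = map′ (λ a → ListAll.lookup a) ListAll.tabulate (ListAll.all? (λ i → i ∈? τ) σ)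

module _ {v p q} {V : Set v} {K : SimplicialComplex V p} {L : SimplicialComplex V q} (K⊆L : K ⊆ᶜ L) where

  Face-incl : ∀ s → Face K s → Face L s
  Face-incl []        _   = _
  Face-incl s@(_ ∷ _) s∈K = K⊆L s s∈K

  inclFace : ∀ {m} → OrderedFace K m → OrderedFace L m
  inclFace (orderedFace s s! s∈K) = orderedFace s s! (Face-incl (toList s) s∈K)

-- Inclusions of subcomplexes, and change of coefficients.

module Chains {r ℓ v} (R : CommutativeRing r ℓ) {V : Set v} where

  private module R = CommutativeRing R using (refl)
  open Scalars R using (∣Λ∣; lin)

  module _ {p q} {K : SimplicialComplex V p} {L : SimplicialComplex V q} (K⊆L : K ⊆ᶜ L) where

    incl : ∀ {m} → Chain R K m → Chain R L m
    incl {m} = Evaluation.eval (chains R L m) (λ s → gen (inclFace K⊆L s))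

    incl-linear : ∀ {m} → IsLinear (chains R K m) (chains R L m) incl
    incl-linear {m} = Evaluation.eval-linear (chains R L m) _ λ where
      (same p)    → Presented.relation (same p)
      (swapped p) → Presented.relation (swapped p)

    incl-∂ : ∀ {m} (x : Chain R K (suc m)) → Module._≈ᴹ_ (chains R L m) (∂ R L (incl x)) (incl (∂ R K x))
    incl-∂ {m} (gen s) = C.≈ᴹ-trans
      (IsLinear.≈-cong (lc-linear (chains R L m) (Boundary.sign (chains R L m)))
        {λ i → gen (deleteVertex (inclFace K⊆L s) i)} {λ i → gen (inclFace K⊆L (deleteVertex s i))}
        (λ i → Presented.relation (same {s = deleteVertex (inclFace K⊆L s) i} {inclFace K⊆L (deleteVertex s i)} refl)))
      (C.≈ᴹ-sym (IsLinear.lc-homo (incl-linear {m}) (Boundary.sign (chains R L m)) (λ i → gen (deleteVertex s i))))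
      where module C = ModuleLemmas (chains R L m)
    incl-∂ 𝟎       = Presented.≈-refl
    incl-∂ (x ⊕ y) = Presented.⊕-cong (incl-∂ x) (incl-∂ y)
    incl-∂ (⊖ x)   = Presented.⊖-cong (incl-∂ x)
    incl-∂ (k · x) = Presented.·-cong R.refl (incl-∂ x)

  incl-incl : ∀ {p q u} {K : SimplicialComplex V p} {L : SimplicialComplex V q} {N : SimplicialComplex V u}
              (K⊆L : K ⊆ᶜ L) (L⊆N : L ⊆ᶜ N) (K⊆N : K ⊆ᶜ N) {m} (x : Chain R K m) →
              Module._≈ᴹ_ (chains R N m) (incl {K = L} {N} L⊆N (incl {K = K} {L} K⊆L x)) (incl {K = K} {N} K⊆N x)
  incl-incl {K = K} {L} {N} K⊆L L⊆N K⊆N {m} = agree-on-gens (chains R N m)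
    (∘-linear (chains R K m) (chains R L m) (chains R N m) (incl-linear {K = L} {N} L⊆N) (incl-linear {K = K} {L} K⊆L))
    (incl-linear {K = K} {N} K⊆N)
    (λ s → Presented.relation (same refl))

  incl-unique : ∀ {p q} {K : SimplicialComplex V p} {L : SimplicialComplex V q} (i j : K ⊆ᶜ L) {m} (x : Chain R K m) →
                Module._≈ᴹ_ (chains R L m) (incl {K = K} {L} i x) (incl {K = K} {L} j x)
  incl-unique {K = K} {L} i j {m} = agree-on-gens (chains R L m) (incl-linear {K = K} {L} i) (incl-linear {K = K} {L} j)
    (λ s → Presented.relation (same refl))

  -- `lin` builds a term, and `∂` passes through its sums and multiples by definition.
  ∂-lin : ∀ {q} (L : SimplicialComplex V q) {n m} (b : Vec Bool n → Chain R L (suc m)) a →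
          ∂ R L (lin (chains R L (suc m)) b a) ≡ lin (chains R L m) (∂ R L ∘ b) a
  ∂-lin L {zero}  b a = refl
  ∂-lin L {suc n} b a = cong₂ _⊕_ (∂-lin L (b ∘ (false ∷_)) (a ∘ (false ∷_))) (∂-lin L (b ∘ (true ∷_)) (a ∘ (true ∷_)))

module _ {r ℓ t ℓt u ℓu} {R : CommutativeRing r ℓ} (T : Module R t ℓt) (U : Module R u ℓu)
         {κ : Module.Carrierᴹ T → Module.Carrierᴹ U} (κ-linear : IsLinear T U κ) where

  private
    module T = Exterior T
    module U = Exterior U
    module κ = IsLinear κ-linear
  open ModuleLemmas U

  e-natural : ∀ {n} (i : Fin n) f S → κ (T.e i f S) ≈ᴹ U.e i (κ ∘ f) S
  e-natural zero    f (false ∷ S) = κ.0-homo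
  e-natural zero    f (true ∷ S)  = ≈ᴹ-refl
  e-natural (suc i) f (false ∷ S) = e-natural i _ S
  e-natural (suc i) f (true ∷ S)  = ≈ᴹ-trans (κ.neg-homo _) (-ᴹ‿cong (e-natural i _ S))

  inj-natural : ∀ {n} x (S : Vec Bool n) → κ (T.inj x S) ≈ᴹ U.inj (κ x) S
  inj-natural x []          = ≈ᴹ-refl
  inj-natural x (false ∷ S) = inj-natural x S
  inj-natural x (true ∷ S)  = κ.0-homo

  word-natural : ∀ {n} (τ : List (Fin n)) f S → κ (T.word τ f S) ≈ᴹ U.word τ (κ ∘ f) S
  word-natural []      f S = ≈ᴹ-refl
  word-natural (i ∷ τ) f S = ≈ᴹ-trans (e-natural i (T.word τ f) S) (U.e.≈-cong i (word-natural τ f) S)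

  d-natural : ∀ {δ} (δ-linear : IsLinear T T δ) {δ′} (δ′-linear : IsLinear U U δ′) → (∀ x → κ (δ x) ≈ᴹ δ′ (κ x)) →
              ∀ {n} f (S : Vec Bool n) → κ (T.Differential.d δ-linear f S) ≈ᴹ U.Differential.d δ′-linear (κ ∘ f) S
  d-natural l l′ h f []          = h _
  d-natural l l′ h f (false ∷ S) = ≈ᴹ-trans (κ.+-homo _ _) (+ᴹ-congʳ (d-natural l l′ h _ S))
  d-natural l l′ h f (true ∷ S)  = ≈ᴹ-trans (κ.neg-homo _) (-ᴹ‿cong (d-natural l l′ h _ S))

  map-linear : ∀ n → IsLinear (T.Λ n) (U.Λ n) (κ ∘_)
  map-linear n = record
    { ≈-cong = λ p S → κ.≈-cong (p S) ; +-homo = λ _ _ S → κ.+-homo _ _ ; *-homo = λ _ _ S → κ.*-homo _ _ }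

module _ {r ℓ b ℓb c ℓc} {R : CommutativeRing r ℓ} (B : Module R b ℓb) (C : Module R c ℓc) where
  private module C = Module C using (_≈ᴹ_; ≈ᴹ-trans; +ᴹ-cong)
  open Scalars R using (lin)

  lin-homo : ∀ {L} → IsLinear B C L → ∀ {n} (b : Vec Bool n → Module.Carrierᴹ B) a → L (lin B b a) C.≈ᴹ lin C (L ∘ b) a
  lin-homo L {zero}  b a = IsLinear.*-homo L _ _
  lin-homo L {suc n} b a = C.≈ᴹ-trans (IsLinear.+-homo L _ _) (C.+ᴹ-cong
    (lin-homo L (b ∘ (false ∷_)) (a ∘ (false ∷_))) (lin-homo L (b ∘ (true ∷_)) (a ∘ (true ∷_))))

members-unique : ∀ {n} (S : Vec Bool n) → Unique (members S)
members-unique []          = []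
members-unique (false ∷ S) = UniqueProperties.map⁺ Fin.suc-injective (members-unique S)
members-unique (true ∷ S)  = ListAllProperties.map⁺ (ListAll.tabulate λ _ ()) ∷ UniqueProperties.map⁺ Fin.suc-injective (members-unique S)

module _ {r ℓ v p} (R : CommutativeRing r ℓ) {V : Set v} (K : SimplicialComplex V p) where

  -- Read off the term and not its class, so faces that cancel are listed too; it only matters that
  -- the list is finite and contains every face in use.
  facesOf : ∀ {m} → Chain R K m → List (List V)
  facesOf (gen s) = toList (vertices s) ∷ []
  facesOf 𝟎       = []
  facesOf (x ⊕ y) = facesOf x ++ facesOf y
  facesOf (⊖ x)   = facesOf x
  facesOf (k · x) = facesOf x

  facesOf-Face : ∀ {m} (x : Chain R K m) → ListAll.All (Face K) (facesOf x)
  facesOf-Face (gen s) = isFace s ∷ []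
  facesOf-Face 𝟎       = []
  facesOf-Face (x ⊕ y) = ListAllProperties.++⁺ (facesOf-Face x) (facesOf-Face y)
  facesOf-Face (⊖ x)   = facesOf-Face x
  facesOf-Face (k · x) = facesOf-Face x

  chain-lc : ∀ {m d} (a : Fin d → CommutativeRing.Carrier R) (z : Fin d → Cycle R K m) →
             chain (linearCombination (homologyModule R K m) a z) ≡ linearCombination (chains R K m) a (chain ∘ z)
  chain-lc {d = zero}  a z = refl
  chain-lc {d = suc d} a z = cong (a zero · chain (z zero) ⊕_) (chain-lc (a ∘ suc) (z ∘ suc))

length-++-suc : ∀ {a k m m′} {A : Set a} (σ : List A) {τ : List A} →
                length σ + m ≡ k → length τ + m′ ≡ suc m → length (σ ++ τ) + m′ ≡ suc k
length-++-suc []      p q = trans q (cong suc p)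
length-++-suc {k = suc k} (_ ∷ σ) p q = cong suc (length-++-suc σ (ℕ.suc-injective p) q)

-- The simplices at which fillers are built, with a cap on their size. They are decidable because φ
-- is defined by cases on them, outside any double negation.
record DecidableFaces (n : ℕ) : Set₁ where
  field
    Good   : List (Fin n) → Set
    good?  : ∀ σ → Dec (Good σ)
    good-⊆ : ∀ {σ τ} → Good σ → τ ⊆ σ → Good τ
    bound  : ℕ

module NerveTheorem {r ℓ v p} (R : CommutativeRing r ℓ) {V : Set v} {n : ℕ} (Γ : Fin n → SimplicialComplex V p) where

  private module R = CommutativeRing R using (Carrier; -_; 1#; sym; ring; refl)
  open Chains R {V} using (incl; incl-linear; incl-∂; incl-incl; incl-unique; ∂-lin)

  -- Chains of X as combinations of cells that carry decisions about Γ.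

  module Cells where

    -- V need not have decidable equality, so a cell is an ordered tuple of positions in a finite
    -- family W of vertices for which membership in each Γ i has been decided.
    record Ambient : Set (v ⊔ p) where
      no-eta-equality
      field
        {size}  : ℕ
        W       : Fin size → V
        covered : ∀ {m} (s : Vec (Fin size) (suc m)) → ∃ λ i → Simplex (Γ i) (toList (Vec.map W s))
        member? : ∀ i {m} (s : Vec (Fin size) m) → Dec (Simplex (Γ i) (toList (Vec.map W s)))

    open Ambient public

    record Cell : Set (v ⊔ p) where
      constructor cell
      field
        ambient : Ambient
        {arity} : ℕ
        tuple   : Vec (Fin (size ambient)) arity

    open Presented R Cell using (Term)

    -- Cells from different ambients are identified through the names of their vertices, so the
    -- class of a cell does not depend on the decisions stored with it.
    data CellOrientation : Rel Term (r ⊔ v ⊔ p) where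
      same    : ∀ {A A′ m} {s : Vec _ m} {s′} → Vec.map (W A) s ≡ Vec.map (W A′) s′ →
                CellOrientation (gen (cell A s)) (gen (cell A′ s′))
      swapped : ∀ {A A′ m} {s : Vec _ m} {s′} → AdjacentTransposition (Vec.map (W A) s) (Vec.map (W A′) s′) →
                CellOrientation (gen (cell A s)) (⊖ gen (cell A′ s′))

    M : Module R (r ⊔ v ⊔ p) (r ⊔ ℓ ⊔ v ⊔ p)
    M = Presented.presentedModule R Cell CellOrientation

    open ModuleLemmas M

    cellIn : (A : Ambient) → ∀ {m} → Vec (Fin (size A)) m → Term
    cellIn A s = gen (cell A s)

    cell-same : ∀ A A′ {m} → Boundary.RespectsSame M (W A) (W A′) {m} (cellIn A) (cellIn A′)
    cell-same A A′ s s′ p = Presented.relation (same p)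

    cell-swap : ∀ A A′ {m} → Boundary.RespectsSwap M (W A) (W A′) {m} (cellIn A) (cellIn A′)
    cell-swap A A′ s s′ p = Presented.relation (swapped p)

    module _ {t ℓt} (T : Module R t ℓt) (f : (A : Ambient) → ∀ {m} → Vec (Fin (size A)) m → Module.Carrierᴹ T) where

      evalᴹ : Term → Module.Carrierᴹ T
      evalᴹ = Evaluation.eval T (λ c → f (Cell.ambient c) (Cell.tuple c))

      evalᴹ-linear : (∀ A A′ {m} → Boundary.RespectsSame T (W A) (W A′) {m} (f A) (f A′)) →
                     (∀ A A′ {m} → Boundary.RespectsSwap T (W A) (W A′) {m} (f A) (f A′)) →
                     IsLinear M T evalᴹ
      evalᴹ-linear f-same f-swap = Evaluation.eval-linear T _ λ where
        (same p)    → f-same _ _ _ _ p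
        (swapped p) → f-swap _ _ _ _ p

    faces : (A : Ambient) → ∀ {m} → Vec (Fin (size A)) m → Term
    -- The complex ends at the empty cell; `M` contains all arities at once, so its boundary must be
    -- defined there too.
    faces A {zero}  s = 𝟎
    faces A {suc m} s = Boundary.bd M (cellIn A) s

    faces-same : ∀ A A′ {m} → Boundary.RespectsSame M (W A) (W A′) {m} (faces A) (faces A′)
    faces-same A A′ {zero}  s s′ p = ≈ᴹ-refl
    faces-same A A′ {suc m} s s′ p = Boundary.bd-same M (W A) (W A′) (cell-same A A′) s s′ p

    faces-swap : ∀ A A′ {m} → Boundary.RespectsSwap M (W A) (W A′) {m} (faces A) (faces A′)
    faces-swap A A′ {zero}  [] [] ()
    faces-swap A A′ {suc m} s s′ p = Boundary.bd-swap M (W A) (W A′) (cell-same A A′) (cell-swap A A′) s s′ p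

    ∂ᴹ : Term → Term
    ∂ᴹ = evalᴹ M faces

    ∂ᴹ-linear : IsLinear M M ∂ᴹ
    ∂ᴹ-linear = evalᴹ-linear M faces faces-same faces-swap

    module _ {q} (K : SimplicialComplex V q) where

      data Lift {m} : Term → Chain R K m → Set (r ⊔ v ⊔ p ⊔ q) where
        gen : ∀ {A s t} → Vec.map (W A) s ≡ vertices t → Lift (gen (cell A s)) (gen t)
        𝟎   : Lift 𝟎 𝟎
        _⊕_ : ∀ {x x′ y y′} → Lift x′ x → Lift y′ y → Lift (x′ ⊕ y′) (x ⊕ y)
        ⊖_  : ∀ {x x′} → Lift x′ x → Lift (⊖ x′) (⊖ x)
        _·_ : ∀ k {x x′} → Lift x′ x → Lift (k · x′) (k · x)

      Lift-unique : ∀ {m} {x : Chain R K m} {x′ x″} → Lift x′ x → Lift x″ x → x′ ≈ᴹ x″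
      Lift-unique (gen p)   (gen q)   = Presented.relation (same (trans p (sym q)))
      Lift-unique 𝟎         𝟎         = ≈ᴹ-refl
      Lift-unique (p ⊕ p′)  (q ⊕ q′)  = +ᴹ-cong (Lift-unique p q) (Lift-unique p′ q′)
      Lift-unique (⊖ p)     (⊖ q)     = -ᴹ‿cong (Lift-unique p q)
      Lift-unique (k · p)   (.k · q)  = *ₗ-congˡ (Lift-unique p q)

      Lift-lc : ∀ {m d} k {x : Fin d → Chain R K m} {x′} → (∀ i → Lift (x′ i) (x i)) →
                Lift (linearCombination M k x′) (linearCombination (chains R K m) k x)
      Lift-lc {d = zero}  k h = 𝟎
      Lift-lc {d = suc d} k h = (k zero · h zero) ⊕ Lift-lc (k ∘ suc) (h ∘ suc)

      Lift-∂ : ∀ {m} {x : Chain R K (suc m)} {x′} → Lift x′ x → Lift (∂ᴹ x′) (∂ R K x)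
      Lift-∂ (gen {A} {s} {t} p) = subst (λ z → Lift z (∂ R K (gen t))) (sym (Boundary.bd-unfold M (cellIn A) s))
        (Lift-lc (Boundary.sign M) (λ i → gen {A = A} {removeAt s i} {deleteVertex t i} (trans (Boundary.map-removeAt M (W A) s i) (cong (λ u → removeAt u i) p))))
      Lift-∂ 𝟎       = 𝟎
      Lift-∂ (p ⊕ q) = Lift-∂ p ⊕ Lift-∂ q
      Lift-∂ (⊖ p)   = ⊖ Lift-∂ p
      Lift-∂ (k · p) = k · Lift-∂ p

      module _ (K⊆⋃ : ∀ {s} → Simplex K s → ∃ λ i → Simplex (Γ i) s) where

        -- The vertices of the simplex itself serve as the ambient family: a member of Γ that
        -- contains the simplex covers all tuples of its vertices.
        ¬¬-ambient : ∀ {m} (t : OrderedFace K m) → ¬ ¬ (∃ λ (A : Ambient) → ∃ λ (s : Vec (Fin (size A)) m) → Vec.map (W A) s ≡ vertices t)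
        ¬¬-ambient {m} (orderedFace t t! t∈K) = ¬¬-Fin (λ i → ¬¬-decide (Γ i) (lookup t)) >>= λ dec → pure
          (record { W = lookup t ; covered = cov t t∈K ; member? = dec } , Vec.allFin _ , map-lookup-allFin t)
          where
          cov : ∀ {m} (t : Vec V m) → Face K (toList t) → ∀ {k} (s : Vec (Fin m) (suc k)) →
                ∃ λ i → Simplex (Γ i) (toList (Vec.map (lookup t) s))
          cov (x ∷ t) t∈K s@(_ ∷ _) with K⊆⋃ t∈K
          ... | i , t∈Γᵢ = i , down-closed (Γ i) t∈Γᵢ (lookup-⊆ (x ∷ t) s) λ ()
          cov [] t∈K (() ∷ _)

        ¬¬-Lift : ∀ {m} (x : Chain R K m) → ¬ ¬ (∃ λ x′ → Lift x′ x)
        ¬¬-Lift (gen t) = ¬¬-ambient t >>= λ (A , s , p) → pure (_ , gen {A = A} p)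
        ¬¬-Lift 𝟎       = pure (_ , 𝟎)
        ¬¬-Lift (x ⊕ y) = ¬¬-Lift x >>= λ (_ , p) → ¬¬-Lift y >>= λ (_ , q) → pure (_ , p ⊕ q)
        ¬¬-Lift (⊖ x)   = ¬¬-Lift x >>= λ (_ , p) → pure (_ , ⊖ p)
        ¬¬-Lift (k · x) = ¬¬-Lift x >>= λ (_ , p) → pure (_ , k · p)

        record LiftsAgree {m} (x y : Chain R K m) : Set (r ⊔ ℓ ⊔ v ⊔ p ⊔ q) where
          constructor liftsAgree
          field
            agree : ∀ {x′ y′} → Lift x′ x → Lift y′ y → x′ ≈ᴹ y′

        open LiftsAgree public

        -- Lifts follow the syntax of a chain, so a derivation of equality can be replayed in `M`.
        -- Transitivity needs a lift of the middle chain, whence the double negation.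
        ¬¬-Lift-≈ : ∀ {m} {x y : Chain R K m} → Presented._≈_ R _ (Orientation R K m) x y → ¬ ¬ LiftsAgree x y
        ¬¬-Lift-≈ (Presented.relation (same p)) = pure (liftsAgree λ where
          (gen q) (gen q′) → Presented.relation (same (trans q (trans p (sym q′)))))
        ¬¬-Lift-≈ (Presented.relation (swapped p)) = pure (liftsAgree λ where
          (gen q) (⊖ gen q′) → Presented.relation (swapped (subst₂ AdjacentTransposition (sym q) (sym q′) p)))
        ¬¬-Lift-≈ Presented.≈-refl = pure (liftsAgree Lift-unique)
        ¬¬-Lift-≈ (Presented.≈-sym p) = ¬¬-Lift-≈ p >>= λ h → pure (liftsAgree λ x y → ≈ᴹ-sym (agree h y x))
        ¬¬-Lift-≈ (Presented.≈-trans {y = y} p q) =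
          ¬¬-Lift-≈ p >>= λ h → ¬¬-Lift-≈ q >>= λ h′ → ¬¬-Lift y >>= λ (_ , y) → pure (liftsAgree λ x z → ≈ᴹ-trans (agree h x y) (agree h′ y z))
        ¬¬-Lift-≈ (Presented.⊕-cong p q) = ¬¬-Lift-≈ p >>= λ h → ¬¬-Lift-≈ q >>= λ h′ → pure (liftsAgree λ where
          (x ⊕ y) (x′ ⊕ y′) → +ᴹ-cong (agree h x x′) (agree h′ y y′))
        ¬¬-Lift-≈ (Presented.⊕-assoc _ _ _) = pure (liftsAgree λ where
          ((x ⊕ y) ⊕ z) (x′ ⊕ (y′ ⊕ z′)) → ≈ᴹ-trans (+ᴹ-assoc _ _ _)
            (+ᴹ-cong (Lift-unique x x′) (+ᴹ-cong (Lift-unique y y′) (Lift-unique z z′))))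
        ¬¬-Lift-≈ (Presented.⊕-comm _ _) = pure (liftsAgree λ where
          (x ⊕ y) (y′ ⊕ x′) → ≈ᴹ-trans (+ᴹ-comm _ _) (+ᴹ-cong (Lift-unique y y′) (Lift-unique x x′)))
        ¬¬-Lift-≈ (Presented.⊕-identity _) = pure (liftsAgree λ where
          (𝟎 ⊕ x) x′ → ≈ᴹ-trans (+ᴹ-identityˡ _) (Lift-unique x x′))
        ¬¬-Lift-≈ (Presented.⊖-cong p) = ¬¬-Lift-≈ p >>= λ h → pure (liftsAgree λ where
          (⊖ x) (⊖ x′) → -ᴹ‿cong (agree h x x′))
        ¬¬-Lift-≈ (Presented.⊖-inverse _) = pure (liftsAgree λ where
          ((⊖ x) ⊕ x′) 𝟎 → ≈ᴹ-trans (+ᴹ-congˡ (Lift-unique x′ x)) (-ᴹ‿inverseˡ _))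
        ¬¬-Lift-≈ (Presented.·-cong a p) = ¬¬-Lift-≈ p >>= λ h → pure (liftsAgree λ where
          (_ · x) (_ · x′) → *ₗ-cong a (agree h x x′))
        ¬¬-Lift-≈ (Presented.·-identity _) = pure (liftsAgree λ where
          (_ · x) x′ → ≈ᴹ-trans (*ₗ-identityˡ _) (Lift-unique x x′))
        ¬¬-Lift-≈ (Presented.·-assoc _ _ _) = pure (liftsAgree λ where
          (_ · x) (_ · (_ · x′)) → ≈ᴹ-trans (*ₗ-assoc _ _ _) (*ₗ-congˡ (*ₗ-congˡ (Lift-unique x x′))))
        ¬¬-Lift-≈ (Presented.·-distribˡ _ _ _) = pure (liftsAgree λ where
          (_ · (x ⊕ y)) ((_ · x′) ⊕ (_ · y′)) → ≈ᴹ-trans (*ₗ-distribˡ _ _ _)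
            (+ᴹ-cong (*ₗ-congˡ (Lift-unique x x′)) (*ₗ-congˡ (Lift-unique y y′))))
        ¬¬-Lift-≈ (Presented.·-distribʳ _ _ _) = pure (liftsAgree λ where
          (_ · x) ((_ · x′) ⊕ (_ · x″)) → ≈ᴹ-trans (*ₗ-distribʳ _ _ _)
            (+ᴹ-cong (*ₗ-congˡ (Lift-unique x x′)) (*ₗ-congˡ (Lift-unique x x″))))
        ¬¬-Lift-≈ (Presented.·-zeroˡ _) = pure (liftsAgree λ where
          (_ · x) 𝟎 → *ₗ-zeroˡ _)
        ¬¬-Lift-≈ (Presented.·-zeroʳ _) = pure (liftsAgree λ where
          (_ · 𝟎) 𝟎 → *ₗ-zeroʳ _)

  open Cells

  module M = ModuleLemmas M
  module S = Scalars R
  module SΛ = ModuleLemmas (S.Λ n)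
  module X = Exterior M
  module XΛ = ModuleLemmas (X.Λ n)
  module D = X.Differential ∂ᴹ-linear

  private
    -1# : R.Carrier
    -1# = R.- R.1#

  -- Operators made by choosing apexes: the map ψ, the contraction h and the retraction ρ.

  module _ (A A′ : Ambient) {m} {s : Vec (Fin (size A)) m} {s′ : Vec (Fin (size A′)) m} where

    Γ-same : Vec.map (W A) s ≡ Vec.map (W A′) s′ →
             ∀ i → Simplex (Γ i) (toList (Vec.map (W A) s)) → Simplex (Γ i) (toList (Vec.map (W A′) s′))
    Γ-same p i = subst (λ t → Simplex (Γ i) (toList t)) p

    Γ-swap : AdjacentTransposition (Vec.map (W A) s) (Vec.map (W A′) s′) →
             ∀ i → Simplex (Γ i) (toList (Vec.map (W A) s)) → Simplex (Γ i) (toList (Vec.map (W A′) s′))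
    Γ-swap p i s∈ = Simplex-⊆⊇ (Γ i) s∈ (transposition-⊆ p) (transposition-⊆ (transposition-sym p))

  apex : (A : Ambient) → Fin n → List (Fin n) → ∀ {m} → Vec (Fin (size A)) m → Fin n
  apex A j σ s = choose (λ i → member? A i s) j σ

  private
    ≡⇒e≈ : ∀ {t ℓt} (T : Module R t ℓt) {i j : Fin n} → i ≡ j → ∀ x → Module._≈ᴹ_ (Exterior.Λ T n) (Exterior.e T i x) (Exterior.e T j x)
    ≡⇒e≈ T refl x = Module.≈ᴹ-refl (Exterior.Λ T n)

  -- ψ is the chain map to the nerve that is induced by choosing, for each simplex of X, a member
  -- of Γ that contains it (up to a subdivision, which coning makes implicit).
  module _ (A : Ambient) where

    coverApex : ∀ {m} → Vec (Fin (size A)) (suc m) → Fin n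
    coverApex s = apex A (proj₁ (covered A s)) (List.allFin n) s

    ψ-E : ∀ {m} → Vec (Fin (size A)) (suc m) → S.∣Λ∣ n → S.∣Λ∣ n
    ψ-E s = S.e (coverApex s)

    ψ-on : ∀ {m} → Vec (Fin (size A)) m → S.∣Λ∣ n
    -- With g = 0 and ε = 1 the cone equation reads dψ = ψ∂. The base value sends the empty simplex
    -- to the unit, so ψ respects augmentations.
    ψ-on {m} = Cone.cone (S.Λ n) R.1# ψ-E (S.inj R.1#) (λ _ → SΛ.0ᴹ) m

  ψ-same : ∀ A A′ {m} → Boundary.RespectsSame (S.Λ n) (W A) (W A′) {m} (ψ-on A) (ψ-on A′)
  ψ-swap : ∀ A A′ {m} → Boundary.RespectsSwap (S.Λ n) (W A) (W A′) {m} (ψ-on A) (ψ-on A′)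

  private
    module ψ-Invariance (A A′ : Ambient) where
      apex-eq : ∀ {m} (s : Vec (Fin (size A)) (suc m)) (s′ : Vec (Fin (size A′)) (suc m)) →
                (∀ i → Simplex (Γ i) (toList (Vec.map (W A) s)) → Simplex (Γ i) (toList (Vec.map (W A′) s′))) →
                (∀ i → Simplex (Γ i) (toList (Vec.map (W A′) s′)) → Simplex (Γ i) (toList (Vec.map (W A) s))) →
                -- Since `List.allFin n` contains a suitable index, the search never returns its
                -- default, which may differ between the two ambients.
                coverApex A s ≡ coverApex A′ s′
      apex-eq s s′ f g = choose-cong _ _ f g _ _ _ (inj₂ (proj₁ (covered A s) , ∈-allFin _ , proj₂ (covered A s)))

  ψ-same A A′ = Cone.cone-same (S.Λ n) R.1# (W A) (W A′) (ψ-E A) (ψ-E A′) _ _ _ _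
    (λ s s′ q → ≡⇒e≈ S.unit (apex-eq s s′ (Γ-same A A′ q) (Γ-same A′ A (sym q))))
    (λ s s′ q → ≡⇒e≈ S.unit (apex-eq s s′ (Γ-swap A A′ q) (Γ-swap A′ A (transposition-sym q))))
    SΛ.≈ᴹ-refl (λ _ _ _ → SΛ.≈ᴹ-refl) (λ _ _ _ → SΛ.≈ᴹ-sym SΛ.-ᴹ0≈0) (λ s → S.e-linear (coverApex A′ s))
    where open ψ-Invariance A A′

  ψ-swap A A′ = Cone.cone-swap (S.Λ n) R.1# (W A) (W A′) (ψ-E A) (ψ-E A′) _ _ _ _
    (λ s s′ q → ≡⇒e≈ S.unit (apex-eq s s′ (Γ-same A A′ q) (Γ-same A′ A (sym q))))
    (λ s s′ q → ≡⇒e≈ S.unit (apex-eq s s′ (Γ-swap A A′ q) (Γ-swap A′ A (transposition-sym q))))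
    SΛ.≈ᴹ-refl (λ _ _ _ → SΛ.≈ᴹ-refl) (λ _ _ _ → SΛ.≈ᴹ-sym SΛ.-ᴹ0≈0) (λ s → S.e-linear (coverApex A′ s))
    where open ψ-Invariance A A′

  ψ : M.Carrierᴹ → S.∣Λ∣ n
  ψ = evalᴹ (S.Λ n) ψ-on

  ψ-linear : IsLinear M (S.Λ n) ψ
  ψ-linear = evalᴹ-linear (S.Λ n) ψ-on ψ-same ψ-swap

  ψ-∂ : ∀ x → S.d (ψ x) SΛ.≈ᴹ ψ (∂ᴹ x)
  ψ-∂ = agree-on-gens (S.Λ n) (∘-linear M (S.Λ n) (S.Λ n) S.d-linear ψ-linear)
    (∘-linear M M (S.Λ n) ψ-linear ∂ᴹ-linear) λ where
      (cell A {zero}  []) → S.d-1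
      (cell A {suc m} s)  → SΛ.≈ᴹ-trans
        (Cone.∂-cone-suc (S.Λ n) R.1# (ψ-E A) (S.inj R.1#) (λ _ → SΛ.0ᴹ) S.d-linear (λ s → S.e-linear (coverApex A s))
          (λ s → S.d-e (coverApex A s)) S.d-1
          (λ s → SΛ.≈ᴹ-trans S.d.0-homo (SΛ.≈ᴹ-sym (SΛ.≈ᴹ-trans
            (SΛ.-ᴹ‿cong (SΛ.≈ᴹ-trans (SΛ.*ₗ-identityˡ _) (IsLinear.0-homo (Boundary.bd-linear (S.Λ n) s)))) SΛ.-ᴹ0≈0)))
          s)
        (SΛ.≈ᴹ-trans (SΛ.+ᴹ-identityˡ _) (SΛ.≈ᴹ-trans (SΛ.*ₗ-identityˡ _)
          (SΛ.≈ᴹ-sym (bd-homo M (S.Λ n) ψ-linear (cellIn A) s))))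

  -- h contracts the join of ⋃[ σ ] Γ with the simplex on σ.  On a simplex outside ⋃[ σ ] Γ the apex
  -- is the arbitrary default j.
  module Contraction (j : Fin n) (σ : List (Fin n)) where

    g : (A : Ambient) → ∀ {m} → Vec (Fin (size A)) m → X.∣Λ∣ n
    g A s = X.inj (cellIn A s)

    E : (A : Ambient) → ∀ {m} → Vec (Fin (size A)) (suc m) → X.∣Λ∣ n → X.∣Λ∣ n
    E A s = X.e (apex A j σ s)

    H-on : (A : Ambient) → ∀ {m} → Vec (Fin (size A)) m → X.∣Λ∣ n
    -- With g = `inj` and ε = -1 the cone equation reads dH = `inj` - H∂. The empty simplex goes to
    -- the vertex j, whose boundary is the empty simplex.
    H-on A {m} = Cone.cone (X.Λ n) -1# (E A) (X.e j (g A [])) (g A) m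

    private
      module Invariance (A A′ : Ambient) where
        apex-eq : ∀ {m} (s : Vec (Fin (size A)) m) (s′ : Vec (Fin (size A′)) m) →
                  (∀ i → Simplex (Γ i) (toList (Vec.map (W A) s)) → Simplex (Γ i) (toList (Vec.map (W A′) s′))) →
                  (∀ i → Simplex (Γ i) (toList (Vec.map (W A′) s′)) → Simplex (Γ i) (toList (Vec.map (W A) s))) →
                  apex A j σ s ≡ apex A′ j σ s′
        apex-eq s s′ f g = choose-cong (λ i → member? A i s) (λ i → member? A′ i s′) f g j j σ (inj₁ refl)

        g-same : ∀ {m} → Boundary.RespectsSame (X.Λ n) (W A) (W A′) {m} (g A) (g A′)
        g-same s s′ q = IsLinear.≈-cong X.inj-linear (cell-same A A′ s s′ q)

        g-swap : ∀ {m} → Boundary.RespectsSwap (X.Λ n) (W A) (W A′) {m} (g A) (g A′)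
        g-swap s s′ q = XΛ.≈ᴹ-trans (IsLinear.≈-cong X.inj-linear (cell-swap A A′ s s′ q)) (IsLinear.neg-homo X.inj-linear _)

    H-same : ∀ A A′ {m} → Boundary.RespectsSame (X.Λ n) (W A) (W A′) {m} (H-on A) (H-on A′)
    H-same A A′ = Cone.cone-same (X.Λ n) -1# (W A) (W A′) (E A) (E A′) _ _ (g A) (g A′)
      (λ s s′ q → ≡⇒e≈ M (apex-eq s s′ (Γ-same A A′ q) (Γ-same A′ A (sym q))))
      (λ s s′ q → ≡⇒e≈ M (apex-eq s s′ (Γ-swap A A′ q) (Γ-swap A′ A (transposition-sym q))))
      (X.e.≈-cong j (g-same [] [] refl)) g-same g-swap (λ s → X.e-linear (apex A′ j σ s))
      where open Invariance A A′

    H-swap : ∀ A A′ {m} → Boundary.RespectsSwap (X.Λ n) (W A) (W A′) {m} (H-on A) (H-on A′)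
    H-swap A A′ = Cone.cone-swap (X.Λ n) -1# (W A) (W A′) (E A) (E A′) _ _ (g A) (g A′)
      (λ s s′ q → ≡⇒e≈ M (apex-eq s s′ (Γ-same A A′ q) (Γ-same A′ A (sym q))))
      (λ s s′ q → ≡⇒e≈ M (apex-eq s s′ (Γ-swap A A′ q) (Γ-swap A′ A (transposition-sym q))))
      (X.e.≈-cong j (g-same [] [] refl)) g-same g-swap (λ s → X.e-linear (apex A′ j σ s))
      where open Invariance A A′

    H : M.Carrierᴹ → X.∣Λ∣ n
    H = evalᴹ (X.Λ n) H-on

    H-linear : IsLinear M (X.Λ n) H
    H-linear = evalᴹ-linear (X.Λ n) H-on H-same H-swap

    d-base : ∀ A → D.d (X.e j (g A [])) XΛ.≈ᴹ g A []
    d-base A = begin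
      D.d (X.e j (g A []))                                          ≈⟨ x≈y+z⇒x-z≈y (≈ᴹ-sym (D.d-e j (g A []))) ⟨
      g A [] +ᴹ -ᴹ X.e j (D.d (g A []))                             ≈⟨ +ᴹ-congˡ (-ᴹ‿cong (X.e.≈-cong j (≈ᴹ-trans (D.d-inj _) (IsLinear.0-homo X.inj-linear)))) ⟩
      g A [] +ᴹ -ᴹ X.e j 0ᴹ                                         ≈⟨ +ᴹ-congˡ (≈ᴹ-trans (-ᴹ‿cong (X.e.0-homo j)) -ᴹ0≈0) ⟩
      g A [] +ᴹ 0ᴹ                                                  ≈⟨ +ᴹ-identityʳ _ ⟩
      g A []                                                        ∎
      where open XΛ

    d-g : ∀ A {m} (s : Vec (Fin (size A)) (suc m)) →
          D.d (g A s) XΛ.≈ᴹ XΛ.-ᴹ (-1# XΛ.*ₗ Boundary.bd (X.Λ n) (g A) s)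
    d-g A s = begin
      D.d (g A s)                                        ≈⟨ D.d-inj _ ⟩
      X.inj (Boundary.bd M (cellIn A) s)                 ≈⟨ bd-homo M (X.Λ n) X.inj-linear (cellIn A) s ⟩
      Boundary.bd (X.Λ n) (g A) s                        ≈⟨ -ᴹ-involutive _ ⟨
      -ᴹ (-ᴹ Boundary.bd (X.Λ n) (g A) s)                ≈⟨ -ᴹ‿cong (-ᴹ≈-1*ₗ _) ⟩
      -ᴹ (-1# *ₗ Boundary.bd (X.Λ n) (g A) s)            ∎
      where open XΛ

    d-H : ∀ x → D.d (H x) XΛ.≈ᴹ X.inj x XΛ.+ᴹ -1# XΛ.*ₗ H (∂ᴹ x)
    d-H = agree-on-gens (X.Λ n) (∘-linear M (X.Λ n) (X.Λ n) D.d-linear H-linear)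
      (+-linear M (X.Λ n) X.inj-linear (*-linear M (X.Λ n) -1# (∘-linear M M (X.Λ n) H-linear ∂ᴹ-linear))) λ where
        (cell A {zero}  []) → XΛ.≈ᴹ-trans (d-base A) (XΛ.≈ᴹ-sym (XΛ.≈ᴹ-trans (XΛ.+ᴹ-congˡ (XΛ.*ₗ-zeroʳ _)) (XΛ.+ᴹ-identityʳ _)))
        (cell A {suc m} s)  → XΛ.≈ᴹ-trans
          (Cone.∂-cone-suc (X.Λ n) -1# (E A) (X.e j (g A [])) (g A) D.d-linear (λ s → X.e-linear (apex A j σ s))
            (λ s → D.d-e (apex A j σ s)) (d-base A) (d-g A) s)
          (XΛ.+ᴹ-congˡ (XΛ.*ₗ-congˡ (XΛ.≈ᴹ-sym (bd-homo M (X.Λ n) H-linear (cellIn A) s))))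

    h : X.∣Λ∣ n → X.∣Λ∣ n
    h = Extension.ext M (X.Λ n) -1# H X.e

    h-linear : IsLinear (X.Λ n) (X.Λ n) h
    h-linear = Extension.ext-linear M (X.Λ n) -1# H H-linear X.e X.e-linear

    -- This holds on the whole algebra for every j and σ; the choice of apexes matters only for
    -- staying inside K, in `h-∈`.
    d-h : ∀ f → D.d (h f) XΛ.≈ᴹ f XΛ.+ᴹ XΛ.-ᴹ h (D.d f)
    d-h f = XΛ.≈ᴹ-trans
      (ExtensionBoundary.ext-d M (X.Λ n) -1# R.1# (R.sym (RingProperties.-‿involutive R.ring R.1#)) H-linear ∂ᴹ-linear D.d-linear d-H
        X.e X.e-linear D.d-e f)
      (XΛ.+ᴹ-cong (ext-inj-e M R.refl f) (XΛ.≈ᴹ-sym (XΛ.-ᴹ≈-1*ₗ _)))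

  ρ : X.∣Λ∣ n → S.∣Λ∣ n
  ρ = Extension.ext M (S.Λ n) R.1# ψ S.e

  ρ-linear : IsLinear (X.Λ n) (S.Λ n) ρ
  ρ-linear = Extension.ext-linear M (S.Λ n) R.1# ψ ψ-linear S.e S.e-linear

  ρ-inj : ∀ x → ρ (X.inj x) SΛ.≈ᴹ ψ x
  ρ-inj = Extension.ext-inj M (S.Λ n) R.1# ψ ψ-linear S.e S.e-linear

  d-ρ : ∀ f → S.d (ρ f) SΛ.≈ᴹ ρ (D.d f)
  d-ρ f = SΛ.≈ᴹ-trans
    (ExtensionBoundary.ext-d M (S.Λ n) R.1# -1# R.refl ψ-linear ∂ᴹ-linear S.d-linear
      (λ x → SΛ.≈ᴹ-trans (ψ-∂ x) (SΛ.≈ᴹ-sym (SΛ.≈ᴹ-trans (SΛ.+ᴹ-identityˡ _) (SΛ.*ₗ-identityˡ _))))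
      S.e S.e-linear S.d-e f)
    (SΛ.≈ᴹ-trans (SΛ.+ᴹ-cong (ext-0 S.e S.e-linear f) (SΛ.*ₗ-identityˡ _)) (SΛ.+ᴹ-identityˡ _))
    where
    ext-0 : ∀ {k} (E : Fin k → S.∣Λ∣ n → S.∣Λ∣ n) → (∀ i → IsLinear (S.Λ n) (S.Λ n) (E i)) →
            ∀ f → Extension.ext M (S.Λ n) -1# (λ _ → SΛ.0ᴹ) E f SΛ.≈ᴹ SΛ.0ᴹ
    ext-0 {zero}  E E-linear f = SΛ.≈ᴹ-refl
    ext-0 {suc k} E E-linear f = SΛ.≈ᴹ-trans
      (SΛ.+ᴹ-cong (ext-0 (E ∘ suc) (E-linear ∘ suc) _) (SΛ.≈ᴹ-trans
        (SΛ.*ₗ-congˡ (SΛ.≈ᴹ-trans (IsLinear.≈-cong (E-linear zero) (ext-0 (E ∘ suc) (E-linear ∘ suc) _)) (IsLinear.0-homo (E-linear zero))))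
        (SΛ.*ₗ-zeroʳ _)))
      (SΛ.+ᴹ-identityˡ _)

  -- Carriers: the joins that can occur in the values of these operators.

  module _ {q} (P : List (Fin n) → ∀ {m} → Vec V m → Set q) where

    data Supported : X.∣Λ∣ n → Set (r ⊔ v ⊔ p ⊔ q) where
      supported : ∀ A {m} (s : Vec _ m) τ → P τ (Vec.map (W A) s) → Supported (X.word τ (X.inj (cellIn A s)))

  infix 4 _∈K_

  InJoin : List (Fin n) → ℕ → List (Fin n) → ∀ {m} → Vec V m → Set _
  InJoin σ k τ {m} t =
    length τ + m ≡ k × τ ⊆ σ × Face (⋃[ σ ] Γ) (toList t) × (∀ i → i ∈ τ → Face (Γ i) (toList t))

  -- The join of the simplex on σ with ⋃[ σ ] Γ, restricted to the pairs (τ , t) with t in every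
  -- member of τ; k is the number of vertices.
  _∈K_ : List (Fin n) × ℕ → X.∣Λ∣ n → Set _
  (σ , k) ∈K x = Span (X.Λ n) (Supported (InJoin σ k)) x

  Face-⋃-mono : ∀ {σ σ′ m} (t : Vec V m) → σ ⊆ σ′ → Face (⋃[ σ ] Γ) (toList t) → Face (⋃[ σ′ ] Γ) (toList t)
  Face-⋃-mono []      σ⊆ _               = _
  Face-⋃-mono (_ ∷ _) σ⊆ ((i , i∈) , t∈) = (i , σ⊆ i∈) , t∈

  K-mono : ∀ {σ σ′ k x} → σ ⊆ σ′ → (σ , k) ∈K x → (σ′ , k) ∈K x
  K-mono {σ} {σ′} {k} σ⊆ = Span-⊆ (X.Λ n) {P = Supported (InJoin σ k)} {Q = Supported (InJoin σ′ k)} λ where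
    (supported A s τ (l , τ⊆ , s∈ , s∈τ)) → supported A s τ (l , ⊆-trans τ⊆ σ⊆ , Face-⋃-mono (Vec.map (W A) s) σ⊆ s∈ , s∈τ)

  map-removeAt-⊆ : (A : Ambient) → ∀ {m} (s : Vec (Fin (size A)) (suc m)) i →
                   toList (Vec.map (W A) (removeAt s i)) ⊆ toList (Vec.map (W A) s)
  map-removeAt-⊆ A s i rewrite Boundary.map-removeAt M (W A) s i = removeAt-⊆ (Vec.map (W A) s) i

  module _ (j : Fin n) (σ : List (Fin n)) (j∈σ : j ∈ σ) where

    open Contraction j σ

    Below : ∀ {m} → Vec V m → List (Fin n) → ∀ {k} → Vec V k → Set _
    Below {m} u τ {k} t = length τ + k ≡ suc m × τ ⊆ σ × toList t ⊆ toList u × (∀ i → i ∈ τ → Face (Γ i) (toList t))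

    -- The apex contains the whole simplex, hence every face to which it is joined. `Below` confines
    -- the values to faces of the given simplex, which is stronger than lying in the union over σ
    -- and lets `h-∈` put a word τ in front.
    H-∈ : ∀ A {m} (s : Vec (Fin (size A)) m) → Face (⋃[ σ ] Γ) (toList (Vec.map (W A) s)) →
          Span (X.Λ n) (Supported (Below (Vec.map (W A) s))) (H-on A s)
    H-∈ A []        s∈ = base (supported A [] (j ∷ []) (refl , ∈-∷⁺ʳ j∈σ (λ ()) , ⊆-refl , λ _ _ → _))
    H-∈ A {suc m} s@(_ ∷ _) s∈@((i , i∈σ) , s∈Γᵢ) = Span-map (X.Λ n) (X.Λ n) {P = Supported Smaller} {Q = Supported (Below (Vec.map (W A) s))} (X.e-linear a) (λ where
        (supported A′ t τ (l , τ⊆ , t⊆ , t∈)) → base (supported A′ t (a ∷ τ)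
          ( cong suc l , ∈-∷⁺ʳ a∈σ τ⊆ , t⊆
          , λ { i (here refl) → Face-down-closed (Γ i) a-face t⊆ ; i (there i∈) → t∈ i i∈ })))
      (+-∈ (base (supported A s [] (refl , (λ ()) , ⊆-refl , λ _ ())))
        (*-∈ _ (Boundary.bd-∈ (X.Λ n) {f = H-on A} {s} λ i → Span-⊆ (X.Λ n) {P = Supported (Below (Vec.map (W A) (removeAt s i)))} {Q = Supported Smaller} (λ where
            (supported A′ t τ (l , τ⊆ , t⊆ , t∈)) → supported A′ t τ
              (l , τ⊆ , ⊆-trans t⊆ (map-removeAt-⊆ A s i) , t∈))
          (H-∈ A (removeAt s i) (Face-down-closed (⋃[ σ ] Γ) s∈ (map-removeAt-⊆ A s i))))))
      where
      Smaller : List (Fin n) → ∀ {k} → Vec V k → Set _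
      Smaller τ {k} t = length τ + k ≡ suc m × τ ⊆ σ × toList t ⊆ toList (Vec.map (W A) s) ×
        (∀ i → i ∈ τ → Face (Γ i) (toList t))
      a : Fin n
      a = apex A j σ s
      a-face : Simplex (Γ a) (toList (Vec.map (W A) s))
      a-face = choose-holds (λ i → member? A i s) {j = j} σ i∈σ s∈Γᵢ
      a∈σ : a ∈ σ
      a∈σ = choose-∈ (λ i → member? A i s) σ j∈σ ⊆-refl

    -- Up to a scalar, `h` passes the word τ and acts by `H` on the coefficient. The result involves
    -- only faces of that coefficient, and every member of τ still contains them.
    h-∈ : ∀ {k x} → (σ , k) ∈K x → (σ , suc k) ∈K h x
    h-∈ {k} = Span-map (X.Λ n) (X.Λ n) {P = Supported (InJoin σ k)} {Q = Supported (InJoin σ (suc k))} h-linear λ where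
      (supported A {m} s τ (l , τ⊆ , s∈ , s∈τ)) →
        let c , eq = skew-word M M (λ i f → Extension.ext-e M (X.Λ n) _ H H-linear X.e X.e-linear
                       (X.e-square {n}) (X.e-anticomm {n}) i f) τ (X.inj (cellIn A s))
        in resp (XΛ.≈ᴹ-sym (XΛ.≈ᴹ-trans eq (XΛ.*ₗ-congˡ (IsLinear.≈-cong (X.word-linear τ)
             (Extension.ext-inj M (X.Λ n) _ H H-linear X.e X.e-linear _)))))
           (*-∈ c (Span-map (X.Λ n) (X.Λ n) {P = Supported (Below (Vec.map (W A) s))} {Q = Supported (InJoin σ (suc k))} (X.word-linear τ) (λ where
             (supported A′ {m′} t τ′ (l′ , τ′⊆ , t⊆ , t∈)) →
               subst (Span (X.Λ n) _) (X.word-++ τ τ′ _) (base (supported A′ t (τ ++ τ′)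
                 ( length-++-suc τ l l′
                 , (λ i∈ → [ τ⊆ , τ′⊆ ]′ (∈-++⁻ τ i∈))
                 , Face-down-closed (⋃[ σ ] Γ) s∈ t⊆
                 , λ i i∈ → [ (λ i∈τ → Face-down-closed (Γ i) (s∈τ i i∈τ) t⊆) , t∈ i ]′ (∈-++⁻ τ i∈)))))
             (H-∈ A s s∈)))

  module N = NerveChains R (Nerve Γ)

  Face-Nerve : ∀ {x t} τ → (∀ i → i ∈ τ → Simplex (Γ i) (x ∷ t)) → Face (Nerve Γ) τ
  Face-Nerve []      h = _
  Face-Nerve (_ ∷ _) h = (λ ()) , _ , h

  -- The common vertex x witnesses that υ is a simplex of the nerve. As x lies in t, it is also
  -- shared by all members that contain t, so υ can be joined with the τ of any pair in K. The first
  -- disjunct serves the empty t.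
  InStar : ∀ {m} → Vec V m → List (Fin n) → Set _
  InStar {m} t υ = length υ ≡ m × (υ ≡ [] ⊎ ∃ λ x → x ∈ toList t × (∀ i → i ∈ υ → Simplex (Γ i) (x ∷ [])))

  ScalarWord : ∀ {q} → (List (Fin n) → Set q) → S.∣Λ∣ n → Set _
  ScalarWord P x = ∃ λ υ → P υ × x ≡ S.word υ (S.inj R.1#)

  vertex-∈ : ∀ i {x t} → Simplex (Γ i) t → x ∈ t → Simplex (Γ i) (x ∷ [])
  vertex-∈ i t∈ x∈ = down-closed (Γ i) t∈ (λ { (here refl) → x∈ }) λ ()

  ψ-∈ : ∀ A {m} (s : Vec (Fin (size A)) m) → Span (S.Λ n) (ScalarWord (InStar (Vec.map (W A) s))) (ψ-on A s)
  ψ-∈ A []            = base ([] , (refl , inj₁ refl) , refl)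
  ψ-∈ A {suc m} s@(x ∷ s′) = Span-map (S.Λ n) (S.Λ n)
      {P = ScalarWord (λ υ → InStar (Vec.map (W A) s) (a ∷ υ))} {Q = ScalarWord (InStar (Vec.map (W A) s))} (S.e-linear a)
      (λ { (υ , υ∈ , refl) → base (a ∷ υ , υ∈ , refl) })
    (resp (SΛ.≈ᴹ-sym (SΛ.≈ᴹ-trans (SΛ.+ᴹ-identityˡ _) (SΛ.*ₗ-identityˡ _)))
      (Boundary.bd-∈ (S.Λ n) {f = ψ-on A} {s} λ i → Span-⊆ (S.Λ n) {P = ScalarWord (InStar (Vec.map (W A) (removeAt s i)))} {Q = ScalarWord (λ υ → InStar (Vec.map (W A) s) (a ∷ υ))} (λ { (υ , υ∈ , refl) → υ , step i υ υ∈ , refl }) (ψ-∈ A (removeAt s i))))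
    where
    a : Fin n
    a = coverApex A s
    a-face : Simplex (Γ a) (toList (Vec.map (W A) s))
    a-face = choose-holds (λ i → member? A i s) {j = proj₁ (covered A s)} (List.allFin n) (∈-allFin _) (proj₂ (covered A s))
    step : ∀ i υ → InStar (Vec.map (W A) (removeAt s i)) υ → InStar (Vec.map (W A) s) (a ∷ υ)
    -- An empty υ means that s is a single vertex; this vertex becomes the common one and is kept at
    -- all larger simplices.
    step i υ (l , inj₁ refl)           = cong suc l , inj₂ (W A x , here refl , λ { i (here refl) → vertex-∈ a a-face (here refl) })
    step k υ (l , inj₂ (y , y∈ , h)) = cong suc l , inj₂ (y , map-removeAt-⊆ A s k y∈ , λ where
      i (here refl) → vertex-∈ a a-face (map-removeAt-⊆ A s k y∈)
      i (there i∈)  → h i i∈)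

  toWord : ∀ {k x} → ScalarWord (λ υ → length υ ≡ k × Face (Nerve Γ) υ) x → N.Word k x
  toWord (υ , (l , υ∈) , refl) with fromList-length υ l
  ... | s , refl = s , υ∈ , refl

  ρ-∈ : ∀ {σ k x} → Face (Nerve Γ) σ → (σ , k) ∈K x → Span (S.Λ n) (N.Word k) (ρ x)
  ρ-∈ {σ} {k} σ∈ = Span-map (X.Λ n) (S.Λ n) {P = Supported (InJoin σ k)} {Q = N.Word k} ρ-linear λ { (supported A s τ (l , τ⊆ , s∈ , s∈τ)) →
      let c , eq = skew-word M S.unit (Extension.ext-e M (S.Λ n) _ ψ ψ-linear S.e S.e-linear
                     (S.e-square {n}) (S.e-anticomm {n})) τ (X.inj (cellIn A s))
      in resp (SΛ.≈ᴹ-sym (SΛ.≈ᴹ-trans eq (SΛ.*ₗ-congˡ (IsLinear.≈-cong (S.word-linear τ) (ρ-inj (cellIn A s))))))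
         (*-∈ c (Span-map (S.Λ n) (S.Λ n) {P = ScalarWord (InStar (Vec.map (W A) s))} {Q = N.Word k} (S.word-linear τ) (λ where
             (υ , (l′ , υ∈) , refl) → base (toWord (τ ++ υ , (trans (length-++ τ) (trans (cong (λ j → length τ + j) l′) l)
               , joined A s τ υ τ⊆ l′ υ∈ s∈τ) , sym (S.word-++ τ υ _))))
           (ψ-∈ A s))) }
    where
    joined : ∀ A {m} (s : Vec (Fin (size A)) m) τ υ → τ ⊆ σ → length υ ≡ m →
             (υ ≡ [] ⊎ ∃ λ x → x ∈ toList (Vec.map (W A) s) × (∀ i → i ∈ υ → Simplex (Γ i) (x ∷ []))) →
             (∀ i → i ∈ τ → Face (Γ i) (toList (Vec.map (W A) s))) → Face (Nerve Γ) (τ ++ υ)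
    -- An empty coefficient has no vertex to share; here τ is a face because it lies in the face σ.
    joined A [] τ [] τ⊆ l υ∈ s∈τ = Face-down-closed (Nerve Γ) σ∈ (λ i∈ → [ τ⊆ , (λ ()) ]′ (∈-++⁻ τ i∈))
    joined A (x ∷ s) τ υ τ⊆ l (inj₁ refl) s∈τ = Face-Nerve (τ ++ υ)
      λ i i∈ → [ (λ i∈τ → vertex-∈ i (s∈τ i i∈τ) (here refl)) , (λ ()) ]′ (∈-++⁻ τ i∈)
    joined A s@(_ ∷ _) τ υ τ⊆ l (inj₂ (y , y∈ , h)) s∈τ = Face-Nerve (τ ++ υ)
      λ i i∈ → [ (λ i∈τ → vertex-∈ i (s∈τ i i∈τ) y∈) , h i ]′ (∈-++⁻ τ i∈)

  ψ-Lift-∈ : ∀ {q k} {K : SimplicialComplex V q} {x : Chain R K k} {x′} → Lift K x′ x → Span (S.Λ n) (N.Word k) (ψ x′)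
  ψ-Lift-∈ {k = k} (gen {A} {s} _) = Span-⊆ (S.Λ n) {P = ScalarWord (InStar (Vec.map (W A) s))} {Q = N.Word k} (λ where
      (υ , (l , inj₁ refl) , refl)        → toWord (υ , (l , _) , refl)
      (υ , (l , inj₂ (_ , _ , h)) , refl) → toWord (υ , (l , Face-Nerve υ h) , refl))
    (ψ-∈ A s)
  ψ-Lift-∈ 𝟎       = 0-∈
  ψ-Lift-∈ (p ⊕ q) = +-∈ (ψ-Lift-∈ p) (ψ-Lift-∈ q)
  ψ-Lift-∈ (⊖ p)   = neg-∈ (S.Λ n) _ (ψ-Lift-∈ p)
  ψ-Lift-∈ (k · p) = *-∈ k (ψ-Lift-∈ p)

  inj-Lift-∈ : ∀ {σ k} {x : Chain R (⋃[ σ ] Γ) k} {x′} → Lift (⋃[ σ ] Γ) x′ x → (σ , k) ∈K X.inj x′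
  inj-Lift-∈ {σ} (gen {A} {s} {t} p) = base (supported A s []
    (refl , (λ ()) , subst (λ u → Face (⋃[ σ ] Γ) (toList u)) (sym p) (isFace t) , λ _ ()))
  inj-Lift-∈ 𝟎       = resp (XΛ.≈ᴹ-sym (IsLinear.0-homo X.inj-linear)) 0-∈
  inj-Lift-∈ (p ⊕ q) = resp (XΛ.≈ᴹ-sym (IsLinear.+-homo X.inj-linear _ _)) (+-∈ (inj-Lift-∈ p) (inj-Lift-∈ q))
  inj-Lift-∈ (⊖ p)   = resp (XΛ.≈ᴹ-sym (IsLinear.neg-homo X.inj-linear _)) (neg-∈ (X.Λ n) _ (inj-Lift-∈ p))
  inj-Lift-∈ (k · p) = resp (XΛ.≈ᴹ-sym (IsLinear.*-homo X.inj-linear _ _)) (*-∈ k (inj-Lift-∈ p))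

  -- The nerve inside the algebra of joins.

  origin : Ambient
  origin = record { size = 0 ; W = λ () ; covered = λ { (() ∷ _) } ; member? = λ { i [] → no (nonempty (Γ i)) ; i (() ∷ _) } }

  -- The empty simplex as a coefficient: the monomial τ with this coefficient is the copy of τ in
  -- the join.
  ∅ : M.Carrierᴹ
  ∅ = gen (cell origin [])

  κ : R.Carrier → M.Carrierᴹ
  κ a = a · ∅

  κ-linear : IsLinear S.unit M κ
  κ-linear = record
    { ≈-cong = λ p → M.*ₗ-congʳ p ; +-homo = λ a b → M.*ₗ-distribʳ ∅ a b ; *-homo = λ a b → M.*ₗ-assoc a b ∅ }

  ι : S.∣Λ∣ n → X.∣Λ∣ n
  ι f = κ ∘ f

  ι-linear : IsLinear (S.Λ n) (X.Λ n) ι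
  ι-linear = map-linear S.unit M κ-linear n

  d-ι : ∀ f → ι (S.d f) XΛ.≈ᴹ D.d (ι f)
  d-ι f = d-natural S.unit M κ-linear (0-linear S.unit S.unit) ∂ᴹ-linear
    (λ a → M.≈ᴹ-trans (M.*ₗ-zeroˡ ∅) (M.≈ᴹ-sym (M.*ₗ-zeroʳ a))) f

  ι-basis : ∀ S → ι (S.basis S) XΛ.≈ᴹ X.word (members S) (X.inj ∅)
  ι-basis S = XΛ.≈ᴹ-trans (IsLinear.≈-cong ι-linear (S.basis≈word S)) (XΛ.≈ᴹ-trans
    (word-natural S.unit M κ-linear (members S) (S.inj R.1#))
    (IsLinear.≈-cong (X.word-linear (members S)) (λ U → M.≈ᴹ-trans (inj-natural S.unit M κ-linear R.1# U)
      (IsLinear.≈-cong X.inj-linear (M.*ₗ-identityˡ ∅) U))))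

  ρ-word : ∀ τ f → ρ (X.word τ f) SΛ.≈ᴹ S.word τ (ρ f)
  ρ-word []      f = SΛ.≈ᴹ-refl
  ρ-word (i ∷ τ) f = SΛ.≈ᴹ-trans
    (SΛ.≈ᴹ-trans (Extension.ext-e M (S.Λ n) _ ψ ψ-linear S.e S.e-linear (S.e-square {n}) (S.e-anticomm {n}) i _) (SΛ.*ₗ-identityˡ _))
    (S.e.≈-cong i (ρ-word τ f))

  -- ψ sends the empty simplex to the unit, so ρ leaves every monomial of the nerve unchanged.
  ρ-ι : ∀ {s} {P : Vec Bool n → Set s} {a} → Span (S.Λ n) (S.Basis P) a → ρ (ι a) SΛ.≈ᴹ a
  ρ-ι = agree-on-Span (S.Λ n) (S.Λ n) (∘-linear (S.Λ n) (X.Λ n) (S.Λ n) ρ-linear ι-linear) (id-linear (S.Λ n)) λ { (S , _ , refl) → begin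
      ρ (ι (S.basis S))                       ≈⟨ IsLinear.≈-cong ρ-linear (ι-basis S) ⟩
      ρ (X.word (members S) (X.inj ∅))        ≈⟨ ρ-word (members S) (X.inj ∅) ⟩
      S.word (members S) (ρ (X.inj ∅))        ≈⟨ IsLinear.≈-cong (S.word-linear (members S)) (ρ-inj ∅) ⟩
      S.word (members S) (S.inj R.1#)         ≈⟨ S.basis≈word S ⟨
      S.basis S                               ∎ }
    where open SΛ

  contract : List (Fin n) → X.∣Λ∣ n → X.∣Λ∣ n
  -- A default without an apex to cone from; `d-contract` asks for a nonempty list.
  contract []        x = XΛ.0ᴹ
  contract (j ∷ σ) x = Contraction.h j (j ∷ σ) x

  d-contract : ∀ {k} τ → length τ ≡ suc k → ∀ {x} → D.d x XΛ.≈ᴹ XΛ.0ᴹ → D.d (contract τ x) XΛ.≈ᴹ x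
  d-contract (j ∷ σ) _ {x} dx≈0 = begin
    D.d (h x)             ≈⟨ d-h x ⟩
    x +ᴹ -ᴹ h (D.d x)     ≈⟨ +ᴹ-congˡ (-ᴹ‿cong (≈ᴹ-trans (IsLinear.≈-cong h-linear dx≈0) (IsLinear.0-homo h-linear))) ⟩
    x +ᴹ -ᴹ 0ᴹ            ≈⟨ ≈ᴹ-trans (+ᴹ-congˡ -ᴹ0≈0) (+ᴹ-identityʳ x) ⟩
    x                     ∎
    where open XΛ
          open Contraction j (j ∷ σ)

  contract-∈ : ∀ τ {k x} → (τ , k) ∈K x → (τ , suc k) ∈K contract τ x
  contract-∈ []      x∈ = 0-∈
  contract-∈ (j ∷ σ) x∈ = h-∈ j (j ∷ σ) (here refl) x∈

  -- Recursive construction of the fillers.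

  module Fillers (𝒢 : DecidableFaces n) where

    open S
    open DecidableFaces 𝒢

    Y : Vec Bool n → SimplicialComplex V p
    Y S = ⋃[ members S ] Γ

    Y-mono : ∀ {S T} → members T ⊆ members S → Y T ⊆ᶜ Y S
    Y-mono T⊆S s ((i , i∈) , s∈) = (i , T⊆S i∈) , s∈

    Filled : ℕ → Vec Bool n → Set
    Filled k S = length (members S) ≡ k × k ℕ.≤ bound × Good (members S)

    filled? : ∀ k S → Dec (Filled k S)
    filled? k S = (length (members S) ℕ.≟ k) ×-dec ((k ℕ.≤? bound) ×-dec good? (members S))

    Filled-◃ : ∀ {k S T} → Filled (suc k) S → T ◃ S → Filled k T
    Filled-◃ (l , k≤ , g) T◃S = ℕ.suc-injective (trans (◃-length T◃S) l) , ℕ.<⇒≤ k≤ , good-⊆ g (◃-⊆ T◃S)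

    -- All values of φ are brought into one complex L, so that they can be added; masks without an
    -- inclusion get `𝟎`. L is `Y S` while fillers are built and X at the end.
    module Spread {u} (L : SimplicialComplex V u) (inc : ∀ T → Maybe (Y T ⊆ᶜ L)) {k} (φ : ∀ S → Chain R (Y S) k) where
      private module C = ModuleLemmas (chains R L k)

      spread : Vec Bool n → Chain R L k
      spread T with inc T
      ... | just i  = incl {K = Y T} {L} i (φ T)
      ... | nothing = 𝟎

      spread-incl : ∀ {T} → Is-just (inc T) → (i : Y T ⊆ᶜ L) → spread T C.≈ᴹ incl {K = Y T} {L} i (φ T)
      spread-incl {T} h i with inc T
      spread-incl {T} (just _) i | just j = incl-unique {K = Y T} {L} j i (φ T)

    inc-Y : ∀ S T → Maybe (Y T ⊆ᶜ Y S)
    inc-Y S T with members T ⊆? members S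
    ... | yes T⊆S = just (Y-mono {S} {T} T⊆S)
    ... | no _    = nothing

    inc-Y-just : ∀ S T → members T ⊆ members S → Is-just (inc-Y S T)
    inc-Y-just S T T⊆S with members T ⊆? members S
    ... | yes _ = just _
    ... | no ¬p = ⊥-elim (¬p T⊆S)

    within : ∀ {k} → (∀ T → Chain R (Y T) k) → ∀ S → ∣Λ∣ n → Chain R (Y S) k
    within {k} φ S = lin (chains R (Y S) k) (Spread.spread (Y S) (inc-Y S) φ)

    -- `φ-cycle` is what the next stage consumes: the chain assembled from the facets of a simplex
    -- is a cycle of its union, so the hypothesis can fill it.
    record Stage (k : ℕ) : Set (r ⊔ ℓ ⊔ v ⊔ p) where
      field
        φ       : ∀ S → Chain R (Y S) k
        φ-cycle : ∀ S → Filled (suc k) S → IsCycle R (Y S) (within φ S (d (basis S)))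

    open Stage public

    BoundaryOf : ∀ {k} → (∀ S → Chain R (Y S) (suc k)) → (∀ S → Chain R (Y S) k) → Set _
    BoundaryOf {k} φ′ φ = ∀ S → Filled (suc k) S →
      Module._≈ᴹ_ (chains R (Y S) k) (∂ R (Y S) (φ′ S)) (within φ S (d (basis S)))

    module _ {k} {φ′ : ∀ S → Chain R (Y S) (suc k)} {φ : ∀ S → Chain R (Y S) k} (bdry : BoundaryOf φ′ φ)
             {u} (L : SimplicialComplex V u) (inc : ∀ T → Maybe (Y T ⊆ᶜ L)) where

      private
        module C = ModuleLemmas (chains R L k)
        module Sφ′ = Spread L inc φ′
        module Sφ  = Spread L inc φ

      -- The boundary of T involves only its facets, and for these the direct inclusion into L
      -- agrees with the one through `Y T`.
      spread-∂ : ∀ T → Filled (suc k) T → Y T ⊆ᶜ L → (∀ U → members U ⊆ members T → Is-just (inc U)) →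
                 ∂ R L (Sφ′.spread T) C.≈ᴹ lin (chains R L k) Sφ.spread (d (basis T))
      spread-∂ T fT T⊆L h = begin
        ∂ R L (Sφ′.spread T)                                   ≈⟨ ∂-spread (inc T) refl ⟩
        incl {K = Y T} {L} T⊆L (∂ R (Y T) (φ′ T))                            ≈⟨ IsLinear.≈-cong (incl-linear {K = Y T} {L} T⊆L) (bdry T fT) ⟩
        incl {K = Y T} {L} T⊆L (within φ T (d (basis T)))                    ≈⟨ spread-agrees ⟨
        lin (chains R L k) Sφ.spread (d (basis T))             ∎
        where
        open C
        ∂-spread : ∀ m → inc T ≡ m → ∂ R L (Sφ′.spread T) ≈ᴹ incl {K = Y T} {L} T⊆L (∂ R (Y T) (φ′ T))
        ∂-spread m eq with inc T | h T ⊆-refl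
        ... | just i | _ = ≈ᴹ-trans (incl-∂ {K = Y T} {L} i (φ′ T)) (incl-unique {K = Y T} {L} i T⊆L (∂ R (Y T) (φ′ T)))
        spread-agrees : lin (chains R L k) Sφ.spread (d (basis T)) ≈ᴹ incl {K = Y T} {L} T⊆L (within φ T (d (basis T)))
        spread-agrees = lin-agree (chains R L k)
          (∘-linear (Λ n) (chains R (Y T) k) (chains R L k) (incl-linear {K = Y T} {L} T⊆L) (lin-linear (chains R (Y T) k) _))
          (λ U U◃T → begin
            Sφ.spread U                                ≈⟨ Sφ.spread-incl (h U (◃-⊆ U◃T)) (U⊆L U◃T) ⟩
            incl {K = Y U} {L} (U⊆L U◃T) (φ U)                       ≈⟨ incl-incl {K = Y U} {Y T} {L} (Y-mono {T} {U} (◃-⊆ U◃T)) T⊆L (U⊆L U◃T) (φ U) ⟨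
            incl {K = Y T} {L} T⊆L (incl {K = Y U} {Y T} (Y-mono {T} {U} (◃-⊆ U◃T)) (φ U))   ≈⟨ IsLinear.≈-cong (incl-linear {K = Y T} {L} T⊆L)
                (Spread.spread-incl (Y T) (inc-Y T) φ (inc-Y-just T U (◃-⊆ U◃T)) (Y-mono {T} {U} (◃-⊆ U◃T))) ⟨
            incl {K = Y T} {L} T⊆L (Spread.spread (Y T) (inc-Y T) φ U)       ≈⟨ IsLinear.≈-cong (incl-linear {K = Y T} {L} T⊆L) (lin-basis (chains R (Y T) k) (Spread.spread (Y T) (inc-Y T) φ) U) ⟨
            incl {K = Y T} {L} T⊆L (within φ T (basis U))            ∎)
          (d-basis T)
          where
          U⊆L : ∀ {U} → U ◃ T → Y U ⊆ᶜ L
          U⊆L {U} U◃T s s∈ = T⊆L s (Y-mono {T} {U} (◃-⊆ U◃T) s s∈)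

      lin-spread-∂ : ∀ {P : Vec Bool n → Set} {a} →
                     (∀ T → P T → Filled (suc k) T × Y T ⊆ᶜ L × (∀ U → members U ⊆ members T → Is-just (inc U))) →
                     Span (Λ n) (Basis P) a →
                     ∂ R L (lin (chains R L (suc k)) Sφ′.spread a) C.≈ᴹ lin (chains R L k) Sφ.spread (d a)
      lin-spread-∂ {a = a} h a∈ = C.≈ᴹ-trans (C.≈ᴹ-reflexive (∂-lin L Sφ′.spread a))
        (lin-agree (chains R L k)
          (∘-linear (Λ n) (Λ n) (chains R L k) (lin-linear (chains R L k) Sφ.spread) d-linear)
          (λ T PT → let fT , T⊆L , g = h T PT in spread-∂ T fT T⊆L g) a∈)

    module _ (fill : ∀ S {k} → Filled (suc k) S → (z : Chain R (Y S) k) → IsCycle R (Y S) z →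
                     ∃ λ w → Module._≈ᴹ_ (chains R (Y S) k) (∂ R (Y S) w) z) where

      module Next {k} (stage : Stage k) where

        next : ∀ S → Chain R (Y S) (suc k)
        next S with filled? (suc k) S
        ... | yes f = proj₁ (fill S f _ (φ-cycle stage S f))
        ... | no _  = 𝟎

        next-∂ : BoundaryOf next (φ stage)
        next-∂ S f with filled? (suc k) S
        ... | yes f′ = proj₂ (fill S f′ _ (φ-cycle stage S f′))
        ... | no ¬f  = contradiction f ¬f

      stages : ∀ k → Stage k
      -- Every mask starts with the empty face, which is always a cycle. Filling it for a single
      -- member of Γ uses reduced homology in degree -1 and picks out points of that member.
      stages zero = record { φ = λ S → gen (orderedFace [] [] _) ; φ-cycle = λ _ _ → _ }
      stages (suc k) = record
        { φ       = next
        -- The boundary of φ(∂S) is φ(∂∂S), which is zero by `d-d`; the facets of S are small enough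
        -- to have been filled.
        ; φ-cycle = λ S f → C.≈ᴹ-trans S
            (lin-spread-∂ next-∂ (Y S) (inc-Y S) {P = λ T → Filled (suc k) T × T ◃ S}
              (λ T (fT , T◃S) → fT , Y-mono {S} {T} (◃-⊆ T◃S) , λ U U⊆T → inc-Y-just S U (⊆-trans U⊆T (◃-⊆ T◃S)))
              (Span-⊆ (Λ n) (λ { (T , T◃S , eq) → T , (Filled-◃ f T◃S , T◃S) , eq }) (d-basis S)))
            (C.≈ᴹ-trans S (IsLinear.≈-cong (lin-linear (chains R (Y S) k) (Spread.spread (Y S) (inc-Y S) (φ (stages k)))) (d-d (λ _ → R.refl) (basis S)))
              (IsLinear.0-homo (lin-linear (chains R (Y S) k) (Spread.spread (Y S) (inc-Y S) (φ (stages k))))))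
        }
        where
        open Next (stages k)
        module C (S : Vec Bool n) = ModuleLemmas (chains R (Y S) k)

      stages-∂ : ∀ k → BoundaryOf (φ (stages (suc k))) (φ (stages k))
      stages-∂ k = Next.next-∂ (stages k)

  -- Comparing a cycle of the nerve with its image in X inside K.

  module Comparison (X : SimplicialComplex V p) (Γ⊆X : ∀ i → Γ i ⊆ᶜ X) (X⊆⋃ : X ⊆ᶜ ⋃ Γ) (𝒢 : DecidableFaces n) where

    open Fillers 𝒢
    open DecidableFaces 𝒢 using (Good)

    Y⊆X : ∀ S → Y S ⊆ᶜ X
    Y⊆X S s ((i , _) , s∈) = Γ⊆X i s s∈

    Lift-lin : ∀ {m k} {b : Vec Bool k → Chain R X m} {b′} → (∀ S → Lift X (b′ S) (b S)) →
               ∀ a → Lift X (S.lin M b′ a) (S.lin (chains R X m) b a)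
    Lift-lin {k = zero}  h a = a [] · h []
    Lift-lin {k = suc k} h a = Lift-lin (h ∘ (false ∷_)) _ ⊕ Lift-lin (h ∘ (true ∷_)) _

    -- Inclusion keeps the shape and the vertices of a chain, so a lift chosen in X still remembers
    -- that the filler lies in the union over S.
    Lift-incl : ∀ S {m} (y : Chain R (Y S) m) {x′} → Lift X x′ (incl {K = Y S} {X} (Y⊆X S) y) → Lift (Y S) x′ y
    Lift-incl S (gen t) (gen p) = gen p
    Lift-incl S 𝟎       𝟎       = 𝟎
    Lift-incl S (x ⊕ y) (p ⊕ q) = Lift-incl S x p ⊕ Lift-incl S y q
    Lift-incl S (⊖ x)   (⊖ p)   = ⊖ Lift-incl S x p
    Lift-incl S (k · x) (.k · p) = k · Lift-incl S x p

    module _ (fill : ∀ S {k} → Filled (suc k) S → (z : Chain R (Y S) k) → IsCycle R (Y S) z →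
                     ∃ λ w → Module._≈ᴹ_ (chains R (Y S) k) (∂ R (Y S) w) z) where

      φX : ∀ k → Vec Bool n → Chain R X k
      φX k = Spread.spread X (λ T → just (Y⊆X T)) (φ (stages fill k))

      φ̂ : ∀ {k} → S.∣Λ∣ n → Chain R X k
      φ̂ {k} = S.lin (chains R X k) (φX k)

      φ̂-linear : ∀ {k} → IsLinear (S.Λ n) (chains R X k) φ̂
      φ̂-linear {k} = S.lin-linear (chains R X k) (φX k)

      ∂-φ̂ : ∀ {k a} → Span (S.Λ n) (S.Basis (Filled (suc k))) a →
            Module._≈ᴹ_ (chains R X k) (∂ R X (φ̂ {suc k} a)) (φ̂ (S.d a))
      ∂-φ̂ {k} = lin-spread-∂ {φ′ = φ (stages fill (suc k))} (stages-∂ fill k) X (λ T → just (Y⊆X T))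
        (λ T fT → fT , Y⊆X T , λ _ _ → just _)

      ∂-φX : ∀ {k} S → Filled (suc k) S → Module._≈ᴹ_ (chains R X k) (∂ R X (φX (suc k) S)) (φ̂ (S.d (S.basis S)))
      ∂-φX {k} S f = spread-∂ {φ′ = φ (stages fill (suc k))} (stages-∂ fill k) X (λ T → just (Y⊆X T)) S f (Y⊆X S) (λ _ _ → just _)

      -- In general dη(a) = Φ(a) - ι(a) - η(da), with η of the previous level on the right. On
      -- cycles that term vanishes, so one level can be stated alone, and the next level applies it
      -- only to boundaries.
      record Homotopy (k : ℕ) : Set (r ⊔ ℓ ⊔ v ⊔ p) where
        field
          Φ      : Vec Bool n → M.Carrierᴹ
          Φ-lift : ∀ S → Lift X (Φ S) (φX k S)
          η      : Vec Bool n → X.∣Λ∣ n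
          η-∈    : ∀ S → Filled k S → (members S , suc k) ∈K η S
          d-η    : ∀ {a} → Span (S.Λ n) (S.Basis (Filled k)) a → S.d a SΛ.≈ᴹ SΛ.0ᴹ →
                   D.d (S.lin (X.Λ n) η a) XΛ.≈ᴹ X.inj (S.lin M Φ a) XΛ.+ᴹ XΛ.-ᴹ ι a

      open Homotopy

      ¬¬-Φ : ∀ k → ¬ ¬ (∀ S → ∃ λ x → Lift X x (φX k S))
      ¬¬-Φ k = ¬¬-Vec ¬¬-Bool (λ S → ¬¬-Lift X (X⊆⋃ _) (φX k S))

      -- Over the empty mask both φ and ι give the empty simplex, so the zero homotopy works.
      homotopy-base : (∀ S → ∃ λ x → Lift X x (φX 0 S)) → Homotopy 0
      homotopy-base Φ = record
        { Φ      = proj₁ ∘ Φ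
        ; Φ-lift = proj₂ ∘ Φ
        ; η      = λ _ → XΛ.0ᴹ
        ; η-∈    = λ _ _ → 0-∈
        ; d-η    = λ {a} a∈ _ → begin
            D.d (S.lin (X.Λ n) (λ _ → 0ᴹ) a)                       ≈⟨ IsLinear.≈-cong D.d-linear (lin-0 a∈) ⟩
            D.d 0ᴹ                                                 ≈⟨ IsLinear.0-homo D.d-linear ⟩
            0ᴹ                                                     ≈⟨ -ᴹ‿inverseʳ (ι a) ⟨
            ι a +ᴹ -ᴹ ι a                                          ≈⟨ +ᴹ-congʳ (inj-Φ a∈) ⟨
            X.inj (S.lin M (proj₁ ∘ Φ) a) +ᴹ -ᴹ ι a                ∎
        }
        where
        open XΛ
        lin-0 : ∀ {a} → Span (S.Λ n) (S.Basis (Filled 0)) a → S.lin (X.Λ n) (λ _ → 0ᴹ) a ≈ᴹ 0ᴹ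
        lin-0 = S.lin-agree (X.Λ n) (0-linear (S.Λ n) (X.Λ n)) (λ _ _ → ≈ᴹ-refl)
        inj-Φ : ∀ {a} → Span (S.Λ n) (S.Basis (Filled 0)) a → X.inj (S.lin M (proj₁ ∘ Φ) a) ≈ᴹ ι a
        inj-Φ = agree-on-Span (S.Λ n) (X.Λ n)
          (∘-linear (S.Λ n) M (X.Λ n) X.inj-linear (S.lin-linear M _)) ι-linear λ { (S , (l , _) , refl) → ≈ᴹ-trans
              (IsLinear.≈-cong X.inj-linear (M.≈ᴹ-trans (S.lin-basis M (proj₁ ∘ Φ) S)
                (Lift-unique X (proj₂ (Φ S)) (gen {A = origin} {[]} {inclFace {K = Y S} {X} (Y⊆X S) (orderedFace [] _ _)} refl))))
              (≈ᴹ-trans (≈ᴹ-reflexive (cong (λ τ → X.word τ (X.inj ∅)) (sym (empty (members S) l)))) (≈ᴹ-sym (ι-basis S))) }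
          where
          empty : ∀ (τ : List (Fin n)) → length τ ≡ 0 → τ ≡ []
          empty [] _ = refl

      module _ {k} (E : Homotopy k) (Φ′ : ∀ S → ∃ λ x → Lift X x (φX (suc k) S))
               (∂Φ′ : ∀ S → Filled (suc k) S → ∂ᴹ (proj₁ (Φ′ S)) M.≈ᴹ S.lin M (Φ E) (S.d (S.basis S))) where

        open XΛ

        private
          module linη = IsLinear (S.lin-linear (X.Λ n) (η E))

          -- The boundary that the new homotopy must have at a simplex, once the previous homotopy
          -- is fixed on its facets.
          obstruction : S.∣Λ∣ n → X.∣Λ∣ n
          obstruction a = (X.inj (S.lin M (proj₁ ∘ Φ′) a) +ᴹ -ᴹ ι a) +ᴹ -ᴹ S.lin (X.Λ n) (η E) (S.d a)

          obstruction-linear : IsLinear (S.Λ n) (X.Λ n) obstruction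
          obstruction-linear = +-linear (S.Λ n) (X.Λ n)
            (+-linear (S.Λ n) (X.Λ n) (∘-linear (S.Λ n) M (X.Λ n) X.inj-linear (S.lin-linear M _)) (neg-linear (S.Λ n) (X.Λ n) ι-linear))
            (neg-linear (S.Λ n) (X.Λ n) (∘-linear (S.Λ n) (S.Λ n) (X.Λ n) (S.lin-linear (X.Λ n) (η E)) S.d-linear))

          facets : ∀ {S} → Filled (suc k) S → Span (S.Λ n) (S.Basis (Filled k)) (S.d (S.basis S))
          facets {S} f = Span-⊆ (S.Λ n) (λ { (T , T◃S , eq) → T , Filled-◃ f T◃S , eq }) (S.d-basis S)

          -- The previous level applies to `S.d (S.basis S)`, which is a cycle; with the lifted
          -- filler equation `∂Φ′` its right-hand side is the boundary of the first two terms.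
          d-obstruction : ∀ S → Filled (suc k) S → D.d (obstruction (S.basis S)) ≈ᴹ 0ᴹ
          d-obstruction S f = begin
            D.d (obstruction b)
              ≈⟨ ≈ᴹ-trans (D.d.+-homo _ _) (+ᴹ-cong (≈ᴹ-trans (D.d.+-homo _ _) (+ᴹ-congˡ (D.d.neg-homo _))) (D.d.neg-homo _)) ⟩
            (D.d (X.inj (S.lin M (proj₁ ∘ Φ′) b)) +ᴹ -ᴹ D.d (ι b)) +ᴹ -ᴹ D.d (S.lin (X.Λ n) (η E) (S.d b))
              ≈⟨ +ᴹ-cong (+ᴹ-cong inj-part (-ᴹ‿cong (≈ᴹ-sym (d-ι b)))) (-ᴹ‿cong (d-η E (facets {S} f) (S.d-d (λ _ → R.refl) b))) ⟩
            (X.inj (S.lin M (Φ E) (S.d b)) +ᴹ -ᴹ ι (S.d b)) +ᴹ -ᴹ (X.inj (S.lin M (Φ E) (S.d b)) +ᴹ -ᴹ ι (S.d b))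
              ≈⟨ -ᴹ‿inverseʳ _ ⟩
            0ᴹ ∎
            where
            b = S.basis S
            inj-part : D.d (X.inj (S.lin M (proj₁ ∘ Φ′) b)) ≈ᴹ X.inj (S.lin M (Φ E) (S.d b))
            inj-part = ≈ᴹ-trans (D.d-inj _) (IsLinear.≈-cong X.inj-linear
              (M.≈ᴹ-trans (IsLinear.≈-cong ∂ᴹ-linear (S.lin-basis M (proj₁ ∘ Φ′) S)) (∂Φ′ S f)))

          η′ : Vec Bool n → X.∣Λ∣ n
          η′ S = contract (members S) (obstruction (S.basis S))

          -- The filler is a chain of the union over σ, ι gives σ joined with the empty simplex, and
          -- η of a facet stays over that facet.
          obstruction-∈ : ∀ S → Filled (suc k) S → (members S , suc k) ∈K obstruction (S.basis S)
          obstruction-∈ S f@(l , _) = +-∈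
            (+-∈ (resp (IsLinear.≈-cong X.inj-linear (M.≈ᴹ-sym (S.lin-basis M (proj₁ ∘ Φ′) S)))
                   (inj-Lift-∈ (Lift-incl S (φ (stages fill (suc k)) S) (proj₂ (Φ′ S)))))
                 (neg-∈ (X.Λ n) _ (resp (≈ᴹ-sym (ι-basis S))
                   (base {P = Supported (InJoin (members S) (suc k))} (supported origin [] (members S) (trans (ℕ.+-identityʳ _) l , ⊆-refl , _ , λ _ _ → _))))))
            (neg-∈ (X.Λ n) _ (S.lin-∈ (X.Λ n) {P = λ T → T ◃ S × Filled k T} {b = η E} (λ T (T◃S , fT) → K-mono (◃-⊆ T◃S) (η-∈ E T fT))
              (Span-⊆ (S.Λ n) {Q = S.Basis (λ T → T ◃ S × Filled k T)} (λ { (T , T◃S , eq) → T , (T◃S , Filled-◃ f T◃S) , eq }) (S.d-basis S))))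

        homotopy-step : Homotopy (suc k)
        homotopy-step = record
          { Φ      = proj₁ ∘ Φ′
          ; Φ-lift = proj₂ ∘ Φ′
          ; η      = η′
          ; η-∈    = λ S f → contract-∈ (members S) (obstruction-∈ S f)
          ; d-η    = λ {a} a∈ da≈0 → begin
              D.d (S.lin (X.Λ n) η′ a)           ≈⟨ lin-homo (X.Λ n) (X.Λ n) D.d-linear η′ a ⟩
              S.lin (X.Λ n) (D.d ∘ η′) a         ≈⟨ S.lin-agree (X.Λ n) obstruction-linear
                                                      (λ S f → d-contract (members S) (proj₁ f) (d-obstruction S f)) a∈ ⟩
              obstruction a                      ≈⟨ +ᴹ-congˡ (-ᴹ‿cong (≈ᴹ-trans (linη.≈-cong da≈0) linη.0-homo)) ⟩
              (X.inj (S.lin M (proj₁ ∘ Φ′) a) +ᴹ -ᴹ ι a) +ᴹ -ᴹ 0ᴹ   ≈⟨ ≈ᴹ-trans (+ᴹ-congˡ -ᴹ0≈0) (+ᴹ-identityʳ _) ⟩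
              X.inj (S.lin M (proj₁ ∘ Φ′) a) +ᴹ -ᴹ ι a              ∎
          }

      -- The filler equation is known for chains of X. Passing to cells costs a double negation for
      -- each mask, and there are finitely many masks.
      ¬¬-homotopy : ∀ k → ¬ ¬ Homotopy k
      ¬¬-homotopy zero    = ¬¬-Φ 0 >>= λ Φ → pure (homotopy-base Φ)
      ¬¬-homotopy (suc k) = ¬¬-homotopy k >>= λ E → ¬¬-Φ (suc k) >>= λ Φ′ →
        ¬¬-Vec ¬¬-Bool {P = λ S → Filled (suc k) S → LiftsAgree X (X⊆⋃ _) (∂ R X (φX (suc k) S)) (φ̂ (S.d (S.basis S)))}
          (λ S → ¬¬-→ (filled? (suc k) S) (λ f → ¬¬-Lift-≈ X (X⊆⋃ _) (∂-φX S f))) >>= λ agrees →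
        pure (homotopy-step E Φ′ (λ S f → agree (agrees S f) (Lift-∂ X (proj₂ (Φ′ S))) (Lift-lin (Φ-lift E) (S.d (S.basis S)))))
        where
        ¬¬-→ : ∀ {a b} {A : Set a} {B : Set b} → Dec A → (A → ¬ ¬ B) → ¬ ¬ (A → B)
        ¬¬-→ (yes a) f = f a >>= λ b → pure λ _ → b
        ¬¬-→ (no ¬a) f = pure λ a → contradiction a ¬a

      bounding : ∀ {k} {z : Chain R (Nerve Γ) k} → Span (S.Λ n) (S.Basis (Filled k)) (N.fwd z) →
                 (∀ σ → Good σ → Face (Nerve Γ) σ) → S.d (N.fwd z) SΛ.≈ᴹ SΛ.0ᴹ →
                 (w : Chain R X (suc k)) → Module._≈ᴹ_ (chains R X k) (φ̂ (N.fwd z)) (∂ R X w) →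
                 ¬ ¬ (∃ λ c → Module._≈ᴹ_ (chains R (Nerve Γ) k) z (∂ R (Nerve Γ) c))
      bounding {k} {z} a∈ good-face da≈0 w p =
        ¬¬-homotopy k >>= λ E → ¬¬-Lift X (X⊆⋃ _) w >>= λ (w′ , lw) →
        ¬¬-Lift-≈ X (X⊆⋃ _) p >>= λ h →
        ¬¬-Vec ¬¬-Fin (λ s → ¬¬-excluded-middle) >>= λ face? →
        pure (conclude E w′ lw (agree h (Lift-lin (Φ-lift E) a) (Lift-∂ X lw)) face?)
        where
        a : S.∣Λ∣ n
        a = N.fwd z
        conclude : ∀ E w′ → Lift X w′ w → S.lin M (Φ E) a M.≈ᴹ ∂ᴹ w′ → (∀ s → Dec (Face (Nerve Γ) (toList s))) →
                   ∃ λ c → Module._≈ᴹ_ (chains R (Nerve Γ) k) z (∂ R (Nerve Γ) c)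
        conclude E w′ lw q face? = c , N.fwd-injective face? (begin
          a                                                  ≈⟨ a≈du ⟩
          S.d u                                              ≈⟨ S.d.≈-cong fc≈u ⟨
          S.d (N.fwd c)                                      ≈⟨ N.fwd-∂ c ⟨
          N.fwd (∂ R (Nerve Γ) c)                            ∎)
          where
          open SΛ
          y : X.∣Λ∣ n
          y = S.lin (X.Λ n) (η E) a
          u : S.∣Λ∣ n
          -- This comes from applying ρ, which is ψ on chains of X, to `ι a` written as
          -- `X.inj (∂ᴹ w′)` minus `D.d y`.
          u = ψ w′ +ᴹ -ᴹ ρ y
          a≈du : a ≈ᴹ S.d u
          a≈du = begin
            a                                          ≈⟨ ρ-ι a∈ ⟨
            ρ (ι a)                                    ≈⟨ IsLinear.≈-cong ρ-linear ι≈ ⟩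
            ρ (X.inj (∂ᴹ w′) XΛ.+ᴹ XΛ.-ᴹ D.d y)        ≈⟨ ≈ᴹ-trans (IsLinear.+-homo ρ-linear _ _) (+ᴹ-congˡ (IsLinear.neg-homo ρ-linear _)) ⟩
            ρ (X.inj (∂ᴹ w′)) +ᴹ -ᴹ ρ (D.d y)          ≈⟨ +ᴹ-cong (≈ᴹ-trans (ρ-inj _) (≈ᴹ-sym (ψ-∂ w′))) (-ᴹ‿cong (≈ᴹ-sym (d-ρ y))) ⟩
            S.d (ψ w′) +ᴹ -ᴹ S.d (ρ y)                 ≈⟨ ≈ᴹ-trans (S.d.+-homo _ _) (+ᴹ-congˡ (S.d.neg-homo _)) ⟨
            S.d u                                      ∎
            where
            ι≈ : ι a XΛ.≈ᴹ X.inj (∂ᴹ w′) XΛ.+ᴹ XΛ.-ᴹ D.d y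
            ι≈ = XΛ.≈ᴹ-sym (XΛ.x≈y+z⇒x-z≈y (XΛ.≈ᴹ-trans (XΛ.≈ᴹ-sym (XΛ.x-y+y _ (ι a)))
              (XΛ.≈ᴹ-trans (XΛ.+ᴹ-congʳ (XΛ.≈ᴹ-trans (XΛ.+ᴹ-congʳ (IsLinear.≈-cong X.inj-linear (M.≈ᴹ-sym q))) (XΛ.≈ᴹ-sym (d-η E a∈ da≈0)))) (XΛ.+ᴹ-comm _ _))))
          u∈ : Span (S.Λ n) (N.Word (suc k)) u
          -- ψ takes every chain of X to nerve faces; for the other part, `η-∈` puts each value of η
          -- in K over a face of the nerve.
          u∈ = +-∈ (ψ-Lift-∈ lw) (neg-∈ (S.Λ n) _ (resp (SΛ.≈ᴹ-sym (lin-homo (X.Λ n) (S.Λ n) ρ-linear (η E) a))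
            (S.lin-∈ (S.Λ n) (λ S f → ρ-∈ (good-face _ (proj₂ (proj₂ f))) (η-∈ E S f)) a∈)))
          c : Chain R (Nerve Γ) (suc k)
          c = proj₁ (N.Span⇒fwd u∈)
          fc≈u : N.fwd c ≈ᴹ u
          fc≈u = proj₂ (N.Span⇒fwd u∈)

  -- The induced map on the given cycles, and why it reflects boundaries.

  module Main (X : SimplicialComplex V p) (Γ⊆X : ∀ i → Γ i ⊆ᶜ X) (X⊆⋃ : X ⊆ᶜ ⋃ Γ) (m : ℕ)
              (trivial : ∀ S k → length (members S) ≡ suc k → suc k ℕ.≤ m → Face (Nerve Γ) (members S) →
                         Trivial (homologyModule R (⋃[ members S ] Γ) k))
              {d : ℕ} (z : Fin d → Cycle R (Nerve Γ) m) where

    -- Simplices of the nerve carry witnesses and need not be decidable; the faces that occur in the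
    -- given cycles form a decidable subcomplex with a canonical witness for each face.
    Good : List (Fin n) → Set
    Good σ = ∃ λ i → Any (σ ⊆_) (facesOf R (Nerve Γ) (chain (z i)))

    𝒢 : DecidableFaces n
    𝒢 = record
      { Good   = Good
      ; good?  = λ σ → Fin.any? (λ i → Any.any? (σ ⊆?_) (facesOf R (Nerve Γ) (chain (z i))))
      ; good-⊆ = λ (i , σ∈) τ⊆σ → i , Any.map (⊆-trans τ⊆σ) σ∈
      ; bound  = m
      }

    good-face : ∀ σ → Good σ → Face (Nerve Γ) σ
    good-face σ (i , σ∈) with ListAll.lookupAny (facesOf-Face R (Nerve Γ) (chain (z i))) σ∈
    ... | τ∈ , σ⊆τ = Face-down-closed (Nerve Γ) τ∈ σ⊆τ

    open DecidableFaces 𝒢 using (good-⊆)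
    open Fillers 𝒢 using (Y; Filled)
    open Comparison X Γ⊆X X⊆⋃ 𝒢 using (bounding; φ̂; φ̂-linear; ∂-φ̂)

    fill : ∀ S {k} → Filled (suc k) S → (z : Chain R (Y S) k) → IsCycle R (Y S) z →
           ∃ λ w → Module._≈ᴹ_ (chains R (Y S) k) (∂ R (Y S) w) z
    fill S {k} (l , k≤ , g) z z-cycle with trivial S k l k≤ (good-face _ g) (cycle z z-cycle)
    ... | w , p = w , Presented.≈-sym (Presented.≈-trans p (Presented.⊕-identity _))

    -- Sorting a face into monomials stays within its vertices, so only subsets of faces of the
    -- given cycles occur, and these are `Good` by definition.
    fwd-∈ : (x : Chain R (Nerve Γ) m) → (∀ {τ} → τ ∈ facesOf R (Nerve Γ) x → Good τ) →
            Span (S.Λ n) (S.Basis (Filled m)) (N.fwd x)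
    fwd-∈ (gen s) h = Span-⊆ (S.Λ n) (λ where
        (S , (l , S⊆) , eq) → S , (trans l (length-toList (vertices s)) , ℕ.≤-refl , good-⊆ (h (here refl)) S⊆) , eq)
      (S.word-∈ (toList (vertices s)))
    fwd-∈ 𝟎       h = 0-∈
    fwd-∈ (x ⊕ y) h = +-∈ (fwd-∈ x (h ∘ ∈-++⁺ˡ)) (fwd-∈ y (h ∘ ∈-++⁺ʳ (facesOf R (Nerve Γ) x)))
    fwd-∈ (⊖ x)   h = neg-∈ (S.Λ n) _ (fwd-∈ x h)
    fwd-∈ (k · x) h = *-∈ k (fwd-∈ x h)

    fwd-z-∈ : ∀ i → Span (S.Λ n) (S.Basis (Filled m)) (N.fwd (chain (z i)))
    fwd-z-∈ i = fwd-∈ (chain (z i)) (λ τ∈ → i , lose τ∈ ⊆-refl)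

    d-fwd : ∀ {k} (y : Cycle R (Nerve Γ) k) → S.d (N.fwd (chain y)) SΛ.≈ᴹ SΛ.0ᴹ
    d-fwd {zero}  y = N.d-fwd₀ (chain y)
    d-fwd {suc k} y = SΛ.≈ᴹ-trans (SΛ.≈ᴹ-sym (N.fwd-∂ (chain y))) (IsLinear.≈-cong (N.fwd-linear k) (isCycle y))

    φ̂-cycle : ∀ {k} (y : Cycle R (Nerve Γ) k) → Span (S.Λ n) (S.Basis (Filled k)) (N.fwd (chain y)) →
              IsCycle R X (φ̂ fill {k} (N.fwd (chain y)))
    φ̂-cycle {zero}  y y∈ = _
    φ̂-cycle {suc k} y y∈ = C.≈ᴹ-trans (∂-φ̂ fill y∈)
      (C.≈ᴹ-trans (IsLinear.≈-cong (φ̂-linear fill {k}) (d-fwd y)) (IsLinear.0-homo (φ̂-linear fill {k})))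
      where module C = ModuleLemmas (chains R X k)

    image : Fin d → Cycle R X m
    image i = cycle (φ̂ fill (N.fwd (chain (z i)))) (φ̂-cycle (z i) (fwd-z-∈ i))

    reflects-boundaries : ∀ (a : Fin d → R.Carrier) →
      Module._≈ᴹ_ (homologyModule R X m) (linearCombination (homologyModule R X m) a image) (Module.0ᴹ (homologyModule R X m)) →
      ¬ ¬ Module._≈ᴹ_ (homologyModule R (Nerve Γ) m) (linearCombination (homologyModule R (Nerve Γ) m) a z)
                      (Module.0ᴹ (homologyModule R (Nerve Γ) m))
    reflects-boundaries a (w , p) = bounding fill {z = chain y} y∈ good-face (d-fwd y) w φ̂y≈∂w
      >>= λ (c , q) → pure (c , Presented.≈-trans q (Presented.≈-sym (Presented.⊕-identity _)))
      where
      y : Cycle R (Nerve Γ) m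
      y = linearCombination (homologyModule R (Nerve Γ) m) a z
      fwd-y : N.fwd (chain y) SΛ.≈ᴹ linearCombination (S.Λ n) a (λ i → N.fwd (chain (z i)))
      fwd-y = SΛ.≈ᴹ-trans (SΛ.≈ᴹ-reflexive (cong N.fwd (chain-lc R (Nerve Γ) a z)))
        (IsLinear.lc-homo (N.fwd-linear m) a (chain ∘ z))
      y∈ : Span (S.Λ n) (S.Basis (Filled m)) (N.fwd (chain y))
      y∈ = resp (SΛ.≈ᴹ-sym fwd-y) (lc-∈ (S.Λ n) _ a fwd-z-∈)
      φ̂y≈∂w : Module._≈ᴹ_ (chains R X m) (φ̂ fill (N.fwd (chain y))) (∂ R X w)
      φ̂y≈∂w = begin
        φ̂ fill (N.fwd (chain y))                                                ≈⟨ IsLinear.≈-cong (φ̂-linear fill) fwd-y ⟩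
        φ̂ fill (linearCombination (S.Λ n) a (λ i → N.fwd (chain (z i))))        ≈⟨ IsLinear.lc-homo (φ̂-linear fill) a _ ⟩
        linearCombination (chains R X m) a (chain ∘ image)                      ≈⟨ ≈ᴹ-reflexive (chain-lc R X a image) ⟨
        chain (linearCombination (homologyModule R X m) a image)                ≈⟨ p ⟩
        𝟎 ⊕ ∂ R X w                                                             ≈⟨ +ᴹ-identityˡ _ ⟩
        ∂ R X w                                                                 ∎
        where open ModuleLemmas (chains R X m)

theorem3 : ∀ {c ℓ₁ ℓ₂ v p} (F : HeytingField c ℓ₁ ℓ₂) →
    let 𝔽 = HeytingCommutativeRing.commutativeRing (HeytingField.heytingCommutativeRing F) in
    {V : Set v} (X : SimplicialComplex V p) →
    (n : ℕ) (Γ : Fin n → SimplicialComplex V p) →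
    (∀ i → Γ i ⊆ᶜ X) → ⋃ Γ ≐ᶜ X →
    (ℓ : ℤ) → -1ℤ ≤ ℓ → ℓ < + n →
    (∀ (σ : List (Fin n)) → Unique σ → Simplex (Nerve Γ) σ → dim σ ≤ ℓ →
    Trivial (H̃ 𝔽 (⋃[ σ ] Γ) (+ length σ - + 2))) →
    H̃ 𝔽 (Nerve Γ) ℓ dim≤ H̃ 𝔽 X ℓ
theorem3 F X n Γ Γ⊆X (_ , X⊆⋃) ℓ -1≤ℓ _ trivial = cases ℓ -1≤ℓ trivial
  where
  module F = HeytingField F
  𝔽 = HeytingCommutativeRing.commutativeRing (HeytingField.heytingCommutativeRing F)

  -- By tightness, elements that are not apart are equal, and apartness contradicts a doubly negated
  -- equality.
  ≈-stable : ∀ {x y} → ¬ ¬ (x F.≈ y) → x F.≈ y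
  ≈-stable {x} {y} ¬¬x≈y = proj₁ (F.tight x y) λ x#y → ¬¬x≈y λ x≈y → proj₂ (F.tight x y) x≈y x#y

  Hypothesis : ℤ → Set _
  Hypothesis ℓ = ∀ (σ : List (Fin n)) → Unique σ → Simplex (Nerve Γ) σ → dim σ ≤ ℓ →
    Trivial (H̃ 𝔽 (⋃[ σ ] Γ) (+ length σ - + 2))

  Face⇒Simplex : ∀ {k} σ → length σ ≡ suc k → Face (Nerve Γ) σ → Simplex (Nerve Γ) σ
  Face⇒Simplex (_ ∷ _) _ σ∈ = σ∈

  compare : ∀ m → (∀ S k → length (members S) ≡ suc k → suc k ℕ.≤ m → Face (Nerve Γ) (members S) →
                   Trivial (homologyModule 𝔽 (⋃[ members S ] Γ) k)) →
            homologyModule 𝔽 (Nerve Γ) m dim≤ homologyModule 𝔽 X m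
  compare m h d (z , independent) = image , λ a p i →
    ≈-stable (reflects-boundaries a p >>= λ q → pure (independent a q i))
    where open NerveTheorem.Main 𝔽 Γ X Γ⊆X X⊆⋃ m h z using (image; reflects-boundaries)

  -- Homology modules are indexed by the number of vertices, so l - 2 becomes l - 1 = k; the case
  -- split lets the integer subtraction compute.
  degree : ∀ {q} (K : SimplicialComplex _ q) k l → l ≡ suc k → Trivial (H̃ 𝔽 K (+ l - + 2)) → Trivial (homologyModule 𝔽 K k)
  degree K zero    _ refl t = t
  degree K (suc k) _ refl t = t

  dim-bound : ∀ {k k′} (σ : List (Fin n)) → length σ ≡ suc k → suc k ℕ.≤ suc k′ → dim σ ≤ + k′
  dim-bound σ l (ℕ.s≤s k≤) = subst (λ j → + j - + 1 ≤ _) (sym l) (+≤+ k≤)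

  cases : ∀ ℓ → -1ℤ ≤ ℓ → Hypothesis ℓ → H̃ 𝔽 (Nerve Γ) ℓ dim≤ H̃ 𝔽 X ℓ
  -- Degree k means k + 1 vertices, so the masks to be filled have at most k + 1 members, that is,
  -- dimension at most k.
  cases (+ k) _ h = compare (suc k) λ S j l j≤ S∈ → degree _ j _ l
    (h (members S) (members-unique S) (Face⇒Simplex _ l S∈) (dim-bound (members S) l j≤))
  -- In degree -1 the masks to be filled would be nonempty of size at most zero, so there are none.
  cases -[1+ 0 ] _ h = compare 0 λ _ _ _ ()
  cases -[1+ suc _ ] (-≤- ()) h
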